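{- For $\mathsf K$ any class between $\mathsf{Df}$ and $\mathsf{PEA}$ and any finite $n>2$, the class $\mathsf K_s=\{\mathfrak A\in\mathsf K_n:\mathfrak A\text{ is atomic and }\mathfrak{Cm}\mathrm{At}\mathfrak A\in\mathsf{RK}_n\}$ is not elementary.
   Context: Classes between $\mathsf{Df}$ and $\mathsf{PEA}$: the $n$-dimensional algebras in a signature containing the Boolean operations and cylindrifiers $c_i$ ($\mathsf{Df}_n$) and contained in that of polyadic equality algebras $\mathsf{PEA}_n$ (cylindrifiers $c_i$, diagonals $d_{ij}$, replacements $s^i_j$, transpositions $s_{ij}$, $i,j<n$), such as $\mathsf{Df}$, $\mathsf{Sc}$ (Pinter's substitution algebras: $c_i,s^i_j$), $\mathsf{CA}$ (cylindric algebras: $c_i,d_{ij}$), $\mathsf{PA}$ (polyadic algebras: $c_i,s^i_j,s_{ij}$), $\mathsf{PEA}$. $\mathsf{RK}_n$ is the class of representable algebras in $\mathsf K_n$: those isomorphic to a subalgebra of a direct product of set algebras of the same type (fields of subsets of ${}^nU$ (or $U_0\times\dots\times U_{n-1}$ for $\mathsf{Df}_n$) with $c_iX=\{s:\exists t\in X,\ t_j=s_j\ \forall j\ne i\}$, $d_{ij}=\{s:s_i=s_j\}$, $s^i_jX=\{s:s\circ[i|j]\in X\}$, $s_{ij}X=\{s:s\circ[i,j]\in X\}$, with $[i|j]$ sending $i$ to $j$ and fixing the rest and $[i,j]$ the transposition). For an atomic algebra $\mathfrak A$, $\mathrm{At}\mathfrak A$ is its atom structure and $\mathfrak{Cm}\mathrm{At}\mathfrak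 A$ the complex algebra of this atom structure. -}

module Defs where

open import Level using (Level; _⊔_; 0ℓ) renaming (suc to lsuc)
open import Algebra.Lattice.Structures using (IsBooleanAlgebra)
open import Axiom.ExcludedMiddle using (ExcludedMiddle)
open import Data.Bool.Base using (Bool; true; false; T; if_then_else_) renaming (_∧_ to _∧ᵇ_; _∨_ to _∨ᵇ_; not to notᵇ)
open import Data.Empty.Polymorphic using (⊥)
open import Data.Fin.Base using (Fin; zero; suc)
open import Data.Fin.Permutation.Components using (transpose)
open import Data.Fin.Properties using (_≟_)
open import Data.Nat.Base using (ℕ)
open import Data.Product.Base using (Σ; ∃; ∃-syntax; _×_; _,_; proj₁; proj₂; map₂)
open import Data.Sum.Base using (_⊎_)
open import Data.Unit.Base using (tt)
open import Data.Vec.Functional using (Vector; []; _∷_)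
open import Function.Base using (_∘_)
open import Function.Bundles using (Func; Bijection; _⇔_; mk⇔)
open import Relation.Binary.Bundles using (Setoid)
open import Relation.Binary.PropositionalEquality as ≡ using (_≡_; _≢_; refl)
open import Relation.Nullary.Decidable.Core using (does)
open import Relation.Nullary.Decidable using (does-⇔)
open import Relation.Nullary.Negation.Core using (¬_; contradiction)
open import Relation.Unary using (Pred; _∈_)

private
  variable
    n : ℕ

-- Sets are rendered as setoids at a fixed level ℓ. The mathematics is
-- classical: excluded middle is passed explicitly, and under it subsets of a
-- setoid are exactly its Bool-valued maps.

data Extra (n : ℕ) : Set where
  diag repl swap : (i j : Fin n) → Extra n

-- The Boolean operations and cylindrifiers are always present; the Boolean
-- function says which of d_ij, s^i_j, s_ij are present as well.
Signature : ℕ → Set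
Signature n = Extra n → Bool

∅ full : Signature n
∅ _    = false
full _ = true

data BooleanSymbol : Set where
  join meet compl top bot : BooleanSymbol

data Operator {n : ℕ} (τ : Signature n) : Set where
  cyl : Fin n → Operator τ
  ext : (e : Extra n) → T (τ e) → Operator τ

data Symbol {n : ℕ} (τ : Signature n) : Set where
  bool : BooleanSymbol → Symbol τ
  op   : Operator τ → Symbol τ

booleanArity : BooleanSymbol → ℕ
booleanArity join  = 2
booleanArity meet  = 2
booleanArity compl = 1
booleanArity top   = 0
booleanArity bot   = 0

extraArity : Extra n → ℕ
extraArity (diag _ _) = 0
extraArity (repl _ _) = 1
extraArity (swap _ _) = 1

operatorArity : {τ : Signature n} → Operator τ → ℕ
operatorArity (cyl _)   = 1
operatorArity (ext e _) = extraArity e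

arity : {τ : Signature n} → Symbol τ → ℕ
arity (bool b) = booleanArity b
arity (op o)   = operatorArity o

-- Arbitrary structures of the signature; no axioms are imposed here.
record Algebra {n : ℕ} (τ : Signature n) (ℓ : Level) : Set (lsuc ℓ) where
  field
    setoid : Setoid ℓ ℓ
  open Setoid setoid public using (Carrier; _≈_; isEquivalence)
  field
    ⟦_⟧    : (f : Symbol τ) → Vector Carrier (arity f) → Carrier
    ⟦⟧-cong : ∀ f {xs ys} → (∀ k → xs k ≈ ys k) → ⟦ f ⟧ xs ≈ ⟦ f ⟧ ys

  infixr 7 _∧_
  infixr 6 _∨_
  infix  4 _≤_

  _∨_ _∧_ : Carrier → Carrier → Carrier
  x ∨ y = ⟦ bool join ⟧ (x ∷ y ∷ [])
  x ∧ y = ⟦ bool meet ⟧ (x ∷ y ∷ [])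

  ∁ : Carrier → Carrier
  ∁ x = ⟦ bool compl ⟧ (x ∷ [])

  𝟙 𝟘 : Carrier
  𝟙 = ⟦ bool top ⟧ []
  𝟘 = ⟦ bool bot ⟧ []

  c : Fin n → Carrier → Carrier
  c i x = ⟦ op (cyl i) ⟧ (x ∷ [])

  _≤_ : Carrier → Carrier → Set ℓ
  x ≤ y = x ∧ y ≈ x

_⊆_ : Signature n → Signature n → Set
σ ⊆ τ = ∀ e → T (σ e) → T (τ e)

reduct : ∀ {ℓ} {σ τ : Signature n} → σ ⊆ τ → Algebra τ ℓ → Algebra σ ℓ
reduct {σ = σ} inc A = record
  { setoid  = setoid
  ; ⟦_⟧     = interp
  ; ⟦⟧-cong = interp-cong
  }
  where
  open Algebra A
  interp : (f : Symbol σ) → Vector Carrier (arity f) → Carrier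
  interp (bool b)         = ⟦ bool b ⟧
  interp (op (cyl i))     = ⟦ op (cyl i) ⟧
  interp (op (ext e p))   = ⟦ op (ext e (inc e p)) ⟧
  interp-cong : ∀ f {xs ys} → (∀ k → xs k ≈ ys k) → interp f xs ≈ interp f ys
  interp-cong (bool b)       = ⟦⟧-cong (bool b)
  interp-cong (op (cyl i))   = ⟦⟧-cong (op (cyl i))
  interp-cong (op (ext e p)) = ⟦⟧-cong (op (ext e (inc e p)))

infix 4 _≅_

record _≅_ {ℓ} {τ : Signature n} (A B : Algebra τ ℓ) : Set ℓ where
  private
    module A = Algebra A
    module B = Algebra B
  field
    bijection : Bijection A.setoid B.setoid
  open Bijection bijection public using (to)
  field
    homo : ∀ f xs → to (A.⟦ f ⟧ xs) B.≈ B.⟦ f ⟧ (to ∘ xs)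

record Subuniverse {ℓ} {τ : Signature n} (A : Algebra τ ℓ) : Set (lsuc ℓ) where
  open Algebra A
  field
    Member   : Pred Carrier ℓ
    respects : ∀ {x y} → x ≈ y → Member x → Member y
    closed   : ∀ f xs → (∀ k → Member (xs k)) → Member (⟦ f ⟧ xs)

subalgebra : ∀ {ℓ} {τ : Signature n} (A : Algebra τ ℓ) → Subuniverse A → Algebra τ ℓ
subalgebra A S = record
  { setoid = record
    { Carrier       = Σ Carrier Member
    ; _≈_           = λ x y → proj₁ x ≈ proj₁ y
    ; isEquivalence = record { refl = E.refl ; sym = E.sym ; trans = E.trans }
    }
  ; ⟦_⟧     = λ f xs → ⟦ f ⟧ (proj₁ ∘ xs) , closed f (proj₁ ∘ xs) (proj₂ ∘ xs)
  ; ⟦⟧-cong = λ f eq → ⟦⟧-cong f eq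
  }
  where
  open Algebra A
  open Subuniverse S
  module E = Setoid setoid

product : ∀ {ℓ} {τ : Signature n} {I : Set ℓ} → (I → Algebra τ ℓ) → Algebra τ ℓ
product {I = I} A = record
  { setoid = record
    { Carrier       = (i : I) → A.Carrier i
    ; _≈_           = λ x y → ∀ i → A._≈_ i (x i) (y i)
    ; isEquivalence = record
      { refl  = λ i → E.refl i
      ; sym   = λ p i → E.sym i (p i)
      ; trans = λ p q i → E.trans i (p i) (q i)
      }
    }
  ; ⟦_⟧     = λ f xs i → A.⟦_⟧ i f (λ k → xs k i)
  ; ⟦⟧-cong = λ f eq i → A.⟦⟧-cong i f (λ k → eq k i)
  }
  where
  module A (i : I) = Algebra (A i)
  module E (i : I) = Setoid (A.setoid i)

IsBoolean : ∀ {ℓ} {τ : Signature n} → Algebra τ ℓ → Set ℓ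
IsBoolean A = IsBooleanAlgebra _≈_ _∨_ _∧_ ∁ 𝟙 𝟘
  where open Algebra A

record Df {n : ℕ} {ℓ : Level} (A : Algebra {n} ∅ ℓ) : Set ℓ where
  open Algebra A
  field
    isBoolean : IsBoolean A
    c-𝟘       : ∀ i → c i 𝟘 ≈ 𝟘
    c-incr    : ∀ i x → x ≤ c i x
    c-∧-c     : ∀ i x y → c i (x ∧ c i y) ≈ c i x ∧ c i y
    c-comm    : ∀ i j x → c i (c j x) ≈ c j (c i x)

module PEA-operations {n : ℕ} {ℓ : Level} (A : Algebra {n} full ℓ) where
  open Algebra A

  d : Fin n → Fin n → Carrier
  d i j = ⟦ op (ext (diag i j) tt) ⟧ []

  -- s i j is s^i_j (replace i by j), p i j is the transposition s_ij
  s p : Fin n → Fin n → Carrier → Carrier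
  s i j x = ⟦ op (ext (repl i j) tt) ⟧ (x ∷ [])
  p i j x = ⟦ op (ext (swap i j) tt) ⟧ (x ∷ [])

-- The Sain–Thompson axioms for finitary polyadic equality algebras, which for
-- finite n axiomatise PEA_n in the signature c_i, d_ij, s^i_j, s_ij.
record PEA {n : ℕ} {ℓ : Level} (A : Algebra {n} full ℓ) : Set ℓ where
  open Algebra A

  open PEA-operations A
  field
    isBoolean : IsBoolean A
    s-id      : ∀ i x → s i i x ≈ x
    p-id      : ∀ i x → p i i x ≈ x
    p-sym     : ∀ i j x → p i j x ≈ p j i x
    c-incr    : ∀ i x → x ≤ c i x
    c-∨       : ∀ i x y → c i (x ∨ y) ≈ c i x ∨ c i y
    s-c       : ∀ i j x → s i j (c i x) ≈ c i x
    c-s       : ∀ i j x → i ≢ j → c i (s i j x) ≈ s i j x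
    s-c-comm  : ∀ i j k x → k ≢ i → k ≢ j → s i j (c k x) ≈ c k (s i j x)
    s-∨       : ∀ i j x y → s i j (x ∨ y) ≈ s i j x ∨ s i j y
    s-∁       : ∀ i j x → s i j (∁ x) ≈ ∁ (s i j x)
    p-∨       : ∀ i j x y → p i j (x ∨ y) ≈ p i j x ∨ p i j y
    p-∁       : ∀ i j x → p i j (∁ x) ≈ ∁ (p i j x)
    p-p       : ∀ i j x → p i j (p i j x) ≈ x
    p-p-distinct : ∀ i j k x → i ≢ j → i ≢ k → j ≢ k →
                   p i j (p i k x) ≈ p j k (p i j x)
    p-s       : ∀ i j x → p i j (s i j x) ≈ s j i x
    s-d       : ∀ i j → s i j (d i j) ≈ 𝟙
    ∧-d       : ∀ i j x → x ∧ d i j ≤ s i j x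

-- Sc_n, CA_n, PA_n and the classes in intermediate signatures are covered
-- uniformly: K lies between Df_n and PEA_n when it is closed under isomorphism,
-- its members have Df_n-reducts, and it contains the reducts of all PEA_n's.
record Between {n : ℕ} {ℓ k : Level} {τ : Signature n}
               (K : Pred (Algebra τ ℓ) k) : Set (lsuc ℓ ⊔ k) where
  field
    resp-≅   : ∀ {A B} → A ≅ B → A ∈ K → B ∈ K
    below-Df : ∀ {A} → A ∈ K → Df (reduct (λ _ ()) A)
    above-PEA : ∀ {A} → PEA A → reduct (λ _ _ → tt) A ∈ K

module _ {ℓ : Level} {τ : Signature n} (A : Algebra τ ℓ) where
  open Algebra A

  IsAtom : Pred Carrier ℓ
  IsAtom a = ¬ (a ≈ 𝟘) × (∀ x → x ≤ a → x ≈ 𝟘 ⊎ x ≈ a)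

  Atomic : Set ℓ
  Atomic = ∀ x → ¬ (x ≈ 𝟘) → ∃[ a ] IsAtom a × a ≤ x

-- For an operator f, R f a as stands for a ≤ f(as) (unary for the constants
-- d_ij).
record AtomStructure {n : ℕ} (τ : Signature n) (ℓ : Level) : Set (lsuc ℓ) where
  field
    setoid : Setoid ℓ ℓ
  open Setoid setoid public using (Carrier; _≈_)
  field
    R      : (o : Operator τ) → Carrier → Vector Carrier (operatorArity o) → Set ℓ
    R-resp : ∀ o {a b as bs} → a ≈ b → (∀ k → as k ≈ bs k) → R o a as → R o b bs

At : ∀ {ℓ} {τ : Signature n} (A : Algebra τ ℓ) → AtomStructure τ ℓ
At A = record
  { setoid = record
    { Carrier       = Σ Carrier (IsAtom A)
    ; _≈_           = λ a b → proj₁ a ≈ proj₁ b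
    ; isEquivalence = record { refl = E.refl ; sym = E.sym ; trans = E.trans }
    }
  ; R      = λ o a as → proj₁ a ≤ ⟦ op o ⟧ (proj₁ ∘ as)
  ; R-resp = λ o a≈b as≈bs a≤ →
      E.trans (⟦⟧-cong (bool meet) λ { zero → E.sym a≈b ; (suc zero) → ⟦⟧-cong (op o) (λ k → E.sym (as≈bs k)) })
              (E.trans a≤ a≈b)
  }
  where
  open Algebra A
  module E = Setoid setoid

Subset : ∀ {ℓ} → Setoid ℓ ℓ → Set ℓ
Subset S = Func S (≡.setoid Bool)

module _ {ℓ : Level} {S : Setoid ℓ ℓ} where
  open Setoid S using (Carrier; _≈_; sym)

  infix 4 _∈ˢ_ _≐ˢ_

  _∈ˢ_ : Carrier → Subset S → Set
  s ∈ˢ X = Func.to X s ≡ true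

  _≐ˢ_ : Subset S → Subset S → Set ℓ
  X ≐ˢ Y = ∀ s → Func.to X s ≡ Func.to Y s

  comprehension : ExcludedMiddle ℓ → (P : Carrier → Set ℓ) →
                  (∀ {s t} → s ≈ t → P s → P t) → Subset S
  comprehension em P resp = record
    { to   = λ s → does (em {P s})
    ; cong = λ s≈t → does-⇔ (mk⇔ (resp s≈t) (resp (sym s≈t))) em em
    }

  comprehension-cong : (em : ExcludedMiddle ℓ) {P Q : Carrier → Set ℓ} →
                       (rP : ∀ {s t} → s ≈ t → P s → P t) →
                       (rQ : ∀ {s t} → s ≈ t → Q s → Q t) →
                       (∀ s → P s → Q s) → (∀ s → Q s → P s) →
                       comprehension em P rP ≐ˢ comprehension em Q rQ
  comprehension-cong em rP rQ f g s = does-⇔ (mk⇔ (f s) (g s)) em em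

  booleanOp : (b : BooleanSymbol) → Vector (Subset S) (booleanArity b) → Subset S
  booleanOp join Xs = record
    { to   = λ s → Func.to (Xs zero) s ∨ᵇ Func.to (Xs (suc zero)) s
    ; cong = λ e → ≡.cong₂ _∨ᵇ_ (Func.cong (Xs zero) e) (Func.cong (Xs (suc zero)) e)
    }
  booleanOp meet Xs = record
    { to   = λ s → Func.to (Xs zero) s ∧ᵇ Func.to (Xs (suc zero)) s
    ; cong = λ e → ≡.cong₂ _∧ᵇ_ (Func.cong (Xs zero) e) (Func.cong (Xs (suc zero)) e)
    }
  booleanOp compl Xs = record
    { to   = λ s → notᵇ (Func.to (Xs zero) s)
    ; cong = λ e → ≡.cong notᵇ (Func.cong (Xs zero) e)
    }
  booleanOp top _ = record { to = λ _ → true  ; cong = λ _ → refl }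
  booleanOp bot _ = record { to = λ _ → false ; cong = λ _ → refl }

  booleanOp-cong : ∀ b {Xs Ys} → (∀ k → Xs k ≐ˢ Ys k) → booleanOp b Xs ≐ˢ booleanOp b Ys
  booleanOp-cong join  e s = ≡.cong₂ _∨ᵇ_ (e zero s) (e (suc zero) s)
  booleanOp-cong meet  e s = ≡.cong₂ _∧ᵇ_ (e zero s) (e (suc zero) s)
  booleanOp-cong compl e s = ≡.cong notᵇ (e zero s)
  booleanOp-cong top   e s = refl
  booleanOp-cong bot   e s = refl

powerAlgebra : ∀ {ℓ} {τ : Signature n} (S : Setoid ℓ ℓ)
  (f : (o : Operator τ) → Vector (Subset S) (operatorArity o) → Subset S) →
  (∀ o {Xs Ys} → (∀ k → Xs k ≐ˢ Ys k) → f o Xs ≐ˢ f o Ys) →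
  Algebra τ ℓ
powerAlgebra {τ = τ} S f f-cong = record
  { setoid = record
    { Carrier       = Subset S
    ; _≈_           = _≐ˢ_
    ; isEquivalence = record
      { refl  = λ _ → refl
      ; sym   = λ p s → ≡.sym (p s)
      ; trans = λ p q s → ≡.trans (p s) (q s)
      }
    }
  ; ⟦_⟧     = interp
  ; ⟦⟧-cong = interp-cong
  }
  where
  interp : (g : Symbol τ) → Vector (Subset S) (arity g) → Subset S
  interp (bool b) = booleanOp b
  interp (op o)   = f o
  interp-cong : ∀ g {Xs Ys} → (∀ k → Xs k ≐ˢ Ys k) → interp g Xs ≐ˢ interp g Ys
  interp-cong (bool b) = booleanOp-cong b
  interp-cong (op o)   = f-cong o

Sequences : ∀ {ℓ} → (Fin n → Setoid ℓ ℓ) → Setoid ℓ ℓ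
Sequences U = record
  { Carrier       = ∀ i → U.Carrier i
  ; _≈_           = λ s t → ∀ i → U._≈_ i (s i) (t i)
  ; isEquivalence = record
    { refl  = λ i → U.refl i
    ; sym   = λ p i → U.sym i (p i)
    ; trans = λ p q i → U.trans i (p i) (q i)
    }
  }
  where module U i = Setoid (U i)

-- Units ⁿU in every signature; units U₀ × … × Uₙ₋₁ only in the signature of Df.
data Base {n : ℕ} (τ : Signature n) (ℓ : Level) : Set (lsuc ℓ) where
  cube : Setoid ℓ ℓ → Base τ ℓ
  box  : τ ⊆ ∅ → (Fin n → Setoid ℓ ℓ) → Base τ ℓ

factors : ∀ {ℓ} {τ : Signature n} → Base τ ℓ → Fin n → Setoid ℓ ℓ
factors (cube U)  = λ _ → U
factors (box _ U) = U

[_∣_] : Fin n → Fin n → Fin n → Fin n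
[ i ∣ j ] k = if does (k ≟ i) then j else k

module _ {ℓ : Level} (em : ExcludedMiddle ℓ) where

  private
    preimage : (U : Setoid ℓ ℓ) → (Fin n → Fin n) →
               Subset (Sequences {n} (λ _ → U)) → Subset (Sequences {n} (λ _ → U))
    preimage U σ X = record
      { to   = λ s → Func.to X (s ∘ σ)
      ; cong = λ e → Func.cong X (e ∘ σ)
      }

  module _ (U : Fin n → Setoid ℓ ℓ) where
    private module U i = Setoid (U i)

    private
      C : Fin n → Subset (Sequences U) → (∀ i → U.Carrier i) → Set ℓ
      C i X s = ∃[ t ] t ∈ˢ X × (∀ j → j ≢ i → U._≈_ j (t j) (s j))

      C-resp : ∀ i X {s s′} → (∀ j → U._≈_ j (s j) (s′ j)) → C i X s → C i X s′
      C-resp i X e = map₂ (map₂ (λ p j j≢i → U.trans j (p j j≢i) (e j)))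

      C-mono : ∀ i X Y → X ≐ˢ Y → ∀ s → C i X s → C i Y s
      C-mono i X Y e s (t , t∈X , p) = t , ≡.trans (≡.sym (e t)) t∈X , p

    cylindrify : Fin n → Subset (Sequences U) → Subset (Sequences U)
    cylindrify i X = comprehension em (C i X) (C-resp i X)

    cylindrify-cong : ∀ i X Y → X ≐ˢ Y → cylindrify i X ≐ˢ cylindrify i Y
    cylindrify-cong i X Y e = comprehension-cong {S = Sequences U} em (C-resp i X) (C-resp i Y)
      (C-mono i X Y e) (C-mono i Y X (λ s → ≡.sym (e s)))

  module _ (U : Setoid ℓ ℓ) where
    private module U = Setoid U

    extraOp : (e : Extra n) → Vector (Subset (Sequences {n} (λ _ → U))) (extraArity e) →
              Subset (Sequences {n} (λ _ → U))
    extraOp (diag i j) _  = comprehension em (λ s → s i U.≈ s j)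
      (λ e p → U.trans (U.sym (e i)) (U.trans p (e j)))
    extraOp (repl i j) Xs = preimage U [ i ∣ j ] (Xs zero)
    extraOp (swap i j) Xs = preimage U (transpose i j) (Xs zero)

    extraOp-cong : (e : Extra n) → ∀ {Xs Ys} → (∀ k → Xs k ≐ˢ Ys k) →
                   extraOp e Xs ≐ˢ extraOp e Ys
    extraOp-cong (diag i j) eq s = refl
    extraOp-cong (repl i j) eq s = eq zero (s ∘ [ i ∣ j ])
    extraOp-cong (swap i j) eq s = eq zero (s ∘ transpose i j)

  fullSetAlgebra : {τ : Signature n} → Base τ ℓ → Algebra τ ℓ
  fullSetAlgebra {n} {τ} B = powerAlgebra (Sequences (factors B)) (interp B) (interp-cong B)
    where
    interp : (B : Base τ ℓ) (o : Operator τ) →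
             Vector (Subset (Sequences (factors B))) (operatorArity o) →
             Subset (Sequences (factors B))
    interp B         (cyl i)   Xs = cylindrify (factors B) i (Xs zero)
    interp (cube U)  (ext e _) Xs = extraOp U e Xs
    interp (box z _) (ext e p) Xs = contradiction p (z e)
    interp-cong : ∀ B o {Xs Ys} → (∀ k → Xs k ≐ˢ Ys k) → interp B o Xs ≐ˢ interp B o Ys
    interp-cong B         (cyl i)   {Xs} {Ys} eq =
      cylindrify-cong (factors B) i (Xs zero) (Ys zero) (eq zero)
    interp-cong (cube U)  (ext e _) eq = extraOp-cong U e eq
    interp-cong (box z _) (ext e p) eq = contradiction p (z e)

  record SetAlgebra (τ : Signature n) : Set (lsuc ℓ) where
    field
      base       : Base τ ℓ
      fieldOfSets : Subuniverse (fullSetAlgebra base)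

    algebra : Algebra τ ℓ
    algebra = subalgebra (fullSetAlgebra base) fieldOfSets

  record Representable {τ : Signature n} (A : Algebra τ ℓ) : Set (lsuc ℓ) where
    field
      Index       : Set ℓ
      setAlgebras : Index → SetAlgebra τ
      sub         : Subuniverse (product (SetAlgebra.algebra ∘ setAlgebras))
      iso         : A ≅ subalgebra (product (SetAlgebra.algebra ∘ setAlgebras)) sub

  R[_] : ∀ {k} {τ : Signature n} → Pred (Algebra τ ℓ) k → Pred (Algebra τ ℓ) (lsuc ℓ ⊔ k)
  R[ K ] A = A ∈ K × Representable A

  𝕮𝖒 : {τ : Signature n} → AtomStructure τ ℓ → Algebra τ ℓ
  𝕮𝖒 {τ = τ} F = powerAlgebra setoid
    (λ o Xs → comprehension em (M o Xs) (M-resp o Xs))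
    (λ o {Xs} {Ys} eq → comprehension-cong {S = setoid} em (M-resp o Xs) (M-resp o Ys)
      (M-mono o Xs Ys eq) (M-mono o Ys Xs (λ k a → ≡.sym (eq k a))))
    where
    open AtomStructure F
    Args : Operator τ → Set ℓ
    Args o = Vector (Subset setoid) (operatorArity o)
    M : (o : Operator τ) → Args o → Carrier → Set ℓ
    M o Xs a = ∃[ as ] (∀ k → as k ∈ˢ Xs k) × R o a as
    M-resp : ∀ o (Xs : Args o) {a b} → a ≈ b → M o Xs a → M o Xs b
    M-resp o Xs e = map₂ (map₂ (R-resp o e (λ _ → Setoid.refl setoid)))
    M-mono : ∀ o (Xs Ys : Args o) → (∀ k → Xs k ≐ˢ Ys k) → ∀ a → M o Xs a → M o Ys a
    M-mono o Xs Ys eq _ (as , m , r) =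
      as , (λ k → ≡.trans (≡.sym (eq k (as k))) (m k)) , r

  _ₛ : ∀ {k} {τ : Signature n} → Pred (Algebra τ ℓ) k → Pred (Algebra τ ℓ) (lsuc ℓ ⊔ k)
  (K ₛ) A = A ∈ K × Atomic A × 𝕮𝖒 (At A) ∈ R[ K ]

data Term {n : ℕ} (τ : Signature n) (m : ℕ) : Set where
  var : Fin m → Term τ m
  fun : (f : Symbol τ) → (Fin (arity f) → Term τ m) → Term τ m

-- Formulas with m free (de Bruijn) variables; the remaining connectives are
-- classically definable.
data Formula {n : ℕ} (τ : Signature n) : ℕ → Set where
  _≐_ : ∀ {m} → Term τ m → Term τ m → Formula τ m
  ⊥̇   : ∀ {m} → Formula τ m
  _⇒_ : ∀ {m} → Formula τ m → Formula τ m → Formula τ m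
  ∀̇_  : ∀ {m} → Formula τ (ℕ.suc m) → Formula τ m

Sentence : Signature n → Set
Sentence τ = Formula τ 0

module _ {ℓ : Level} {τ : Signature n} (A : Algebra τ ℓ) where
  open Algebra A

  eval : ∀ {m} → Vector Carrier m → Term τ m → Carrier
  eval ρ (var x)    = ρ x
  eval ρ (fun f ts) = ⟦ f ⟧ (λ k → eval ρ (ts k))

  Satisfies : ∀ {m} → Vector Carrier m → Formula τ m → Set ℓ
  Satisfies ρ (t ≐ u) = eval ρ t ≈ eval ρ u
  Satisfies ρ ⊥̇       = ⊥
  Satisfies ρ (φ ⇒ ψ) = Satisfies ρ φ → Satisfies ρ ψ
  Satisfies ρ (∀̇ φ)   = ∀ x → Satisfies (x ∷ ρ) φ

infix 4 _⊨_

_⊨_ : ∀ {ℓ} {τ : Signature n} → Algebra τ ℓ → Pred (Sentence τ) 0ℓ → Set ℓ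
A ⊨ Γ = ∀ φ → φ ∈ Γ → Satisfies A [] φ

-- Γ may be infinite: this is the class of models of a first-order theory.
Elementary : ∀ {ℓ k} {τ : Signature n} → Pred (Algebra τ ℓ) k → Set (lsuc ℓ ⊔ k)
Elementary {τ = τ} K = ∃[ Γ ] (∀ A → A ∈ K ⇔ A ⊨ Γ)

{-# OPTIONS --safe #-}

-- All algebras used have as atoms the types of n-tuples in coloured simplices: a
-- simplex on n points has a colour on each face of n − 1 points, no three of its
-- faces clash, and the type of a tuple records its equalities and, if it spans a
-- face, the colour of that face. Such an algebra is representable once the faces
-- of some linear order are labelled by ultrafilters on the colours in such a way
-- that every simplex over a given face is realised by a later point. It is not
-- representable if colours fall into classes (m , i) with finitely many indices i
-- such that two colours of class (m , i) clash with any third one of index i: for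
-- apexes x, y, … over one base in a representation, let β x y be the class of the
-- third face of the simplex with apexes x and y. If β u v = β u w = (m , i), then
-- β v w does not have the index i. Restricting to a large fibre of β u therefore
-- removes an index, and the indices run out.
--
-- Excluded middle alone does not yield a nonprincipal ultrafilter on ℕ, so there
-- are two cases. Given such an ultrafilter 𝓓, let the colours of the m-th algebra
-- be lists of m numbers with an index, three of which clash when they have the
-- same index and no two are shifts of each other by less than n places. Windows
-- of a 𝓓-generic list all have the same type but are pairwise shifts, so these
-- algebras are representable. In a countable elementary subalgebra of their
-- ultraproduct lists become infinite sequences, which are coloured properly by
-- their offset modulo n from a chosen sequence in their shift class; hence its
-- completion is not representable.
--
-- If every ultrafilter on ℕ is principal, take a set X of green colours, three of
-- which clash, and blue ones numbered by ℕ with an index, clashing when they have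
-- the same index and two of them the same number. The subalgebra of elements
-- supported by finitely many greens has a complex algebra that is representable
-- for X = ℕ, as ultrafilters on the colours are then points. For X = 2^ℕ it is
-- not, as X is not a countable union of countable sets. But by a back-and-forth
-- argument the two subalgebras satisfy the same sentences.

module Submission where

open import Defs
open import Axiom.ExcludedMiddle using (ExcludedMiddle)
open import Data.Bool.Base using (Bool; true; false) renaming (_∧_ to _∧ᵇ_; _∨_ to _∨ᵇ_; not to notᵇ)
import Data.Bool.Properties as Bool
open import Data.Empty using (⊥; ⊥-elim)
open import Data.Fin.Base using (Fin; zero; suc; toℕ; fromℕ<; punchIn; punchOut; combine)
open import Data.Fin.Permutation.Components using (transpose; transpose-inverse)
import Data.Fin.Properties as Fin
import Data.List.Base as L
open import Data.List.Base using (List)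
open import Data.List.Membership.Propositional using () renaming (_∈_ to _∈ˡ_)
open import Data.List.Membership.Propositional.Properties using (∈-++⁺ˡ; ∈-++⁺ʳ; ∈-filter⁺; ∈-allFin)
open import Data.List.Properties using (filter-notAll)
import Data.List.Relation.Unary.Any as Any
open import Data.List.Relation.Unary.Any using (here; there)
open import Data.List.Relation.Unary.Any.Properties using (lookup-index)
open import Data.Maybe.Base using (Maybe; just; nothing; fromMaybe)
open import Data.Nat.Base using (ℕ; zero; suc; _+_; _*_; _^_; _∸_; _≤_; _<_; z≤n; s≤s; >-nonZero)
open import Data.Nat.DivMod using (_%_; _/_; m≡m%n+[m/n]*n; m%n<n; [m+kn]%n≡m%n)
open import Data.Nat.Divisibility using (divides; ∣m+n∣m⇒∣n; ∣⇒≤)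
import Data.Nat.Properties as ℕ
open import Data.Nat.Solver using (module +-*-Solver)
open import Data.Product.Base using (Σ; ∃; _×_; _,_; proj₁; proj₂)
import Data.Sum.Base as Sum
open import Data.Sum.Base using (_⊎_; inj₁; inj₂)
open import Data.Unit.Base using (⊤; tt)
open import Data.Vec.Functional using (Vector; []; _∷_)
open import Function.Base using (_∘_; id; case_of_)
open import Function.Bundles using (Func; Bijection; Equivalence)
open import Level using (Level; _⊔_; 0ℓ; Lift; lift; lower) renaming (suc to lsuc)
open import Relation.Binary.Bundles using (Setoid)
open import Relation.Binary.Definitions using (tri<; tri≈; tri>)
open import Relation.Binary.PropositionalEquality using (_≡_; _≢_; refl; sym; trans; cong; cong₂; subst; subst₂)
open import Relation.Nullary.Decidable using (¬?)
open import Relation.Nullary.Decidable.Core using (Dec; yes; no; does)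
open import Relation.Nullary.Negation.Core using (¬_; contradiction)
open import Relation.Unary using (Pred; _∈_)

-- Ultrafilters

-- The number of indices is dictated by the dimension. A point placed over a face of `N` points
-- creates `N` further faces of their common simplex, and the ultrafilter on each of these
-- concentrates on at most one index. With `n = N + 1` indices one of them stays free for all other
-- faces below that point, and colours of different indices never clash.
--
-- The obstruction has to work in every signature down to that of `Df`, where the coordinates of a
-- unit may range over unrelated sets. It therefore uses Boolean operations and cylindrifiers only:
-- sets of atoms replace the diagonals, and every apex is copied into three coordinates. The
-- representations, on the other hand, are built in the full signature and passed on to reducts.
--
-- Function extensionality is not assumed. Excluded middle for a Σ-type returns a witness, but that
-- witness need not respect pointwise equality. Hence points, simplices and elements are compared by
-- explicit equivalences, and a choice that has to respect one of them takes the least candidate.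

module Classical (em : ∀ {a} → ExcludedMiddle a) where

  ⌊_⌋ : ∀ {a} → Set a → Bool
  ⌊ P ⌋ = does (em {P = P})

  ⌊⌋-intro : ∀ {a} {P : Set a} → P → ⌊ P ⌋ ≡ true
  ⌊⌋-intro {P = P} p with em {P = P}
  ... | yes _ = refl
  ... | no ¬p = contradiction p ¬p

  ⌊⌋-elim : ∀ {a} {P : Set a} → ⌊ P ⌋ ≡ true → P
  ⌊⌋-elim {P = P} e with em {P = P}
  ... | yes p = p

  ⌊⌋-cong : ∀ {a b} {P : Set a} {Q : Set b} → (P → Q) → (Q → P) → ⌊ P ⌋ ≡ ⌊ Q ⌋
  ⌊⌋-cong {P = P} {Q} f g with em {P = P} | em {P = Q}
  ... | yes p | yes q = refl
  ... | yes p | no ¬q = contradiction (f p) ¬q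
  ... | no ¬p | yes q = contradiction (g q) ¬p
  ... | no ¬p | no ¬q = refl

  stable : ∀ {a} {P : Set a} → ¬ ¬ P → P
  stable {P = P} nn with em {P = P}
  ... | yes p = p
  ... | no ¬p = contradiction ¬p nn

  true≢false : ∀ {b} → b ≡ true → b ≡ false → ⊥
  true≢false refl ()

  ≡true : ∀ {a b : Bool} → (a ≡ true → b ≡ true) → (b ≡ true → a ≡ true) → a ≡ b
  ≡true {false} {false} f g = refl
  ≡true {false} {true}  f g = g refl
  ≡true {true}  {b}     f g = sym (f refl)

  ∧-intro : ∀ {a b} → a ≡ true → b ≡ true → a ∧ᵇ b ≡ true
  ∧-intro refl refl = refl

  ∧-elim₁ : ∀ {a b} → a ∧ᵇ b ≡ true → a ≡ true
  ∧-elim₁ {true} _ = refl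

  ∧-elim₂ : ∀ {a b} → a ∧ᵇ b ≡ true → b ≡ true
  ∧-elim₂ {true} e = e

  not-elim : ∀ {a} → notᵇ a ≡ true → a ≡ false
  not-elim {false} _ = refl

  -- Excluded middle returns an arbitrary witness; the least one depends only on the extension of
  -- `P`, as `least-unique` records.
  least : ∀ {a} (P : ℕ → Set a) → ∃ P → ∃ λ m → P m × (∀ j → P j → m ≤ j)
  least P (m , pm) = go m (m , pm , ℕ.≤-refl)
    where
    go : ∀ b → (∃ λ m → P m × m ≤ b) → ∃ λ m → P m × (∀ j → P j → m ≤ j)
    go zero (m , pm , z≤n) = m , pm , λ _ _ → z≤n
    go (suc b) (m , pm , m≤) with em {P = ∃ λ j → P j × j ≤ b}
    ... | yes q = go b q
    ... | no ¬q = m , pm , λ j pj → ℕ.≤-trans m≤ (ℕ.≰⇒> λ j≤b → ¬q (j , pj , j≤b))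

  least-unique : ∀ {a} {P Q : ℕ → Set a} → (∀ j → P j → Q j) → (∀ j → Q j → P j) →
                 (p : ∃ P) (q : ∃ Q) → proj₁ (least P p) ≡ proj₁ (least Q q)
  least-unique {P = P} {Q} f g p q with least P p | least Q q
  ... | m , pm , lm | m′ , qm , lm′ = ℕ.≤-antisym (lm m′ (g m′ qm)) (lm′ m (f m pm))

  -- The last index is returned untested, which makes the search total; `first-true` only asks that
  -- some index qualifies.
  first : ∀ {r} → (Fin (suc r) → Bool) → Fin (suc r)
  first {zero}  b = zero
  first {suc r} b with b zero
  ... | true  = zero
  ... | false = suc (first (b ∘ suc))

  first-true : ∀ {r} (b : Fin (suc r) → Bool) i → b i ≡ true → b (first b) ≡ true
  first-true {zero}  b zero e = e
  first-true {suc r} b i e with b zero in eq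
  ... | true = eq
  first-true {suc r} b zero e    | false = ⊥-elim (true≢false e eq)
  first-true {suc r} b (suc i) e | false = first-true (b ∘ suc) i e

  first-cong : ∀ {r} (b c : Fin (suc r) → Bool) → (∀ i → b i ≡ c i) → first b ≡ first c
  first-cong {zero}  b c e = refl
  first-cong {suc r} b c e with b zero | c zero | e zero
  ... | true  | _ | refl = refl
  ... | false | _ | refl = cong suc (first-cong (b ∘ suc) (c ∘ suc) (e ∘ suc))

  Inj : ∀ {a r} {A : Set a} → (Fin r → A) → Set a
  Inj f = ∀ i j → f i ≡ f j → i ≡ j

  injective⇒onto : ∀ {r} (f : Fin r → Fin r) → Inj f → ∀ y → ∃ λ x → f x ≡ y
  injective⇒onto {zero} f inj ()
  injective⇒onto {suc r} f inj y with em {P = ∃ λ x → f x ≡ y}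
  ... | yes p = p
  ... | no ¬p = ⊥-elim (ℕ.1+n≰n (Fin.injective⇒≤ {f = λ i → punchOut (avoids i)}
                  λ {i} {j} e → inj i j (Fin.punchOut-injective (avoids i) (avoids j) e)))
    where
    avoids : ∀ i → y ≢ f i
    avoids i e = ¬p (i , sym e)

  missing : ∀ {r} (f : Fin r → Fin (suc r)) → ∃ λ m → ∀ i → f i ≢ m
  missing {r} f with em {P = ∃ λ m → ∀ i → f i ≢ m}
  ... | yes p = p
  ... | no ¬p = ⊥-elim (ℕ.1+n≰n (Fin.injective⇒≤ {f = proj₁ ∘ pre}
                  λ {i} {j} e → trans (sym (proj₂ (pre i))) (trans (cong f e) (proj₂ (pre j)))))
    where
    pre : ∀ m → ∃ λ i → f i ≡ m
    pre m = stable λ ¬q → ¬p (m , λ i e → ¬q (i , e))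

  cons-inj : ∀ {a r} {A : Set a} {f : Fin r → A} {m} → Inj f → (∀ i → f i ≢ m) → Inj (m ∷ f)
  cons-inj inj ms zero    zero    e = refl
  cons-inj inj ms zero    (suc j) e = ⊥-elim (ms j (sym e))
  cons-inj inj ms (suc i) zero    e = ⊥-elim (ms i e)
  cons-inj inj ms (suc i) (suc j) e = cong suc (inj i j e)

  -- Together with the missed value, `f` becomes an injection of a finite set into itself, hence
  -- onto.
  onto-rest : ∀ {r} {f : Fin r → Fin (suc r)} {m} → Inj f → (∀ i → f i ≢ m) →
              ∀ y → y ≢ m → ∃ λ i → f i ≡ y
  onto-rest {f = f} {m} inj ms y y≢m with injective⇒onto (m ∷ f) (cons-inj inj ms) y
  ... | zero  , e = ⊥-elim (y≢m (sym e))
  ... | suc i , e = i , e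

  missing-unique : ∀ {r} {f : Fin r → Fin (suc r)} → Inj f → ∀ {m m′} →
                   (∀ i → f i ≢ m) → (∀ i → f i ≢ m′) → m ≡ m′
  missing-unique inj {m} {m′} ms ms′ with m Fin.≟ m′
  ... | yes e = e
  ... | no ne with onto-rest inj ms m′ (ne ∘ sym)
  ...   | i , e = ⊥-elim (ms′ i e)

  punch-surj : ∀ {r} (m y : Fin (suc r)) → y ≢ m → ∃ λ j → punchIn m j ≡ y
  punch-surj m y ne = punchOut (ne ∘ sym) , Fin.punchIn-punchOut (ne ∘ sym)

-- Subsets are Boolean-valued functions. Commuting with complements (`prime`) expresses properness
-- and maximality at once. Pointwise equal subsets are not identified, so `mem-cong` has to be
-- derived from `mono`.
record Uf {a} (A : Set a) : Set a where
  field
    mem   : (A → Bool) → Bool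
    mono  : ∀ X Y → (∀ t → X t ≡ true → Y t ≡ true) → mem X ≡ true → mem Y ≡ true
    inter  : ∀ X Y → mem X ≡ true → mem Y ≡ true → mem (λ t → X t ∧ᵇ Y t) ≡ true
    prime : ∀ X → mem (notᵇ ∘ X) ≡ notᵇ (mem X)

  mem-cong : ∀ X Y → (∀ t → X t ≡ Y t) → mem X ≡ mem Y
  mem-cong X Y e with mem X in eX | mem Y in eY
  ... | true  | true  = refl
  ... | false | false = refl
  ... | true  | false = trans (sym (mono X Y (λ t x → trans (sym (e t)) x) eX)) eY
  ... | false | true  = trans (sym eX) (mono Y X (λ t x → trans (e t) x) eY)

  mem-false : mem (λ _ → false) ≡ false
  mem-false with mem (λ _ → false) in e | prime (λ _ → false)
  ... | false | _ = refl
  ... | true  | q with trans (sym q) (mono (λ _ → false) (λ _ → true) (λ _ ()) e)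
  ...   | ()

  mem-const : ∀ b → mem (λ _ → b) ≡ b
  mem-const false = mem-false
  mem-const true  = trans (prime (λ _ → false)) (cong notᵇ mem-false)

open Uf public

infix 4 _≋_

_≋_ : ∀ {a} {A : Set a} → Uf A → Uf A → Set a
J ≋ J′ = ∀ X → mem J X ≡ mem J′ X

pure : ∀ {a} {A : Set a} → A → Uf A
pure t = record { mem = λ X → X t ; mono = λ X Y f → f t ; inter = λ X Y → ∧ᵗ ; prime = λ X → refl }
  where
  ∧ᵗ : ∀ {a b} → a ≡ true → b ≡ true → a ∧ᵇ b ≡ true
  ∧ᵗ refl refl = refl

-- The limit of the ultrafilters `F t` along `J`, that is, the bind of the ultrafilter monad.
bind : ∀ {a b} {A : Set a} {B : Set b} → Uf A → (A → Uf B) → Uf B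
bind J F = record
  { mem   = λ X → mem J (λ t → mem (F t) X)
  ; mono  = λ X Y f → mono J _ _ (λ t → mono (F t) X Y f)
  ; inter  = λ X Y p q → mono J _ _ (λ t → both t) (inter J _ _ p q)
  ; prime = λ X → trans (mem-cong J _ _ (λ t → prime (F t) X)) (prime J _)
  }
  where
  both : ∀ {X Y} t → mem (F t) X ∧ᵇ mem (F t) Y ≡ true → mem (F t) (λ s → X s ∧ᵇ Y s) ≡ true
  both {X} {Y} t e with mem (F t) X in eX | mem (F t) Y in eY
  ... | true | true = inter (F t) X Y eX eY

mapᵘ : ∀ {a b} {A : Set a} {B : Set b} → (A → B) → Uf A → Uf B
mapᵘ g J = record
  { mem   = λ X → mem J (X ∘ g)
  ; mono  = λ X Y f → mono J _ _ (f ∘ g)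
  ; inter  = λ X Y → inter J _ _
  ; prime = λ X → prime J (X ∘ g)
  }

-- The iterated tensor product. It depends on the order of its factors, but everything below is
-- drawn from its marginals.
prod : ∀ {a r} {A : Set a} → (Fin r → Uf A) → Uf (Fin r → A)
prod {r = zero}  Js = pure []
prod {r = suc r} Js = bind (Js zero) λ t → mapᵘ (t ∷_) (prod (Js ∘ suc))

prod-cong : ∀ {a r} {A : Set a} {Js Js′ : Fin r → Uf A} → (∀ i → Js i ≋ Js′ i) → prod Js ≋ prod Js′
prod-cong {r = zero} e X = refl
prod-cong {r = suc r} {Js = Js} {Js′} e X =
  trans (mem-cong (Js zero) _ _ (λ t → prod-cong (e ∘ suc) (X ∘ (t ∷_)))) (e zero _)

prod-marginal : ∀ {a r} {A : Set a} (Js : Fin r → Uf A) i → mapᵘ (λ ts → ts i) (prod Js) ≋ Js i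
prod-marginal {r = suc r} Js zero X =
  mem-cong (Js zero) _ _ (λ t → mem-const (prod (Js ∘ suc)) (X t))
prod-marginal {r = suc r} Js (suc i) X =
  trans (mem-cong (Js zero) _ _ (λ t → prod-marginal (Js ∘ suc) i X)) (mem-const (Js zero) _)

module Quantifier (em : ∀ {a} → ExcludedMiddle a) where
  open Classical em

  Most : ∀ {a p} {A : Set a} → Uf A → (A → Set p) → Set
  Most J P = mem J (λ t → ⌊ P t ⌋) ≡ true

  module _ {a} {A : Set a} (J : Uf A) where

    most-mono : ∀ {p q} {P : A → Set p} {Q : A → Set q} → (∀ t → P t → Q t) → Most J P → Most J Q
    most-mono f = mono J _ _ (λ t e → ⌊⌋-intro (f t (⌊⌋-elim e)))

    most-∧ : ∀ {p q} {P : A → Set p} {Q : A → Set q} → Most J P → Most J Q → Most J (λ t → P t × Q t)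
    most-∧ mp mq = mono J _ _
      (λ t e → ⌊⌋-intro (⌊⌋-elim (∧-elim₁ e) , ⌊⌋-elim (∧-elim₂ {⌊ _ ⌋} e))) (inter J _ _ mp mq)

    most-all : ∀ {p} {P : A → Set p} → (∀ t → P t) → Most J P
    most-all f = mono J (λ _ → true) _ (λ t _ → ⌊⌋-intro (f t)) (mem-const J true)

    most-¬ : ∀ {p} {P : A → Set p} → ¬ Most J P → Most J (λ t → ¬ P t)
    most-¬ {P = P} ¬m with mem J (λ t → ⌊ P t ⌋) in e | prime J (λ t → ⌊ P t ⌋)
    ... | true  | _ = contradiction refl ¬m
    ... | false | q = mono J _ _
          (λ t r → ⌊⌋-intro λ pt → true≢false (⌊⌋-intro pt) (not-elim r)) q

    most-some : ∀ {p} {P : A → Set p} → Most J P → ∃ P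
    most-some {P = P} m = stable λ ¬e → true≢false
      (mono J _ (λ _ → false) (λ t e → ⊥-elim (¬e (t , ⌊⌋-elim e))) m) (mem-false J)

    ¬most-¬ : ∀ {p} {P : A → Set p} → Most J (λ t → ¬ P t) → ¬ Most J P
    ¬most-¬ m m′ with most-some (most-∧ m m′)
    ... | _ , ¬p , p = ¬p p

    most-⊎ : ∀ {p q} {P : A → Set p} {Q : A → Set q} → Most J (λ t → P t ⊎ Q t) → Most J P ⊎ Most J Q
    most-⊎ {P = P} m with em {P = Most J P}
    ... | yes mp = inj₁ mp
    ... | no ¬mp = inj₂ (most-mono (λ { t (inj₁ p , ¬p) → contradiction p ¬p ; t (inj₂ q , _) → q })
                          (most-∧ m (most-¬ ¬mp)))

    -- This turns a choice among finitely many options, made separately at almost every `t`, into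
    -- one constant option.
    most-fin : ∀ {p r} {P : Fin r → A → Set p} → Most J (λ t → ∃ λ i → P i t) → ∃ λ i → Most J (P i)
    most-fin {r = zero} m with most-some m
    ... | _ , () , _
    most-fin {r = suc r} m with most-⊎ (most-mono (λ { t (zero , p) → inj₁ p ; t (suc i , p) → inj₂ (i , p) }) m)
    ... | inj₁ mp = zero , mp
    ... | inj₂ mq with most-fin mq
    ...   | i , mi = suc i , mi

    most-all-fin : ∀ {p r} {P : Fin r → A → Set p} → (∀ i → Most J (P i)) → Most J (λ t → ∀ i → P i t)
    most-all-fin {P = P} ms = stable λ ¬m → help (most-fin {P = λ i t → ¬ P i t} (most-mono
        (λ t ¬all → stable λ ¬e → ¬all λ i → stable λ ¬p → ¬e (i , ¬p)) (most-¬ ¬m)))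
      where
      help : ¬ (∃ λ i → Most J (λ t → ¬ P i t))
      help (i , mi) = ¬most-¬ mi (ms i)

    most-agree : ∀ {X Y : A → Bool} → Most J (λ t → X t ≡ Y t) → mem J X ≡ mem J Y
    most-agree {X} {Y} m = ≡true
      (λ x → mono J _ _ (λ t e → trans (sym (⌊⌋-elim (∧-elim₁ e))) (∧-elim₂ {⌊ X t ≡ Y t ⌋} e)) (inter J _ _ m x))
      (λ y → mono J _ _ (λ t e → trans (⌊⌋-elim (∧-elim₁ e)) (∧-elim₂ {⌊ X t ≡ Y t ⌋} e)) (inter J _ _ m y))

    most⇒mem : ∀ {X : A → Bool} → Most J (λ t → X t ≡ true) → mem J X ≡ true
    most⇒mem = mono J _ _ (λ t → ⌊⌋-elim)

    mem⇒most : ∀ {X : A → Bool} → mem J X ≡ true → Most J (λ t → X t ≡ true)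
    mem⇒most = mono J _ _ (λ t → ⌊⌋-intro)

  most-≋ : ∀ {a p} {A : Set a} {J J′ : Uf A} {P : A → Set p} → J ≋ J′ → Most J P → Most J′ P
  most-≋ e m = trans (sym (e _)) m

  most-bind : ∀ {a b p} {A : Set a} {B : Set b} (J : Uf A) (F : A → Uf B) {P : B → Set p} →
              Most J (λ t → Most (F t) P) → Most (bind J F) P
  most-bind J F = mono J _ _ (λ t → ⌊⌋-elim)

module _ {a} {A : Set a} (J : Uf A) where

  mem-∧ : ∀ X Y → mem J (λ t → X t ∧ᵇ Y t) ≡ mem J X ∧ᵇ mem J Y
  mem-∧ X Y with mem J X in eX | mem J Y in eY | mem J (λ t → X t ∧ᵇ Y t) in e
  ... | true  | true  | _     = trans (sym e) (inter J X Y eX eY)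
  ... | false | _     | false = refl
  ... | true  | false | false = refl
  ... | false | _     | true  = trans (sym (mono J _ X (λ t → left) e)) eX
    where
    left : ∀ {a b} → a ∧ᵇ b ≡ true → a ≡ true
    left {true} _ = refl
  ... | true  | false | true  = trans (sym (mono J _ Y (λ t → right) e)) eY
    where
    right : ∀ {a b} → a ∧ᵇ b ≡ true → b ≡ true
    right {true} e = e

  mem-∨ : ∀ X Y → mem J (λ t → X t ∨ᵇ Y t) ≡ mem J X ∨ᵇ mem J Y
  mem-∨ X Y = trans (mem-cong J _ _ (λ t → de-morgan (X t) (Y t)))
    (trans (prime J _) (trans (cong notᵇ (trans (mem-∧ _ _) (cong₂ _∧ᵇ_ (prime J X) (prime J Y))))
      (sym (de-morgan (mem J X) (mem J Y)))))
    where
    de-morgan : ∀ a b → a ∨ᵇ b ≡ notᵇ (notᵇ a ∧ᵇ notᵇ b)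
    de-morgan true  b     = refl
    de-morgan false true  = refl
    de-morgan false false = refl

-- Pairing of natural numbers

unpair : ℕ → ℕ × ℕ
unpair zero = 0 , 0
unpair (suc k) with unpair k
... | zero  , b = suc b , 0
... | suc a , b = a , suc b

unpair-onto : ∀ s b a → a + b ≡ s → ∃ λ k → unpair k ≡ (a , b)
unpair-onto s zero zero e = 0 , refl
unpair-onto (suc s) zero (suc a) e with unpair-onto s a zero (trans (sym (ℕ.+-identityʳ a)) (ℕ.suc-injective e))
... | k , q = suc k , step k q
  where
  step : ∀ k → unpair k ≡ (0 , a) → unpair (suc k) ≡ (suc a , 0)
  step k q rewrite q = refl
unpair-onto s (suc b) a e with unpair-onto s b (suc a) (trans (sym (ℕ.+-suc a b)) e)
... | k , q = suc k , step k q
  where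
  step : ∀ k → unpair k ≡ (suc a , b) → unpair (suc k) ≡ (a , suc b)
  step k q rewrite q = refl

abstract
  -- An inverse of the enumeration along antidiagonals. Only its decoding law matters, and
  -- `abstract` keeps the search behind it folded.
  pair : ℕ → ℕ → ℕ
  pair a b = proj₁ (unpair-onto _ b a refl)

  unpair-pair : ∀ a b → unpair (pair a b) ≡ (a , b)
  unpair-pair a b = proj₂ (unpair-onto _ b a refl)

pair-inj : ∀ {a b c d} → pair a b ≡ pair c d → a ≡ c × b ≡ d
pair-inj {a} {b} {c} {d} e with trans (sym (unpair-pair a b)) (trans (cong unpair e) (unpair-pair c d))
... | refl = refl , refl

-- Types of tuples in coloured simplices

-- Colours clash only within one index; `nothing` marks colours outside the indices, such as the
-- greens. Each index comes with `n` fillers, one for each face of a simplex, no three of which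
-- clash, so partial colourings can be completed.
record Palette (k : ℕ) : Set₁ where
  field
    Colour      : Set
    Bad         : Colour → Colour → Colour → Set
    bad-swap₁   : ∀ {a b c} → Bad a b c → Bad b a c
    bad-swap₂   : ∀ {a b c} → Bad a b c → Bad a c b
    idx         : Colour → Maybe (Fin (3 + k))
    bad-idx     : ∀ {a b c} → Bad a b c → idx a ≡ idx b
    filler      : Fin (3 + k) → Fin (3 + k) → Colour
    filler-idx  : ∀ i m → idx (filler i m) ≡ just i
    filler-good : ∀ i {l m o} → l ≢ m → l ≢ o → m ≢ o → ¬ Bad (filler i l) (filler i m) (filler i o)

module Frame (em : ∀ {a} → ExcludedMiddle a) (k : ℕ) (P : Palette k) where
  open Classical em
  open Palette P public

  M N n : ℕ
  M = 1 + k
  N = 2 + k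
  n = 3 + k

  Good : (Fin n → Colour) → Set
  Good K = ∀ i j l → i ≢ j → i ≢ l → j ≢ l → ¬ Bad (K i) (K j) (K l)

  Simp : Set
  Simp = Σ (Fin n → Colour) Good

  good-ext : ∀ {K K′ : Fin n → Colour} → (∀ i → K i ≡ K′ i) → Good K → Good K′
  good-ext e g i j l p q r b rewrite sym (e i) | sym (e j) | sym (e l) = g i j l p q r b

  -- Pigeonhole: `N` values occupy at most `N` of the `n = N + 1` indices. Reading `nothing` as
  -- `zero` at worst blocks one index per value.
  free-index : (f : Fin N → Maybe (Fin n)) → ∃ λ i → ∀ l → f l ≢ just i
  free-index f = let (i , ms) = missing (fromMaybe zero ∘ f) in i , λ l e → ms l (cong (fromMaybe zero) e)

  good-mixed : ∀ {a b c i} → idx a ≡ just i → idx b ≢ just i → ¬ Bad a b c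
  good-mixed ea ne b = ne (trans (sym (bad-idx b)) ea)

  override : (m m′ : Fin n) → Colour → Colour → (Fin n → Colour) → Fin n → Colour
  override m m′ c c′ φ j with j Fin.≟ m | j Fin.≟ m′
  ... | yes _ | _     = c
  ... | no _  | yes _ = c′
  ... | no _  | no _  = φ j

  override-good : ∀ m m′ c c′ i → idx c ≢ just i → idx c′ ≢ just i →
                  Good (override m m′ c c′ (filler i))
  override-good m m′ c c′ i nc nc′ u v w u≢v u≢w v≢w
    with u Fin.≟ m | u Fin.≟ m′ | v Fin.≟ m | v Fin.≟ m′ | w Fin.≟ m | w Fin.≟ m′
  ... | yes refl | _ | yes refl | _ | _ | _ = contradiction refl u≢v
  ... | yes refl | _ | _ | _ | yes refl | _ = contradiction refl u≢w
  ... | _ | _ | yes refl | _ | yes refl | _ = contradiction refl v≢w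
  ... | _ | yes refl | _ | yes refl | _ | _ = contradiction refl u≢v
  ... | _ | yes refl | _ | _ | _ | yes refl = contradiction refl u≢w
  ... | _ | _ | _ | yes refl | _ | yes refl = contradiction refl v≢w
  ... | no _ | no _ | yes _ | _ | _ | _ = good-mixed (filler-idx i u) nc
  ... | no _ | no _ | no _ | yes _ | _ | _ = good-mixed (filler-idx i u) nc′
  ... | yes _ | _ | no _ | no _ | _ | _ = λ b → good-mixed (filler-idx i v) nc (bad-swap₁ b)
  ... | no _ | yes _ | no _ | no _ | _ | _ = λ b → good-mixed (filler-idx i v) nc′ (bad-swap₁ b)
  ... | no _ | no _ | no _ | no _ | yes _ | _ = λ b → good-mixed (filler-idx i u) nc (bad-swap₂ b)
  ... | no _ | no _ | no _ | no _ | no _ | yes _ = λ b → good-mixed (filler-idx i u) nc′ (bad-swap₂ b)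
  ... | no _ | no _ | no _ | no _ | no _ | no _ = filler-good i u≢v u≢w v≢w
  ... | yes _ | _ | no _ | yes _ | no _ | no _ =
        λ b → good-mixed (filler-idx i w) nc (bad-swap₁ (bad-swap₂ b))
  ... | no _ | yes _ | yes _ | _ | no _ | no _ =
        λ b → good-mixed (filler-idx i w) nc′ (bad-swap₁ (bad-swap₂ b))

  -- The prescribed colours are surrounded by fillers of an index that neither of them has. Any
  -- three faces include a filler, so they either mix indices or are three fillers.
  extend-filled : ∀ {m m′} → m ≢ m′ → ∀ c c′ → ∃ λ (K : Simp) → (proj₁ K m ≡ c × proj₁ K m′ ≡ c′) ×
                  (∀ l → l ≢ m → l ≢ m′ → ∃ λ i → proj₁ K l ≡ filler i l)
  extend-filled {m} {m′} m≢m′ c c′ with free-index (λ { zero → idx c ; (suc _) → idx c′ })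
  ... | i , free = (override m m′ c c′ (filler i) , override-good m m′ c c′ i (free zero) (free (suc zero)))
                 , (at-m , at-m′) , λ l l≢m l≢m′ → i , elsewhere l l≢m l≢m′
    where
    at-m : override m m′ c c′ (filler i) m ≡ c
    at-m with m Fin.≟ m
    ... | yes _ = refl
    ... | no ne = contradiction refl ne
    at-m′ : override m m′ c c′ (filler i) m′ ≡ c′
    at-m′ with m′ Fin.≟ m | m′ Fin.≟ m′
    ... | yes e | _     = contradiction (sym e) m≢m′
    ... | no _  | yes _ = refl
    ... | no _  | no ne = contradiction refl ne
    elsewhere : ∀ l → l ≢ m → l ≢ m′ → override m m′ c c′ (filler i) l ≡ filler i l
    elsewhere l p q with l Fin.≟ m | l Fin.≟ m′
    ... | yes e | _     = contradiction e p
    ... | no _  | yes e = contradiction e q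
    ... | no _  | no _  = refl

  extend : ∀ {m m′} → m ≢ m′ → ∀ c c′ → ∃ λ (K : Simp) → proj₁ K m ≡ c × proj₁ K m′ ≡ c′
  extend m≢m′ c c′ = let (K , e , _) = extend-filled m≢m′ c c′ in K , e

  other : (m : Fin n) → ∃ λ m′ → m ≢ m′
  other zero    = suc zero , λ ()
  other (suc _) = zero , λ ()

  extend₁ : ∀ m c → ∃ λ (K : Simp) → proj₁ K m ≡ c
  extend₁ m c with extend (proj₂ (other m)) c c
  ... | K , e , _ = K , e

  -- (pos , sim) is the type of the tuple x ∘ pos, where x enumerates the n
  -- points of a simplex whose face opposite to x m has the colour sim m.
  record Atom : Set where
    constructor atom
    field
      pos : Fin n → Fin n
      sim : Simp
    col : Fin n → Colour
    col = proj₁ sim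
  open Atom public

  -- The `N` entries listed by `φ` span exactly the face opposite to `m`.
  Miss : (Fin N → Fin n) → Fin n → Set
  Miss φ m = Inj φ × (∀ l → φ l ≢ m)

  -- On all coordinates this is equality of types; off `i` it is the accessibility relation of the
  -- cylindrifier. A face is compared through entries `θ` that span it, because it may lie at
  -- different positions in the two simplices.
  record SameOn (A : Fin n → Set) (a b : Atom) : Set where
    field
      ker  : ∀ {i j} → A i → A j → pos a i ≡ pos a j → pos b i ≡ pos b j
      ker⁻ : ∀ {i j} → A i → A j → pos b i ≡ pos b j → pos a i ≡ pos a j
      lab  : ∀ (θ : Fin N → Fin n) → (∀ l → A (θ l)) → ∀ {m m′} →
             Miss (pos a ∘ θ) m → Miss (pos b ∘ θ) m′ → col a m ≡ col b m′
  open SameOn public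

  Same : Atom → Atom → Set
  Same = SameOn (λ _ → ⊤)

  module _ {A : Fin n → Set} where

    same-refl : ∀ {a} → SameOn A a a
    same-refl {a} = record
      { ker = λ _ _ e → e ; ker⁻ = λ _ _ e → e
      ; lab = λ θ _ m m′ → cong (col a) (missing-unique (proj₁ m) (proj₂ m) (proj₂ m′)) }

    same-sym : ∀ {a b} → SameOn A a b → SameOn A b a
    same-sym s = record { ker = ker⁻ s ; ker⁻ = ker s ; lab = λ θ A m m′ → sym (lab s θ A m′ m) }

    same-inj : ∀ {a b} → SameOn A a b → ∀ (θ : Fin N → Fin n) → (∀ l → A (θ l)) →
               Inj (pos a ∘ θ) → Inj (pos b ∘ θ)
    same-inj s θ Aθ inj i j e = inj i j (ker⁻ s (Aθ _) (Aθ _) e)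

    same-trans : ∀ {a b c} → SameOn A a b → SameOn A b c → SameOn A a c
    same-trans {b = b} s t = record
      { ker  = λ p q e → ker t p q (ker s p q e)
      ; ker⁻ = λ p q e → ker⁻ s p q (ker⁻ t p q e)
      -- The middle tuple sees the face as well; only the point it misses has to be supplied.
      ; lab  = λ θ Aθ m m″ → let (m′ , ms) = missing (pos b ∘ θ)
                                 mb = same-inj s θ Aθ (proj₁ m) , ms
                             in trans (lab s θ Aθ m mb) (lab t θ Aθ mb m″)
      }

    pos-ext : ∀ {p p′ : Fin n → Fin n} {K} → (∀ l → p l ≡ p′ l) → SameOn A (atom p K) (atom p′ K)
    pos-ext {p} {p′} {K} e = record
      { ker  = λ {i} {j} _ _ q → trans (sym (e i)) (trans q (e j))
      ; ker⁻ = λ {i} {j} _ _ q → trans (e i) (trans q (sym (e j)))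
      ; lab  = λ θ _ m m′ → cong (proj₁ K)
          (missing-unique (proj₁ m) (proj₂ m) (λ l q → proj₂ m′ l (trans (sym (e (θ l))) q)))
      }

  sim-ext : ∀ {A : Fin n → Set} {p} {K K′ : Simp} → (∀ l → proj₁ K l ≡ proj₁ K′ l) → SameOn A (atom p K) (atom p K′)
  sim-ext {K = K} e = record
    { ker = λ _ _ q → q ; ker⁻ = λ _ _ q → q
    ; lab = λ θ _ {m} {m′} x y → trans (cong (proj₁ K) (missing-unique (proj₁ x) (proj₂ x) (proj₂ y))) (e m′) }

  weaken : ∀ {A A′ : Fin n → Set} {a b} → (∀ l → A′ l → A l) → SameOn A a b → SameOn A′ a b
  weaken f s = record
    { ker = λ p q → ker s (f _ p) (f _ q) ; ker⁻ = λ p q → ker⁻ s (f _ p) (f _ q)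
    ; lab = λ θ Aθ → lab s θ (λ l → f _ (Aθ l)) }

  act : Atom → (Fin n → Fin n) → Atom
  act a σ = atom (pos a ∘ σ) (sim a)

  act-same : ∀ {A A′ : Fin n → Set} {a b} σ → (∀ l → A′ l → A (σ l)) →
             SameOn A a b → SameOn A′ (act a σ) (act b σ)
  act-same σ f s = record
    { ker = λ p q → ker s (f _ p) (f _ q) ; ker⁻ = λ p q → ker⁻ s (f _ p) (f _ q)
    ; lab = λ θ Aθ → lab s (σ ∘ θ) (λ l → f _ (Aθ l)) }

  Off : Fin n → Fin n → Set
  Off i j = j ≢ i

  sub-off : ∀ {i j : Fin n} → i ≢ j → ∀ l → [ i ∣ j ] l ≢ i
  sub-off {i} {j} i≢j l with l Fin.≟ i
  ... | yes _ = i≢j ∘ sym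
  ... | no ne = ne

  sub-id : ∀ {i j l : Fin n} → l ≢ i → [ i ∣ j ] l ≡ l
  sub-id {i} {j} {l} ne with l Fin.≟ i
  ... | yes e = contradiction e ne
  ... | no _  = refl

  sub-at : ∀ (i j : Fin n) → [ i ∣ j ] i ≡ j
  sub-at i j with i Fin.≟ i
  ... | yes _ = refl
  ... | no ne = contradiction refl ne

  sub-fold : ∀ {i j} (p : Fin n → Fin n) → p i ≡ p j → ∀ l → p ([ i ∣ j ] l) ≡ p l
  sub-fold {i} {j} p e l with l Fin.≟ i
  ... | yes refl = sym e
  ... | no _     = refl

  -- A successor that repeats the entry `j` at `i` brings in no new point, so `a` already determines
  -- it.
  cyl-diag : ∀ {i j a b} → i ≢ j → SameOn (Off i) a b → pos b i ≡ pos b j → Same (act a [ i ∣ j ]) b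
  cyl-diag {i} {j} {a} {b} i≢j s e =
    same-trans (act-same [ i ∣ j ] (λ l _ → sub-off i≢j l) s) (pos-ext (sub-fold (pos b) e))

  onto⇒injective : ∀ {r} (p : Fin r → Fin r) → (∀ y → ∃ λ x → p x ≡ y) → Inj p
  onto⇒injective p onto i j e with
      injective⇒onto (proj₁ ∘ onto) (λ x y q → trans (sym (proj₂ (onto x))) (trans (cong p q) (proj₂ (onto y)))) i
    | injective⇒onto (proj₁ ∘ onto) (λ x y q → trans (sym (proj₂ (onto x))) (trans (cong p q) (proj₂ (onto y)))) j
  ... | x , refl | y , refl = cong (proj₁ ∘ onto) (trans (sym (proj₂ (onto x))) (trans e (proj₂ (onto y))))

  -- A non-injective tuple has at most one visible face.
  one-face : ∀ {p : Fin n → Fin n} → ¬ Inj p → ∀ {θ θ′ : Fin N → Fin n} {m m′} →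
             Miss (p ∘ θ) m → Miss (p ∘ θ′) m′ → m ≡ m′
  one-face {p} ¬inj {θ} {θ′} {m} {m′} (inj , ms) (inj′ , ms′) = stable λ m≢m′ →
    ¬inj (onto⇒injective p (λ y → onto m≢m′ y))
    where
    onto : m ≢ m′ → ∀ y → ∃ λ x → p x ≡ y
    onto m≢m′ y with y Fin.≟ m
    ... | no ne = let (l , e) = onto-rest inj ms y ne in θ l , e
    ... | yes refl = let (l , e) = onto-rest inj′ ms′ y m≢m′ in θ′ l , e

  punch-miss : ∀ (p : Fin n → Fin n) i → Inj p → Miss (p ∘ punchIn i) (p i)
  punch-miss p i inj = (λ x y e → Fin.punchIn-injective i x y (inj _ _ e)) , λ l e → Fin.punchInᵢ≢i i l (inj _ _ e)

  -- If c_i fetches b from a and the i-th entry of a lies at the apex of its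
  -- simplex, then b is realised over the positions of a, with the base kept.
  realign : ∀ {i} {p q : Fin n → Fin n} {K L : Simp} → SameOn (Off i) (atom p K) (atom q L) →
            p i ≡ zero → (∀ l → l ≢ i → p l ≢ zero) → (∀ l → l ≢ i → q l ≢ q i) →
            ∃ λ (K′ : Simp) → proj₁ K′ zero ≡ proj₁ K zero × Same (atom p K′) (atom q L)
  realign {i} {p} {q} {K} {L} s pi pl ql = result
    where
    kerpq : ∀ {j l} → p j ≡ p l → q j ≡ q l
    kerpq {j} {l} e with j Fin.≟ i | l Fin.≟ i
    ... | yes refl | yes refl = refl
    ... | yes refl | no ne    = contradiction (trans (sym e) pi) (pl l ne)
    ... | no ne    | yes refl = contradiction (trans e pi) (pl j ne)
    ... | no ne    | no ne′   = ker s ne ne′ e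

    kerqp : ∀ {j l} → q j ≡ q l → p j ≡ p l
    kerqp {j} {l} e with j Fin.≟ i | l Fin.≟ i
    ... | yes refl | yes refl = refl
    ... | yes refl | no ne    = contradiction (sym e) (ql l ne)
    ... | no ne    | yes refl = contradiction e (ql j ne)
    ... | no ne    | no ne′   = ker⁻ s ne ne′ e

    result : ∃ λ (K′ : Simp) → proj₁ K′ zero ≡ proj₁ K zero × Same (atom p K′) (atom q L)
    result with em {P = Inj p}
    -- All faces are visible, so the simplex of `q` is carried over along `q ∘ p⁻`. Its face
    -- opposite to `zero` is the common face off `i`, whose colour `s` preserves.
    ... | yes inj = K′ , K′-zero , record { ker = λ _ _ → kerpq ; ker⁻ = λ _ _ → kerqp ; lab = lab′ }
      where
      p⁻ : Fin n → Fin n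
      p⁻ y = proj₁ (injective⇒onto p inj y)
      pp⁻ : ∀ y → p (p⁻ y) ≡ y
      pp⁻ y = proj₂ (injective⇒onto p inj y)
      p⁻p : ∀ y → p⁻ (p y) ≡ y
      p⁻p y = inj _ _ (pp⁻ (p y))
      qinj : Inj q
      qinj x y e = inj x y (kerqp e)
      ρ : ∀ {x y} → q (p⁻ x) ≡ q (p⁻ y) → x ≡ y
      ρ {x} {y} e = trans (sym (pp⁻ x)) (trans (kerqp e) (pp⁻ y))
      K′ : Simp
      K′ = proj₁ L ∘ q ∘ p⁻ , λ _ _ _ a b c → proj₂ L _ _ _ (a ∘ ρ) (b ∘ ρ) (c ∘ ρ)
      K′-zero : proj₁ L (q (p⁻ zero)) ≡ proj₁ K zero
      K′-zero = trans (cong (proj₁ L ∘ q) (trans (cong p⁻ (sym pi)) (p⁻p i)))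
        (sym (subst (λ z → proj₁ K z ≡ proj₁ L (q i)) pi
          (lab s (punchIn i) (Fin.punchInᵢ≢i i) (punch-miss p i inj) (punch-miss q i qinj))))
      lab′ : ∀ θ → (∀ l → ⊤) → ∀ {m m′} → Miss (p ∘ θ) m → Miss (q ∘ θ) m′ →
             proj₁ L (q (p⁻ m)) ≡ proj₁ L m′
      lab′ θ _ (_ , ms) (injq , msq) = cong (proj₁ L) (missing-unique injq
        (λ l e → ms l (trans (cong p (qinj _ _ e)) (pp⁻ _))) msq)
    -- Now at most one face is visible. If there is none, the kernel alone determines the type and
    -- `K` can stay.
    ... | no ¬inj with em {P = ∃ λ (θ : Fin N → Fin n) → Inj (p ∘ θ)}
    ...   | no none = K , refl , record
              { ker = λ _ _ → kerpq ; ker⁻ = λ _ _ → kerqp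
              ; lab = λ θ _ m _ → contradiction (θ , proj₁ m) none }
    ...   | yes (θ , injθ) = K′ , K′-zero , record
              { ker = λ _ _ → kerpq ; ker⁻ = λ _ _ → kerqp
              ; lab = λ θ′ _ x y → trans (cong (proj₁ K′) (one-face ¬inj x (injθ , ms)))
                  (trans K′-m (cong (proj₁ L) (one-face ¬injq (injqθ , msq) y))) }
      where
      m = proj₁ (missing (p ∘ θ))
      ms = proj₂ (missing (p ∘ θ))
      m′ = proj₁ (missing (q ∘ θ))
      msq = proj₂ (missing (q ∘ θ))
      injqθ : Inj (q ∘ θ)
      injqθ x y e = injθ x y (kerqp e)
      ¬injq : ¬ Inj q
      ¬injq inj = ¬inj λ x y e → inj x y (kerpq e)
      -- If the visible face avoided the entry `i`, the entry at the apex would make `p` injective.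
      -- So this face contains the apex, differs from the base, and `extend` can prescribe both
      -- colours.
      hits : ∃ λ l → θ l ≡ i
      hits = stable λ no-hit → ¬inj λ x y e → inj-off no-hit x y e
        where
        θinj : Inj θ
        θinj x y e = injθ x y (cong p e)
        inj-off : ¬ (∃ λ l → θ l ≡ i) → ∀ x y → p x ≡ p y → x ≡ y
        inj-off no-hit x y e with x Fin.≟ i | y Fin.≟ i
        ... | yes refl | yes refl = refl
        ... | yes refl | no ne    = contradiction (trans (sym e) pi) (pl y ne)
        ... | no ne    | yes refl = contradiction (trans e pi) (pl x ne)
        ... | no ne    | no ne′ with onto-rest θinj (λ l h → no-hit (l , h)) x ne | onto-rest θinj (λ l h → no-hit
            (l , h)) y ne′
        ...   | u , refl | v , refl = cong θ (injθ u v e)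
      zero≢m : zero ≢ m
      zero≢m e = ms (proj₁ hits) (trans (cong p (proj₂ hits)) (trans pi e))
      extension : ∃ λ (K′ : Simp) → proj₁ K′ zero ≡ proj₁ K zero × proj₁ K′ m ≡ proj₁ L m′
      extension = extend zero≢m (proj₁ K zero) (proj₁ L m′)
      K′ = proj₁ extension
      K′-zero = proj₁ (proj₂ extension)
      K′-m = proj₂ (proj₂ extension)

-- Representations from ultrafilter labellings

record StrictOrder : Set₁ where
  infix 4 _≈ᵖ_ _<ᵖ_
  field
    Pt     : Set
    _≈ᵖ_   : Pt → Pt → Set
    ≈-refl  : ∀ {u} → u ≈ᵖ u
    ≈-sym   : ∀ {u v} → u ≈ᵖ v → v ≈ᵖ u
    ≈-trans : ∀ {u v w} → u ≈ᵖ v → v ≈ᵖ w → u ≈ᵖ w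
    _<ᵖ_   : Pt → Pt → Set
    <-irr   : ∀ {u v} → u ≈ᵖ v → ¬ (u <ᵖ v)
    <-trans : ∀ {u v w} → u <ᵖ v → v <ᵖ w → u <ᵖ w
    <-resp  : ∀ {u u′ v v′} → u ≈ᵖ u′ → v ≈ᵖ v′ → u <ᵖ v → u′ <ᵖ v′
    <-tri   : ∀ u v → (u <ᵖ v) ⊎ (u ≈ᵖ v) ⊎ (v <ᵖ u)
    base    : Pt
    above   : ∀ u → ∃ λ v → u <ᵖ v

  infix 4 _≈ᵗ_
  _≈ᵗ_ : ∀ {r} → (Fin r → Pt) → (Fin r → Pt) → Set
  x ≈ᵗ y = ∀ i → x i ≈ᵖ y i

  Desc : ∀ {r} → (Fin r → Pt) → Set
  Desc x = ∀ i j → toℕ i < toℕ j → x j <ᵖ x i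

  desc-inj : ∀ {r} {x : Fin r → Pt} → Desc x → ∀ i j → x i ≈ᵖ x j → i ≡ j
  desc-inj d i j e with ℕ.<-cmp (toℕ i) (toℕ j)
  ... | tri< lt _ _ = contradiction (d i j lt) (<-irr (≈-sym e))
  ... | tri≈ _ q _  = Fin.toℕ-injective q
  ... | tri> _ _ gt = contradiction (d j i gt) (<-irr e)

  desc-cons : ∀ {r} {x : Fin r → Pt} {b} → Desc x → (∀ i → x i <ᵖ b) → Desc (b ∷ x)
  desc-cons d lt zero    (suc j) _       = lt j
  desc-cons d lt (suc i) (suc j) (s≤s q) = d i j q

  desc-below : ∀ {r} {x : Fin (suc r) → Pt} {b} → Desc x → x zero <ᵖ b → ∀ i → x i <ᵖ b
  desc-below d lt zero    = lt
  desc-below d lt (suc i) = <-trans (d zero (suc i) (s≤s z≤n)) lt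

  desc-tail : ∀ {r} {x : Fin (suc r) → Pt} → Desc x → Desc (x ∘ suc)
  desc-tail d i j lt = d (suc i) (suc j) (s≤s lt)

  desc-punch : ∀ {r} {x : Fin (suc r) → Pt} m → Desc x → Desc (x ∘ punchIn m)
  desc-punch m d i j lt = d _ _ (ℕ.≤∧≢⇒< (Fin.punchIn-mono-≤ m i j (ℕ.<⇒≤ lt))
    (λ e → ℕ.<⇒≢ lt (cong toℕ (Fin.punchIn-injective m i j (Fin.toℕ-injective e)))))

  -- A descending tuple is determined by its set of points: the two maxima agree, then the tails are
  -- compared.
  desc-unique : ∀ {r} {x y : Fin r → Pt} → Desc x → Desc y →
                (∀ i → ∃ λ j → x i ≈ᵖ y j) → (∀ i → ∃ λ j → y i ≈ᵖ x j) → x ≈ᵗ y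
  desc-unique {suc r} {x} {y} dx dy f g = go
    where
    head : x zero ≈ᵖ y zero
    head with f zero | g zero
    ... | zero  , e | _          = e
    ... | suc j , e | zero  , e′ = ≈-sym e′
    ... | suc j , e | suc i , e′ = contradiction
      (<-trans (<-resp (≈-sym e) ≈-refl (dy zero (suc j) (s≤s z≤n)))
               (<-resp (≈-sym e′) ≈-refl (dx zero (suc i) (s≤s z≤n))))
      (<-irr ≈-refl)
    f′ : ∀ i → ∃ λ j → x (suc i) ≈ᵖ y (suc j)
    f′ i with f (suc i)
    ... | zero  , e = contradiction (dx zero (suc i) (s≤s z≤n)) (<-irr (≈-trans e (≈-sym head)))
    ... | suc j , e = j , e
    g′ : ∀ i → ∃ λ j → y (suc i) ≈ᵖ x (suc j)
    g′ i with g (suc i)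
    ... | zero  , e = contradiction (dy zero (suc i) (s≤s z≤n)) (<-irr (≈-trans e head))
    ... | suc j , e = j , e
    go : x ≈ᵗ y
    go zero    = head
    go (suc i) = desc-unique (desc-tail dx) (desc-tail dy) f′ g′ i

  bound-above : ∀ {r} (x : Fin r → Pt) → Desc x → ∃ λ b → ∀ i → x i <ᵖ b
  bound-above {zero}  x d = base , λ ()
  bound-above {suc r} x d with above (x zero)
  ... | b , lt = b , desc-below d lt

  -- The last component, that strict upper bounds of the old tuple and of `u` bound the new one, is
  -- what lets the recursion put the head back on top.
  insert : ∀ {r} (x : Fin r → Pt) → Desc x → ∀ u → (∃ λ j → u ≈ᵖ x j) ⊎
           (∃ λ (y : Fin (suc r) → Pt) → Desc y × (∃ λ j → u ≈ᵖ y j) ×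
             (∀ i → ∃ λ j → x i ≈ᵖ y j) × (∀ b → u <ᵖ b → (∀ i → x i <ᵖ b) → ∀ j → y j <ᵖ b))
  insert {zero} x d u = inj₂ ((λ _ → u) , (λ { zero zero () }) , (zero , ≈-refl) , (λ ()) , λ b lt _ _ → lt)
  insert {suc r} x d u with <-tri u (x zero)
  ... | inj₂ (inj₁ e)  = inj₁ (zero , e)
  ... | inj₂ (inj₂ gt) = inj₂ (u ∷ x , desc-cons d (desc-below d gt) , (zero , ≈-refl) , (λ i → suc i , ≈-refl)
                             , λ { b lt f zero → lt ; b lt f (suc j) → f j })
  ... | inj₁ lt with insert (x ∘ suc) (desc-tail d) u
  ...   | inj₁ (j , e) = inj₁ (suc j , e)
  ...   | inj₂ (y , dy , (j , e) , cover , bound) = inj₂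
          (x zero ∷ y , desc-cons dy (bound _ lt (λ i → d zero (suc i) (s≤s z≤n))) , (suc j , e)
          , (λ { zero → zero , ≈-refl ; (suc i) → suc (proj₁ (cover i)) , proj₂ (cover i) })
          , λ { b lt f zero → f zero ; b lt f (suc j) → bound b lt (f ∘ suc) j })

  abstract
    -- Repetitions in `s` are made up for by points above, so that every tuple lies in a simplex of
    -- full size. This simplex is not canonical; `independent` shows that its choice is immaterial.
    enumerate : ∀ {r} (s : Fin r → Pt) → ∃ λ (x : Fin r → Pt) → Desc x × (∀ i → ∃ λ j → s i ≈ᵖ x j)
    enumerate {zero}  s = s , (λ ()) , λ ()
    enumerate {suc r} s with enumerate (s ∘ suc)
    ... | x , d , cover with insert x d (s zero)
    ...   | inj₂ (y , dy , at-u , at-x , _) = y , dy , λ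
            { zero → at-u
            ; (suc i) → let (j , e) = cover i ; (j′ , e′) = at-x j in j′ , ≈-trans e e′ }
    ...   | inj₁ (j , e) with bound-above x d
    ...     | b , lt = b ∷ x , desc-cons d lt , λ
              { zero → suc j , e ; (suc i) → suc (proj₁ (cover i)) , proj₂ (cover i) }

module Models (em : ∀ {a} → ExcludedMiddle a) (k : ℕ) (P : Palette k) where
  open Classical em
  open Quantifier em
  open Frame em k P

  -- A simplex carries a function and a proof, so equal colours do not yield equal simplices;
  -- relevant sets look at the colours only.
  Ext : (Simp → Bool) → Set
  Ext W = ∀ {K K′} → (∀ l → proj₁ K l ≡ proj₁ K′ l) → W K ≡ W K′

  -- λ labels the faces of U by ultrafilters on the colours; J chooses, for each
  -- n points, an ultrafilter on simplices whose marginals are the labels. No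
  -- coherence is needed between the J of different simplices.
  record Model : Set₁ where
    field
      order : StrictOrder
    open StrictOrder order public
    field
      label    : (Fin N → Pt) → Uf Colour
      joint    : (Fin n → Pt) → Uf Simp
      label-cong : ∀ {F F′} → F ≈ᵗ F′ → label F ≋ label F′
      joint-cong : ∀ {x x′} → x ≈ᵗ x′ → ∀ {W} → Ext W → mem (joint x) W ≡ mem (joint x′) W
      marginal : ∀ {x} → Desc x → ∀ m → mapᵘ (λ K → proj₁ K m) (joint x) ≋ label (x ∘ punchIn m)
      realize  : ∀ {a} → Desc a → ∀ {W} → Ext W →
                 Most (label a) (λ c → ∃ λ K → proj₁ K zero ≡ c × W K ≡ true) →
                 ∃ λ b → a zero <ᵖ b × mem (joint (b ∷ a)) W ≡ true

  module Semantics (𝔐 : Model) where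
    open Model 𝔐

    Tuple : Set
    Tuple = Fin n → Pt

    Resp : (Atom → Bool) → Set
    Resp X = ∀ {a b} → Same a b → X a ≡ X b

    val : Tuple → (Atom → Bool) → Bool
    val s X = let (x , _ , cover) = enumerate s in mem (joint x) (λ K → X (atom (proj₁ ∘ cover) K))

    image : ∀ {x x′ : Tuple} {p p′ : Fin n → Fin n} → Desc x → Desc x′ → (x ∘ p) ≈ᵗ (x′ ∘ p′) →
            ∀ {i j} → p i ≡ p j → p′ i ≡ p′ j
    image {x} {x′} {p′ = p′} dx dx′ e {i} {j} q = desc-inj dx′ _ _
      (≈-trans (≈-sym (e i)) (subst (λ z → x z ≈ᵖ x′ (p′ j)) (sym q) (e j)))

    face-in : ∀ {x x′ : Tuple} {p p′ : Fin n → Fin n} {θ : Fin N → Fin n} {m m′} →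
              (x ∘ p) ≈ᵗ (x′ ∘ p′) → Miss (p ∘ θ) m → Miss (p′ ∘ θ) m′ →
              ∀ i → ∃ λ j → x (punchIn m i) ≈ᵖ x′ (punchIn m′ j)
    face-in {x} {x′} {p} {p′} {θ} {m} {m′} e (inj , ms) (_ , ms′) i
      with onto-rest inj ms (punchIn m i) (Fin.punchInᵢ≢i m i)
    ... | l , q with punch-surj m′ (p′ (θ l)) (ms′ l)
    ...   | j , q′ = j , subst (λ z → x z ≈ᵖ _) q (subst (λ z → _ ≈ᵖ x′ z) (sym q′) (e (θ l)))

    face-eq : ∀ {x x′ : Tuple} {p p′ : Fin n → Fin n} {θ : Fin N → Fin n} {m m′} → Desc x → Desc x′ →
              (x ∘ p) ≈ᵗ (x′ ∘ p′) → Miss (p ∘ θ) m → Miss (p′ ∘ θ) m′ →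
              (x ∘ punchIn m) ≈ᵗ (x′ ∘ punchIn m′)
    face-eq {x} {x′} {p} {p′} {θ} dx dx′ e a b = desc-unique (desc-punch _ dx) (desc-punch _ dx′)
      (face-in {x} {x′} {p} {p′} {θ} e a b) (face-in {x′} {x} {p′} {p} {θ} (λ i → ≈-sym (e i)) b a)

    -- A tuple sees its whole simplex, one face of it, or no face. In the first case its points
    -- determine the simplex; in the second the value depends on the colour of one face, and
    -- `marginal` reduces it to the label of that face; in the third `X` is constant.
    independent : ∀ {X} → Resp X → ∀ {x x′ : Tuple} {p p′ : Fin n → Fin n} → Desc x → Desc x′ →
                  (x ∘ p) ≈ᵗ (x′ ∘ p′) →
                  mem (joint x) (λ K → X (atom p K)) ≡ mem (joint x′) (λ K → X (atom p′ K))
    independent {X} resp {x} {x′} {p} {p′} dx dx′ e = go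
      where
      fwd : ∀ {i j} → p i ≡ p j → p′ i ≡ p′ j
      fwd = image dx dx′ e
      bwd : ∀ {i j} → p′ i ≡ p′ j → p i ≡ p j
      bwd = image dx′ dx (λ i → ≈-sym (e i))
      go : mem (joint x) (λ K → X (atom p K)) ≡ mem (joint x′) (λ K → X (atom p′ K))
      go with em {P = Inj p}
      ... | yes inj = trans (joint-cong x≈x′ (λ {K} {K′} e → resp (sim-ext {K = K} {K′} e)))
              (mem-cong (joint x′) _ _ (λ K → resp (pos-ext p≡p′)))
        where
        x≈x′ : x ≈ᵗ x′
        x≈x′ = desc-unique dx dx′
          (λ i → let (j , q) = injective⇒onto p inj i in p′ j , subst (λ z → x z ≈ᵖ x′ (p′ j)) q (e j))
          (λ i → let (j , q) = injective⇒onto p′ (λ u v → inj u v ∘ bwd) i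
                 in p j , subst (λ z → x′ z ≈ᵖ x (p j)) q (≈-sym (e j)))
        p≡p′ : ∀ l → p l ≡ p′ l
        p≡p′ l = desc-inj dx′ _ _ (≈-trans (≈-sym (x≈x′ (p l))) (e l))
      ... | no ¬inj with em {P = ∃ λ (θ : Fin N → Fin n) → Inj (p ∘ θ)}
      ...   | no none = trans (mem-cong (joint x) _ _ (λ K → resp (blind p p′ K K₀ fwd bwd none)))
                (trans (mem-const (joint x) _) (trans (sym (mem-const (joint x′) _))
                  (mem-cong (joint x′) _ _ (λ K → sym (resp (blind p′ p′ K K₀ id id none′))))))
        where
        K₀ : Simp
        K₀ = proj₁ (extend₁ zero (filler zero zero))
        none′ : ¬ (∃ λ (θ : Fin N → Fin n) → Inj (p′ ∘ θ))
        none′ (θ , inj) = none (θ , λ u v → inj u v ∘ fwd)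
        blind : ∀ q q′ K K′ → (∀ {i j} → q i ≡ q j → q′ i ≡ q′ j) → (∀ {i j} → q′ i ≡ q′ j → q i ≡ q j) →
                ¬ (∃ λ (θ : Fin N → Fin n) → Inj (q ∘ θ)) → Same (atom q K) (atom q′ K′)
        blind q q′ K K′ f g none = record
          { ker = λ _ _ → f ; ker⁻ = λ _ _ → g ; lab = λ θ _ a _ → contradiction (θ , proj₁ a) none }
      ...   | yes (θ , injθ) = trans (mem-cong (joint x) _ _ (λ K → resp (see p m K (fwd , bwd) ¬inj (injθ , ms) refl)))
                (trans (marginal dx m g) (trans (label-cong (face-eq dx dx′ e (injθ , ms) (injθ′ , ms′)) g)
                (trans (sym (marginal dx′ m′ g))
                  (mem-cong (joint x′) _ _ (λ K → sym (resp (see p′ m′ K (id , id) ¬inj′ (injθ′ , ms′) refl)))))))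
        where
        m = proj₁ (missing (p ∘ θ))
        ms = proj₂ (missing (p ∘ θ))
        m′ = proj₁ (missing (p′ ∘ θ))
        ms′ = proj₂ (missing (p′ ∘ θ))
        injθ′ : Inj (p′ ∘ θ)
        injθ′ u v = injθ u v ∘ bwd
        ¬inj′ : ¬ Inj p′
        ¬inj′ inj = ¬inj λ u v → inj u v ∘ fwd
        g : Colour → Bool
        g c = X (atom p′ (proj₁ (extend₁ m′ c)))
        see : ∀ q m₁ K → (∀ {i j} → q i ≡ q j → p′ i ≡ p′ j) × (∀ {i j} → p′ i ≡ p′ j → q i ≡ q j) →
              ¬ Inj q → Miss (q ∘ θ) m₁ → ∀ {c} → c ≡ proj₁ K m₁ → Same (atom q K) (atom p′ (proj₁ (extend₁ m′ c)))
        see q m₁ K (f , h) ¬injq miss refl = record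
          { ker = λ _ _ → f ; ker⁻ = λ _ _ → h
          ; lab = λ θ′ _ a b → trans (cong (proj₁ K) (one-face ¬injq a miss))
              (trans (sym (proj₂ (extend₁ m′ (proj₁ K m₁))))
                (cong (proj₁ (proj₁ (extend₁ m′ (proj₁ K m₁)))) (one-face ¬inj′ (injθ′ , ms′) b))) }

    val-rep : ∀ {X} → Resp X → ∀ {s x : Tuple} {p} → Desc x → s ≈ᵗ (x ∘ p) →
              val s X ≡ mem (joint x) (λ K → X (atom p K))
    val-rep resp {s} d e = let (x , d′ , cover) = enumerate s in
      independent resp d′ d (λ i → ≈-trans (≈-sym (proj₂ (cover i))) (e i))

    val-cong : ∀ {X} → Resp X → ∀ {s t : Tuple} → s ≈ᵗ t → val s X ≡ val t X
    val-cong resp {s} {t} e = let (x , d , cover) = enumerate t in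
      val-rep resp d (λ i → ≈-trans (e i) (proj₂ (cover i)))

    val-act : ∀ {X} → Resp X → ∀ (s : Tuple) σ → val (s ∘ σ) X ≡ val s (λ a → X (act a σ))
    val-act resp s σ = let (x , d , cover) = enumerate s in
      val-rep resp d (λ i → proj₂ (cover (σ i)))

    val-diag : ∀ (s : Tuple) i j → (val s (λ a → ⌊ pos a i ≡ pos a j ⌋) ≡ true → s i ≈ᵖ s j)
                                 × (s i ≈ᵖ s j → val s (λ a → ⌊ pos a i ≡ pos a j ⌋) ≡ true)
    val-diag s i j with enumerate s
    ... | x , d , cover rewrite mem-const (joint x) ⌊ proj₁ (cover i) ≡ proj₁ (cover j) ⌋
      = (λ e → ≈-trans (proj₂ (cover i)) (subst (λ z → x z ≈ᵖ s j) (sym (⌊⌋-elim e)) (≈-sym (proj₂ (cover j)))))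
      , λ e → ⌊⌋-intro (desc-inj d _ _ (≈-trans (≈-sym (proj₂ (cover i))) (≈-trans e (proj₂ (cover j)))))

    cyl-set : Fin n → (Atom → Bool) → Atom → Bool
    cyl-set i X a = ⌊ (∃ λ b → SameOn (Off i) a b × X b ≡ true) ⌋

    cyl-off : ∀ i X {a b} → SameOn (Off i) a b → cyl-set i X a ≡ cyl-set i X b
    cyl-off i X s = ⌊⌋-cong
      (λ { (c , t , e) → c , same-trans (same-sym s) t , e })
      (λ { (c , t , e) → c , same-trans s t , e })

    cyl-resp : ∀ i X → Resp (cyl-set i X)
    cyl-resp i X s = cyl-off i X (weaken _ s)

    -- A set that ignores the entry `i` allows this entry to be overwritten by another one, after
    -- which the two tuples agree.
    val-off : ∀ {X} i → Resp X → (∀ {a b} → SameOn (Off i) a b → X a ≡ X b) →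
              ∀ {s t : Tuple} → (∀ j → j ≢ i → s j ≈ᵖ t j) → val s X ≡ val t X
    val-off {X} i resp inv {s} {t} e = trans (step s) (trans (val-cong resp e′) (sym (step t)))
      where
      σ : Fin n → Fin n
      σ = [ i ∣ proj₁ (other i) ]
      e′ : (s ∘ σ) ≈ᵗ (t ∘ σ)
      e′ l = e (σ l) (sub-off (proj₂ (other i)) l)
      step : ∀ s → val s X ≡ val (s ∘ σ) X
      step s = trans (mem-cong (joint _) _ _ (λ K → inv (pos-off _))) (sym (val-act resp s σ))
        where
        pos-off : ∀ a → SameOn (Off i) a (act a σ)
        pos-off a = same-sym (record
          { ker  = λ {u} {v} u≢ v≢ q → subst₂ (λ y z → pos a y ≡ pos a z) (sub-id u≢) (sub-id v≢) q
          ; ker⁻ = λ {u} {v} u≢ v≢ q → subst₂ (λ y z → pos a y ≡ pos a z) (sym (sub-id u≢)) (sym (sub-id v≢)) q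
          ; lab  = λ θ A x y → cong (col a) (missing-unique (proj₁ x) (proj₂ x)
              (λ l q → proj₂ y l (trans (cong (pos a) (sym (sub-id (A l)))) q))) })

    val-cyl⁻ : ∀ {X} → Resp X → ∀ i {s t : Tuple} → (∀ j → j ≢ i → s j ≈ᵖ t j) →
               val t X ≡ true → val s (cyl-set i X) ≡ true
    val-cyl⁻ {X} resp i {s} {t} e vt =
      trans (val-off i (cyl-resp i X) (cyl-off i X) e)
        (mono (joint _) _ _ (λ K h → ⌊⌋-intro (_ , same-refl , h)) vt)

    -- The ultrafilter decides whether witnesses repeat an entry or use a new point. In the first
    -- case one entry `j` serves for most colourings. In the second, `realign` extends most colours
    -- of the base to a simplex with type in `X`, and `realize` finds a single point that serves for
    -- all of them.
    val-cyl : ∀ {X} → Resp X → ∀ i (s : Tuple) → val s (cyl-set i X) ≡ true →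
              ∃ λ t → val t X ≡ true × (∀ j → j ≢ i → t j ≈ᵖ s j)
    val-cyl {X} resp i s vs = finish (most-⊎ (joint x) (most-mono (joint x) split
        (mem⇒most (joint x) (trans (sym (val-rep (cyl-resp i X) dx (λ _ → ≈-refl)))
          (trans (sym (val-off i (cyl-resp i X) (cyl-off i X) s≈)) vs)))))
      where
      a : Fin N → Pt
      a = proj₁ (enumerate (s ∘ punchIn i))
      da : Desc a
      da = proj₁ (proj₂ (enumerate (s ∘ punchIn i)))
      cover : ∀ j → ∃ λ l → s (punchIn i j) ≈ᵖ a l
      cover = proj₂ (proj₂ (enumerate (s ∘ punchIn i)))
      x : Tuple
      x = proj₁ (above (a zero)) ∷ a
      dx : Desc x
      dx = desc-cons da (desc-below da (proj₂ (above (a zero))))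
      p : Fin n → Fin n
      p l with l Fin.≟ i
      ... | yes _ = zero
      ... | no ne = suc (proj₁ (cover (punchOut (ne ∘ sym))))
      p-i : p i ≡ zero
      p-i with i Fin.≟ i
      ... | yes _ = refl
      ... | no ne = contradiction refl ne
      p-off : ∀ l → l ≢ i → p l ≢ zero
      p-off l ne with l Fin.≟ i
      ... | yes e = λ _ → ne e
      ... | no _  = λ ()
      p-cover : ∀ b l → l ≢ i → s l ≈ᵖ (b ∷ a) (p l)
      p-cover b l ne with l Fin.≟ i
      ... | yes e = contradiction e ne
      ... | no q = subst (λ z → s z ≈ᵖ a (proj₁ (cover (punchOut (q ∘ sym))))) (Fin.punchIn-punchOut (q ∘ sym))
          (proj₂ (cover (punchOut (q ∘ sym))))
      s≈ : ∀ j → j ≢ i → s j ≈ᵖ x (p j)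
      s≈ = p-cover _
      Near : Simp → Atom → Set
      Near K b = SameOn (Off i) (atom p K) b × X b ≡ true
      split : ∀ K → cyl-set i X (atom p K) ≡ true →
              (∃ λ j → i ≢ j × (∃ λ b → Near K b × pos b i ≡ pos b j)) ⊎
              (∃ λ b → Near K b × (∀ l → l ≢ i → pos b l ≢ pos b i))
      split K h with ⌊⌋-elim h
      ... | b , near with em {P = ∃ λ j → i ≢ j × pos b i ≡ pos b j}
      ...   | yes (j , ne , e) = inj₁ (j , ne , b , near , e)
      ...   | no ¬e = inj₂ (b , near , λ l ne e → ¬e (l , (λ q → ne (sym q)) , sym e))
      finish : _ → ∃ λ t → val t X ≡ true × (∀ j → j ≢ i → t j ≈ᵖ s j)
      finish (inj₁ mj) with most-fin (joint x) mj
      ... | j , m = x ∘ p ∘ [ i ∣ j ] , vt , λ l ne → ≈-trans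
              (subst (λ z → x (p z) ≈ᵖ x (p l)) (sym (sub-id ne)) ≈-refl) (≈-sym (s≈ l ne))
        where
        vt : val (x ∘ p ∘ [ i ∣ j ]) X ≡ true
        vt = trans (val-rep resp dx (λ _ → ≈-refl)) (most⇒mem (joint x) (most-mono (joint x)
          (λ { K (ne , b , (same , Xb) , e) → trans (resp (cyl-diag ne same e)) Xb }) m))
      finish (inj₂ m) with realize da {W = λ K → X (atom p K)} (λ {K} {K′} e → resp (sim-ext {K = K} {K′} e))
          (most-≋ {J = mapᵘ (λ K → proj₁ K zero) (joint x)} {label a} (marginal dx zero) (most-mono (joint x)
            (λ { K (b , (same , Xb) , new) → let (K′ , ez , sm) = realign {q = pos b} same p-i p-off new
                                             in K′ , ez , trans (resp sm) Xb }) m))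
      ... | b , lt , mb = (b ∷ a) ∘ p
          , trans (val-rep resp (desc-cons da (desc-below da lt)) (λ _ → ≈-refl)) mb
          , λ j ne → ≈-sym (p-cover b j ne)

    -- A first point creates a face whose label is concentrated on the base colour of `c`; a second
    -- one realises the simplex of `c` over that face. This makes the representation faithful.
    val-some : ∀ {X} → Resp X → ∀ c → X c ≡ true → ∃ λ s → val s X ≡ true
    val-some {X} resp c Xc = (b₂ ∷ a₁) ∘ pos c , trans (val-rep resp (desc-cons da₁ (desc-below da₁ lt₂)) (λ _ → ≈-refl)) m₂
      where
      c₀ : Colour
      c₀ = col c zero
      a₀ : Fin N → Pt
      a₀ = proj₁ (enumerate (λ _ → base))
      da₀ : Desc a₀
      da₀ = proj₁ (proj₂ (enumerate {N} (λ _ → base)))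
      W : Simp → Bool
      W K = ⌊ proj₁ K (suc zero) ≡ c₀ ⌋
      step₁ : ∃ λ b → a₀ zero <ᵖ b × mem (joint (b ∷ a₀)) W ≡ true
      step₁ = realize da₀ (λ e → ⌊⌋-cong (trans (sym (e (suc zero)))) (trans (e (suc zero))))
        (most-all (label a₀) λ d → let (K , e , e′) = extend {zero} {suc zero} (λ ()) d c₀ in K , e , ⌊⌋-intro e′)
      b₁ = proj₁ step₁
      d₁ : Desc (b₁ ∷ a₀)
      d₁ = desc-cons da₀ (desc-below da₀ (proj₁ (proj₂ step₁)))
      a₁ : Fin N → Pt
      a₁ = (b₁ ∷ a₀) ∘ punchIn (suc zero)
      da₁ : Desc a₁
      da₁ = desc-punch (suc zero) d₁
      step₂ : ∃ λ b → a₁ zero <ᵖ b × mem (joint (b ∷ a₁)) (λ K → X (atom (pos c) K)) ≡ true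
      step₂ = realize da₁ (λ {K} {K′} e → resp (sim-ext {K = K} {K′} e))
        (most-≋ {J = mapᵘ (λ K → proj₁ K (suc zero)) (joint (b₁ ∷ a₀))} {label a₁} (marginal d₁ (suc zero))
            (most-mono (joint (b₁ ∷ a₀)) (λ K e → sim c , sym (⌊⌋-elim e) , Xc)
          (mem⇒most (joint (b₁ ∷ a₀)) (proj₂ (proj₂ step₁)))))
      b₂ = proj₁ step₂
      lt₂ = proj₁ (proj₂ step₂)
      m₂ = proj₂ (proj₂ step₂)

-- Embeddings into set algebras and the polyadic equality axioms

record Embedding {n ℓ} {τ : Signature n} (A B : Algebra τ ℓ) : Set ℓ where
  private
    module A = Algebra A
    module B = Algebra B
  field
    map  : A.Carrier → B.Carrier
    map-cong : ∀ {x y} → x A.≈ y → map x B.≈ map y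
    map-inj  : ∀ {x y} → map x B.≈ map y → x A.≈ y
    map-homo : ∀ f xs → map (A.⟦ f ⟧ xs) B.≈ B.⟦ f ⟧ (map ∘ xs)

_∘ᵉ_ : ∀ {n ℓ} {τ : Signature n} {A B C : Algebra τ ℓ} → Embedding B C → Embedding A B → Embedding A C
_∘ᵉ_ {C = C} g f = record
  { map  = G.map ∘ F.map
  ; map-cong = G.map-cong ∘ F.map-cong
  ; map-inj = F.map-inj ∘ G.map-inj
  ; map-homo = λ o xs → Setoid.trans (Algebra.setoid C) (G.map-cong (F.map-homo o xs)) (G.map-homo o (F.map ∘ xs))
  }
  where
  module F = Embedding f
  module G = Embedding g

transpose-at₁ : ∀ {n} (i j : Fin n) → transpose i j i ≡ j
transpose-at₁ i j with i Fin.≟ i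
... | yes _ = refl
... | no ne = contradiction refl ne

transpose-at₂ : ∀ {n} (i j : Fin n) → transpose i j j ≡ i
transpose-at₂ i j with j Fin.≟ i
... | yes e = e
... | no _ with j Fin.≟ j
...   | yes _ = refl
...   | no ne = contradiction refl ne

transpose-off : ∀ {n} {i j l : Fin n} → l ≢ i → l ≢ j → transpose i j l ≡ l
transpose-off {i = i} {j} {l} p q with l Fin.≟ i
... | yes e = contradiction e p
... | no _ with l Fin.≟ j
...   | yes e = contradiction e q
...   | no _  = refl

transpose-comm : ∀ {n} (i j l : Fin n) → transpose i j l ≡ transpose j i l
transpose-comm i j l = go (l Fin.≟ i) (l Fin.≟ j)
  where
  go : Dec (l ≡ i) → Dec (l ≡ j) → transpose i j l ≡ transpose j i l
  go (yes refl) _          = trans (transpose-at₁ l j) (sym (transpose-at₂ j l))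
  go (no _)     (yes refl) = trans (transpose-at₂ i l) (sym (transpose-at₁ l i))
  go (no p)     (no q)     = trans (transpose-off p q) (sym (transpose-off q p))

transpose-id : ∀ {n} (i l : Fin n) → transpose i i l ≡ l
transpose-id i l = go (l Fin.≟ i)
  where
  go : Dec (l ≡ i) → transpose i i l ≡ l
  go (yes refl) = transpose-at₁ l l
  go (no p)     = transpose-off p p

transpose-braid : ∀ {n} (i j k l : Fin n) → i ≢ j → i ≢ k → j ≢ k →
                  transpose i j (transpose i k l) ≡ transpose j k (transpose i j l)
transpose-braid i j k l i≢j i≢k j≢k = go (l Fin.≟ i) (l Fin.≟ j) (l Fin.≟ k)
  where
  go : Dec (l ≡ i) → Dec (l ≡ j) → Dec (l ≡ k) →
       transpose i j (transpose i k l) ≡ transpose j k (transpose i j l)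
  go (yes refl) _ _ = trans (cong (transpose l j) (transpose-at₁ l k))
    (trans (transpose-off (i≢k ∘ sym) (j≢k ∘ sym))
      (sym (trans (cong (transpose j k) (transpose-at₁ l j)) (transpose-at₁ j k))))
  go (no p) (yes refl) _ = trans (cong (transpose i l) (transpose-off p j≢k))
    (trans (transpose-at₂ i l) (sym (trans (cong (transpose l k) (transpose-at₂ i l)) (transpose-off i≢j i≢k))))
  go (no p) (no q) (yes refl) = trans (cong (transpose i j) (transpose-at₂ i l))
    (trans (transpose-at₁ i j) (sym (trans (cong (transpose j l) (transpose-off p q)) (transpose-at₂ j l))))
  go (no p) (no q) (no r) = trans (cong (transpose i j) (transpose-off p r))
    (trans (transpose-off p q) (sym (trans (cong (transpose j k) (transpose-off p q)) (transpose-off q r))))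

module Representation (em : ∀ {a} → ExcludedMiddle a) {ℓ : Level} where
  open Classical em

  module _ {n : ℕ} {τ : Signature n} (A : Algebra τ ℓ) (B : Base τ ℓ)
           (e : Embedding A (fullSetAlgebra em B)) where
    private
      module A = Algebra A
      module E = Embedding e

    -- One factor suffices: the full set algebra itself, with the image of the embedding as
    -- subuniverse of the product.
    embedding⇒representable : Representable em A
    embedding⇒representable = record
      { Index       = Lift ℓ ⊤
      ; setAlgebras = λ _ → record
          { base = B
          ; fieldOfSets = record { Member = λ _ → Lift ℓ ⊤ ; respects = λ _ m → m ; closed = λ _ _ _ → lift tt } }
      ; sub = record
          { Member   = λ y → ∃ λ x → ∀ s → Func.to (E.map x) s ≡ Func.to (proj₁ (y (lift tt))) s
          ; respects = λ { y≈z (x , q) → x , λ s → trans (q s) (y≈z (lift tt) s) }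
          ; closed   = λ f ys ms → A.⟦ f ⟧ (proj₁ ∘ ms) , λ s → trans (E.map-homo f (proj₁ ∘ ms) s)
              (Algebra.⟦⟧-cong (fullSetAlgebra em B) f (λ l → proj₂ (ms l)) s)
          }
      ; iso = record
          { bijection = record
              { to        = λ x → (λ _ → E.map x , lift tt) , x , λ _ → refl
              ; cong      = λ x≈y _ → E.map-cong x≈y
              ; bijective = (λ q → E.map-inj (q (lift tt)))
                          , λ y → proj₁ (proj₂ y) , λ z≈x _ s → trans (E.map-cong z≈x s) (proj₂ (proj₂ y) s)
              }
          ; homo = λ f xs _ → E.map-homo f xs
          }
      }

  module _ {n : ℕ} (A : Algebra {n} full ℓ) (U : Setoid ℓ ℓ)
           (e : Embedding A (fullSetAlgebra em (cube U))) where
    private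
      module E = Embedding e
      module U = Setoid U
      open Algebra A renaming (_≤_ to _≤ᴬ_)
      open PEA-operations A
      Tup : Set ℓ
      Tup = Fin n → U.Carrier

      H : Carrier → Tup → Bool
      H x = Func.to (E.map x)

      H-cong : ∀ x {s t : Tup} → (∀ i → s i U.≈ t i) → H x s ≡ H x t
      H-cong x = Func.cong (E.map x)

      H-∨ : ∀ x y s → H (x ∨ y) s ≡ H x s ∨ᵇ H y s
      H-∨ x y = E.map-homo (bool join) (x ∷ y ∷ [])

      H-∧ : ∀ x y s → H (x ∧ y) s ≡ H x s ∧ᵇ H y s
      H-∧ x y = E.map-homo (bool meet) (x ∷ y ∷ [])

      H-∁ : ∀ x s → H (∁ x) s ≡ notᵇ (H x s)
      H-∁ x = E.map-homo (bool compl) (x ∷ [])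

      H-𝟙 : ∀ s → H 𝟙 s ≡ true
      H-𝟙 = E.map-homo (bool top) []

      H-𝟘 : ∀ s → H 𝟘 s ≡ false
      H-𝟘 = E.map-homo (bool bot) []

      H-s : ∀ i j x s → H (PEA-operations.s A i j x) s ≡ H x (s ∘ [ i ∣ j ])
      H-s i j x = E.map-homo (op (ext (repl i j) tt)) (x ∷ [])

      H-p : ∀ i j x s → H (p i j x) s ≡ H x (s ∘ transpose i j)
      H-p i j x = E.map-homo (op (ext (swap i j) tt)) (x ∷ [])

      H-d : ∀ i j s → H (d i j) s ≡ ⌊ s i U.≈ s j ⌋
      H-d i j = E.map-homo (op (ext (diag i j) tt)) []

      Near : Fin n → Carrier → Tup → Set ℓ
      Near i x s = ∃ λ (t : Tup) → H x t ≡ true × (∀ j → j ≢ i → t j U.≈ s j)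

      H-c : ∀ i x s → H (c i x) s ≡ ⌊ Near i x s ⌋
      H-c i x = E.map-homo (op (cyl i)) (x ∷ [])

      c-to : ∀ {i x s} → H (c i x) s ≡ true → Near i x s
      c-to q = ⌊⌋-elim (trans (sym (H-c _ _ _)) q)

      c-from : ∀ {i x s} → Near i x s → H (c i x) s ≡ true
      c-from w = trans (H-c _ _ _) (⌊⌋-intro w)

      ≤-from : ∀ {x y} → (∀ s → H x s ≡ true → H y s ≡ true) → x ≤ᴬ y
      ≤-from {x} {y} f = E.map-inj λ s → trans (H-∧ x y s) (absorb (f s))
        where
        absorb : ∀ {a b} → (a ≡ true → b ≡ true) → a ∧ᵇ b ≡ a
        absorb {false} _ = refl
        absorb {true}  g = g refl

      ≡⇒≈ : ∀ {s : Tup} {i j} → i ≡ j → s i U.≈ s j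
      ≡⇒≈ refl = U.refl

      sub-≢ : ∀ {i j : Fin n} → i ≢ j → ∀ l → [ i ∣ j ] l ≢ i
      sub-≢ {i} i≢j l with l Fin.≟ i
      ... | yes _ = i≢j ∘ sym
      ... | no ne = ne

      sub-off′ : ∀ {i j l : Fin n} → l ≢ i → [ i ∣ j ] l ≡ l
      sub-off′ {i} {l = l} ne with l Fin.≟ i
      ... | yes q = contradiction q ne
      ... | no _  = refl

      sub-both : ∀ (i j : Fin n) → [ i ∣ j ] i ≡ j × [ i ∣ j ] j ≡ j
      sub-both i j with i Fin.≟ i | j Fin.≟ i
      ... | yes _ | yes _ = refl , refl
      ... | yes _ | no _  = refl , refl
      ... | no ne | _     = contradiction refl ne

      swap-sub : ∀ (i j l : Fin n) → transpose i j ([ i ∣ j ] l) ≡ [ j ∣ i ] l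
      swap-sub i j l = go (l Fin.≟ i) (l Fin.≟ j)
        where
        go : Dec (l ≡ i) → Dec (l ≡ j) → transpose i j ([ i ∣ j ] l) ≡ [ j ∣ i ] l
        go (yes refl) (yes refl) = trans (cong (transpose l l) (proj₁ (sub-both l l)))
          (trans (transpose-at₁ l l) (sym (proj₁ (sub-both l l))))
        go (yes refl) (no _) = trans (cong (transpose l j) (proj₁ (sub-both l j)))
          (trans (transpose-at₂ l j) (sym (proj₂ (sub-both j l))))
        go (no _) (yes refl) = trans (cong (transpose i l) (proj₂ (sub-both i l)))
          (trans (transpose-at₂ i l) (sym (proj₁ (sub-both l i))))
        go (no p) (no q) = trans (cong (transpose i j) (sub-off′ p)) (trans (transpose-off p q) (sym (sub-off′ q)))

      isBoolean′ : IsBoolean A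
      isBoolean′ = record
        { isDistributiveLattice = record
          { isLattice = record
            { isEquivalence = isEquivalence
            ; ∨-comm  = λ x y → E.map-inj λ s → trans (H-∨ x y s) (trans (Bool.∨-comm (H x s) (H y s)) (sym (H-∨ y x s)))
            ; ∨-assoc = λ x y z → E.map-inj (assoc∨ x y z)
            ; ∨-cong  = λ p q → ⟦⟧-cong (bool join) λ { zero → p ; (suc zero) → q }
            ; ∧-comm  = λ x y → E.map-inj λ s → trans (H-∧ x y s) (trans (Bool.∧-comm (H x s) (H y s)) (sym (H-∧ y x s)))
            ; ∧-assoc = λ x y z → E.map-inj (assoc∧ x y z)
            ; ∧-cong  = λ p q → ⟦⟧-cong (bool meet) λ { zero → p ; (suc zero) → q }
            ; absorptive = (λ x y → E.map-inj (absorb₁ x y)) , (λ x y → E.map-inj (absorb₂ x y))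
            }
          ; ∨-distrib-∧ = (λ x y z → E.map-inj (distˡ∨ x y z)) , (λ x y z → E.map-inj (distʳ∨ x y z))
          ; ∧-distrib-∨ = (λ x y z → E.map-inj (distˡ∧ x y z)) , (λ x y z → E.map-inj (distʳ∧ x y z))
          }
        ; ∨-complement = (λ x → E.map-inj (compˡ∨ x)) , (λ x → E.map-inj (compʳ∨ x))
        ; ∧-complement = (λ x → E.map-inj (compˡ∧ x)) , (λ x → E.map-inj (compʳ∧ x))
        ; ¬-cong = λ q → ⟦⟧-cong (bool compl) λ { zero → q }
        }
        where
        assoc∨ : ∀ x y z s → H ((x ∨ y) ∨ z) s ≡ H (x ∨ (y ∨ z)) s
        assoc∨ x y z s rewrite H-∨ (x ∨ y) z s | H-∨ x y s | H-∨ x (y ∨ z) s | H-∨ y z s = Bool.∨-assoc (H x s) _ _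
        assoc∧ : ∀ x y z s → H ((x ∧ y) ∧ z) s ≡ H (x ∧ (y ∧ z)) s
        assoc∧ x y z s rewrite H-∧ (x ∧ y) z s | H-∧ x y s | H-∧ x (y ∧ z) s | H-∧ y z s = Bool.∧-assoc (H x s) _ _
        absorb₁ : ∀ x y s → H (x ∨ (x ∧ y)) s ≡ H x s
        absorb₁ x y s rewrite H-∨ x (x ∧ y) s | H-∧ x y s = proj₁ Bool.∨-∧-absorptive (H x s) _
        absorb₂ : ∀ x y s → H (x ∧ (x ∨ y)) s ≡ H x s
        absorb₂ x y s rewrite H-∧ x (x ∨ y) s | H-∨ x y s = proj₂ Bool.∨-∧-absorptive (H x s) _
        distˡ∨ : ∀ x y z s → H (x ∨ (y ∧ z)) s ≡ H ((x ∨ y) ∧ (x ∨ z)) s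
        distˡ∨ x y z s rewrite H-∨ x (y ∧ z) s | H-∧ y z s | H-∧ (x ∨ y) (x ∨ z) s | H-∨ x y s | H-∨ x z s
          = proj₁ Bool.∨-distrib-∧ (H x s) _ _
        distʳ∨ : ∀ x y z s → H ((y ∧ z) ∨ x) s ≡ H ((y ∨ x) ∧ (z ∨ x)) s
        distʳ∨ x y z s rewrite H-∨ (y ∧ z) x s | H-∧ y z s | H-∧ (y ∨ x) (z ∨ x) s | H-∨ y x s | H-∨ z x s
          = proj₂ Bool.∨-distrib-∧ (H x s) (H y s) (H z s)
        distˡ∧ : ∀ x y z s → H (x ∧ (y ∨ z)) s ≡ H ((x ∧ y) ∨ (x ∧ z)) s
        distˡ∧ x y z s rewrite H-∧ x (y ∨ z) s | H-∨ y z s | H-∨ (x ∧ y) (x ∧ z) s | H-∧ x y s | H-∧ x z s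
          = proj₁ Bool.∧-distrib-∨ (H x s) _ _
        distʳ∧ : ∀ x y z s → H ((y ∨ z) ∧ x) s ≡ H ((y ∧ x) ∨ (z ∧ x)) s
        distʳ∧ x y z s rewrite H-∧ (y ∨ z) x s | H-∨ y z s | H-∨ (y ∧ x) (z ∧ x) s | H-∧ y x s | H-∧ z x s
          = proj₂ Bool.∧-distrib-∨ (H x s) (H y s) (H z s)
        compˡ∨ : ∀ x s → H (∁ x ∨ x) s ≡ H 𝟙 s
        compˡ∨ x s rewrite H-∨ (∁ x) x s | H-∁ x s | H-𝟙 s = Bool.∨-inverseˡ (H x s)
        compʳ∨ : ∀ x s → H (x ∨ ∁ x) s ≡ H 𝟙 s
        compʳ∨ x s rewrite H-∨ x (∁ x) s | H-∁ x s | H-𝟙 s = Bool.∨-inverseʳ (H x s)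
        compˡ∧ : ∀ x s → H (∁ x ∧ x) s ≡ H 𝟘 s
        compˡ∧ x s rewrite H-∧ (∁ x) x s | H-∁ x s | H-𝟘 s = Bool.∧-inverseˡ (H x s)
        compʳ∧ : ∀ x s → H (x ∧ ∁ x) s ≡ H 𝟘 s
        compʳ∧ x s rewrite H-∧ x (∁ x) s | H-∁ x s | H-𝟘 s = Bool.∧-inverseʳ (H x s)

    -- The axioms are universally quantified equations, so they pass from the full set algebra on a
    -- power of `U` to everything embedded in it. This replaces any verification on coloured
    -- simplices.
    embedding⇒PEA : PEA A
    embedding⇒PEA = record
      { isBoolean = isBoolean′
      ; s-id = λ i x → E.map-inj λ s → trans (H-s i i x s) (H-cong x (λ l → ≡⇒≈ {s} (same i l)))
      ; p-id = λ i x → E.map-inj λ s → trans (H-p i i x s) (H-cong x (λ l → ≡⇒≈ {s} (transpose-id i l)))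
      ; p-sym = λ i j x → E.map-inj λ s → trans (H-p i j x s)
          (trans (H-cong x (λ l → ≡⇒≈ {s} (transpose-comm i j l))) (sym (H-p j i x s)))
      ; c-incr = λ i x → ≤-from λ s q → c-from (s , q , λ _ _ → U.refl)
      ; c-∨ = λ i x y → E.map-inj λ s → trans (≡true (c-∨-to i x y s) (c-∨-from i x y s)) (sym (H-∨ (c i x) (c i y) s))
      ; s-c = λ i j x → E.map-inj λ s → trans (H-s i j (c i x) s) (≡true
          (λ q → let (t , h , r) = c-to q in c-from (t , h , λ l ne → U.trans (r l ne) (≡⇒≈ {s} (sub-off′ ne))))
          (λ q → let (t , h , r) = c-to q in c-from (t , h , λ l ne → U.trans (r l ne) (≡⇒≈ {s} (sym (sub-off′ ne))))))
      ; c-s = λ i j x i≢j → E.map-inj λ s → ≡true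
          (λ q → let (t , h , r) = c-to q in trans (H-s i j x s) (trans
                   (H-cong x (λ l → U.sym (r ([ i ∣ j ] l) (sub-≢ i≢j l)))) (trans (sym (H-s i j x t)) h)))
          (λ q → c-from (s , q , λ _ _ → U.refl))
      ; s-c-comm = λ i j k x k≢i k≢j → E.map-inj λ s → trans (H-s i j (c k x) s)
          (≡true (s-c-comm-to i j k x k≢i k≢j s) (s-c-comm-from i j k x k≢i k≢j s))
      ; s-∨ = λ i j x y → E.map-inj (s-∨′ i j x y)
      ; s-∁ = λ i j x → E.map-inj (s-∁′ i j x)
      ; p-∨ = λ i j x y → E.map-inj (p-∨′ i j x y)
      ; p-∁ = λ i j x → E.map-inj (p-∁′ i j x)
      ; p-p = λ i j x → E.map-inj λ s → trans (H-p i j (p i j x) s) (trans (H-p i j x _)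
          (H-cong x (λ l → ≡⇒≈ {s} (trans (cong (transpose i j) (transpose-comm i j l)) (transpose-inverse i j)))))
      ; p-p-distinct = λ i j k x i≢j i≢k j≢k → E.map-inj λ s →
          trans (H-p i j (p i k x) s) (trans (H-p i k x _) (trans
            (H-cong x (λ l → ≡⇒≈ {s} (transpose-braid i j k l i≢j i≢k j≢k)))
            (trans (sym (H-p i j x _)) (sym (H-p j k (p i j x) s)))))
      ; p-s = λ i j x → E.map-inj λ s → trans (H-p i j (PEA-operations.s A i j x) s) (trans (H-s i j x _)
          (trans (H-cong x (λ l → ≡⇒≈ {s} (swap-sub i j l))) (sym (H-s j i x s))))
      ; s-d = λ i j → E.map-inj λ s → trans (H-s i j (d i j) s) (trans (H-d i j _)
          (trans (⌊⌋-intro (≡⇒≈ {s} (trans (proj₁ (sub-both i j)) (sym (proj₂ (sub-both i j)))))) (sym (H-𝟙 s))))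
      ; ∧-d = λ i j x → ≤-from λ s q → let r = trans (sym (H-∧ x (d i j) s)) q in
          trans (H-s i j x s) (trans (H-cong x (fold i j s (⌊⌋-elim (trans (sym (H-d i j s)) (∧-elim₂ {H x s} r)))))
            (∧-elim₁ r))
      }
      where
      same : ∀ (i l : Fin n) → [ i ∣ i ] l ≡ l
      same i l with l Fin.≟ i
      ... | yes q = sym q
      ... | no _  = refl
      fold : ∀ i j (s : Tup) → s i U.≈ s j → ∀ l → s ([ i ∣ j ] l) U.≈ s l
      fold i j s q l with l Fin.≟ i
      ... | yes refl = U.sym q
      ... | no _     = U.refl
      c-∨-to : ∀ i x y s → H (c i (x ∨ y)) s ≡ true → H (c i x) s ∨ᵇ H (c i y) s ≡ true
      c-∨-to i x y s q with c-to q
      ... | t , h , r with H x t in hx | trans (sym (H-∨ x y t)) h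
      ...   | true  | _  rewrite c-from {i} {x} {s} (t , hx , r) = refl
      ...   | false | hy rewrite c-from {i} {y} {s} (t , hy , r) = Bool.∨-zeroʳ (H (c i x) s)
      c-∨-from : ∀ i x y s → H (c i x) s ∨ᵇ H (c i y) s ≡ true → H (c i (x ∨ y)) s ≡ true
      c-∨-from i x y s q with H (c i x) s in hx
      ... | true  = let (t , h , r) = c-to hx in c-from (t , trans (H-∨ x y t) (cong (_∨ᵇ H y t) h) , r)
      ... | false = let (t , h , r) = c-to q in
            c-from (t , trans (H-∨ x y t) (trans (cong (H x t ∨ᵇ_) h) (Bool.∨-zeroʳ (H x t))) , r)
      s-c-comm-to : ∀ i j k x → k ≢ i → k ≢ j → ∀ s →
                    H (c k x) (s ∘ [ i ∣ j ]) ≡ true → H (c k (PEA-operations.s A i j x)) s ≡ true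
      s-c-comm-to i j k x k≢i k≢j s q with c-to q
      ... | t , h , r = c-from (t′ , trans (H-s i j x t′) (trans (H-cong x eq) h) , off)
        where
        -- The witness `t` agrees with the substituted tuple, so its entry `i` repeats the entry
        -- `j`. To recover the original entry `i`, only the entry `k` of `t` is copied into `s`.
        t′ : Tup
        t′ l with l Fin.≟ k
        ... | yes _ = t k
        ... | no _  = s l
        off : ∀ l → l ≢ k → t′ l U.≈ s l
        off l ne with l Fin.≟ k
        ... | yes e = contradiction e ne
        ... | no _  = U.refl
        at : t′ k U.≈ t k
        at with k Fin.≟ k
        ... | yes _ = U.refl
        ... | no ne = contradiction refl ne
        moved : ∀ l → l ≢ k → [ i ∣ j ] l ≢ k
        moved l ne with l Fin.≟ i
        ... | yes _ = λ e → k≢j (sym e)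
        ... | no _  = ne
        eq : ∀ l → t′ ([ i ∣ j ] l) U.≈ t l
        eq l with l Fin.≟ k
        ... | yes refl = U.trans (≡⇒≈ {t′} (sub-off′ k≢i)) at
        ... | no ne    = U.trans (off _ (moved l ne)) (U.sym (r l ne))
      s-c-comm-from : ∀ i j k x → k ≢ i → k ≢ j → ∀ s →
                      H (c k (PEA-operations.s A i j x)) s ≡ true → H (c k x) (s ∘ [ i ∣ j ]) ≡ true
      s-c-comm-from i j k x k≢i k≢j s q with c-to q
      ... | t , h , r = c-from (t ∘ [ i ∣ j ] , trans (sym (H-s i j x t)) h , λ l ne → r _ (moved l ne))
        where
        moved : ∀ l → l ≢ k → [ i ∣ j ] l ≢ k
        moved l ne with l Fin.≟ i
        ... | yes _ = λ e → k≢j (sym e)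
        ... | no _  = ne
      s-∨′ : ∀ i j x y s → H (PEA-operations.s A i j (x ∨ y)) s ≡
             H (PEA-operations.s A i j x ∨ PEA-operations.s A i j y) s
      s-∨′ i j x y s rewrite H-s i j (x ∨ y) s | H-∨ x y (s ∘ [ i ∣ j ])
        | H-∨ (PEA-operations.s A i j x) (PEA-operations.s A i j y) s | H-s i j x s | H-s i j y s = refl
      s-∁′ : ∀ i j x s → H (PEA-operations.s A i j (∁ x)) s ≡ H (∁ (PEA-operations.s A i j x)) s
      s-∁′ i j x s rewrite H-s i j (∁ x) s | H-∁ x (s ∘ [ i ∣ j ]) | H-∁ (PEA-operations.s A i j x) s | H-s i j x s = refl
      p-∨′ : ∀ i j x y s → H (p i j (x ∨ y)) s ≡ H (p i j x ∨ p i j y) s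
      p-∨′ i j x y s rewrite H-p i j (x ∨ y) s | H-∨ x y (s ∘ transpose i j)
        | H-∨ (p i j x) (p i j y) s | H-p i j x s | H-p i j y s = refl
      p-∁′ : ∀ i j x s → H (p i j (∁ x)) s ≡ H (∁ (p i j x)) s
      p-∁′ i j x s rewrite H-p i j (∁ x) s | H-∁ x (s ∘ transpose i j) | H-∁ (p i j x) s | H-p i j x s = refl

-- Complex algebras of coloured simplices and their dense subalgebras

module Algebras (em : ∀ {a} → ExcludedMiddle a) (ℓ : Level) (k : ℕ) (P : Palette k) where
  open Classical em
  open Quantifier em
  open Frame em k P
  open Representation em {ℓ}

  atoms : Setoid ℓ ℓ
  atoms = record
    { Carrier       = Lift ℓ Atom
    ; _≈_           = λ a b → Lift ℓ (Same (lower a) (lower b))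
    ; isEquivalence = record
      { refl  = lift same-refl
      ; sym   = λ s → lift (same-sym (lower s))
      ; trans = λ s t → lift (same-trans (lower s) (lower t))
      }
    }

  Rel : (o : Operator {n} full) → Lift ℓ Atom → Vector (Lift ℓ Atom) (operatorArity o) → Set
  Rel (cyl i)            a as = SameOn (Off i) (lower a) (lower (as zero))
  Rel (ext (diag i j) _) a as = pos (lower a) i ≡ pos (lower a) j
  Rel (ext (repl i j) _) a as = Same (act (lower a) [ i ∣ j ]) (lower (as zero))
  Rel (ext (swap i j) _) a as = Same (act (lower a) (transpose i j)) (lower (as zero))

  Rel-resp : ∀ o {a b as bs} → Same (lower a) (lower b) → (∀ l → Same (lower (as l)) (lower (bs l))) →
             Rel o a as → Rel o b bs
  Rel-resp (cyl i) e es r = same-trans (same-sym (weaken _ e)) (same-trans r (weaken _ (es zero)))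
  Rel-resp (ext (diag i j) _) e es r = ker e tt tt r
  Rel-resp (ext (repl i j) _) e es r =
    same-trans (act-same [ i ∣ j ] (λ _ _ → tt) (same-sym e)) (same-trans r (es zero))
  Rel-resp (ext (swap i j) _) e es r =
    same-trans (act-same (transpose i j) (λ _ _ → tt) (same-sym e)) (same-trans r (es zero))

  frame : AtomStructure {n} full ℓ
  frame = record
    { setoid = atoms
    ; R      = λ o a as → Lift ℓ (Rel o a as)
    ; R-resp = λ o e es r → lift (Rel-resp o (lower e) (λ l → lower (es l)) (lower r))
    }

  𝔉 : Algebra {n} full ℓ
  𝔉 = 𝕮𝖒 em frame

  cyl-out : ∀ i (Xs : Vector (Subset atoms) 1) a → Func.to (Algebra.⟦_⟧ 𝔉 (op (cyl i)) Xs) (lift a) ≡ true →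
            ∃ λ b → SameOn (Off i) a b × Func.to (Xs zero) (lift b) ≡ true
  cyl-out i Xs a h = let (as , m , r) = ⌊⌋-elim h in lower (as zero) , lower r , m zero

  cyl-in : ∀ i (Xs : Vector (Subset atoms) 1) a b → SameOn (Off i) a b → Func.to (Xs zero) (lift b) ≡ true →
           Func.to (Algebra.⟦_⟧ 𝔉 (op (cyl i)) Xs) (lift a) ≡ true
  cyl-in i Xs a b s h = ⌊⌋-intro ((λ _ → lift b) , (λ { zero → h }) , lift s)

  repl-at : ∀ i j (Xs : Vector (Subset atoms) 1) a →
            Func.to (Algebra.⟦_⟧ 𝔉 (op (ext (repl i j) tt)) Xs) (lift a) ≡ Func.to (Xs zero) (lift (act a [ i ∣ j ]))
  repl-at i j Xs a = ≡true
    (λ h → let (as , m , r) = ⌊⌋-elim h in trans (Func.cong (Xs zero) r) (m zero))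
    (λ h → ⌊⌋-intro ((λ _ → lift (act a [ i ∣ j ])) , (λ { zero → h }) , lift same-refl))

  swap-at : ∀ i j (Xs : Vector (Subset atoms) 1) a →
            Func.to (Algebra.⟦_⟧ 𝔉 (op (ext (swap i j) tt)) Xs) (lift a) ≡ Func.to (Xs zero) (lift (act a (transpose i j)))
  swap-at i j Xs a = ≡true
    (λ h → let (as , m , r) = ⌊⌋-elim h in trans (Func.cong (Xs zero) r) (m zero))
    (λ h → ⌊⌋-intro ((λ _ → lift (act a (transpose i j))) , (λ { zero → h }) , lift same-refl))

  any : (τ : Signature n) → τ ⊆ full
  any τ _ _ = tt

  module FromModel (𝔐 : Models.Model em k P) where
    open Models em k P
    open Semantics 𝔐
    open Model 𝔐

    points : Setoid ℓ ℓ
    points = record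
      { Carrier       = Lift ℓ Pt
      ; _≈_           = λ u v → Lift ℓ (lower u ≈ᵖ lower v)
      ; isEquivalence = record
        { refl  = lift ≈-refl
        ; sym   = λ e → lift (≈-sym (lower e))
        ; trans = λ e f → lift (≈-trans (lower e) (lower f))
        }
      }

    bits : Subset atoms → Atom → Bool
    bits X a = Func.to X (lift a)

    bits-resp : ∀ X → Resp (bits X)
    bits-resp X s = Func.cong X (lift s)

    meaning : Subset atoms → Subset (Sequences {n} (λ _ → points))
    meaning X = record
      { to   = λ s → val (lower ∘ s) (bits X)
      ; cong = λ e → val-cong (bits-resp X) (lower ∘ e)
      }

    val-ext : ∀ {X Y : Atom → Bool} → (∀ a → X a ≡ Y a) → ∀ s → val s X ≡ val s Y
    val-ext {X} {Y} e s = mem-cong (joint _) _ _ (λ K → e (atom _ K))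

    meaning-homo : ∀ f Xs s → Func.to (meaning (Algebra.⟦_⟧ 𝔉 f Xs)) s ≡
                   Func.to (Algebra.⟦_⟧ (fullSetAlgebra em {τ = full} (cube points)) f (meaning ∘ Xs)) s
    meaning-homo (bool join)  Xs s = mem-∨ (joint _) _ _
    meaning-homo (bool meet)  Xs s = mem-∧ (joint _) _ _
    meaning-homo (bool compl) Xs s = prime (joint _) _
    meaning-homo (bool top)   Xs s = mem-const (joint _) true
    meaning-homo (bool bot)   Xs s = mem-const (joint _) false
    meaning-homo (op (cyl i)) Xs s = trans (val-ext same-set (lower ∘ s)) (≡true
        (λ h → let (t , h′ , e) = val-cyl (bits-resp (Xs zero)) i (lower ∘ s) h in
               ⌊⌋-intro (lift ∘ t , h′ , λ j ne → lift (e j ne)))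
        (λ h → let (t , h′ , e) = ⌊⌋-elim h in
               val-cyl⁻ (bits-resp (Xs zero)) i (λ j ne → ≈-sym (lower (e j ne))) h′))
      where
      same-set : ∀ a → bits (Algebra.⟦_⟧ 𝔉 (op (cyl i)) Xs) a ≡ cyl-set i (bits (Xs zero)) a
      same-set a = ≡true (λ h → ⌊⌋-intro (cyl-out i Xs a h))
        (λ h → let (b , r , m) = ⌊⌋-elim h in cyl-in i Xs a b r m)
    meaning-homo (op (ext (diag i j) _)) Xs s = trans (val-ext same-set (lower ∘ s)) (≡true
        (λ h → ⌊⌋-intro (lift (proj₁ (val-diag (lower ∘ s) i j) h)))
        (λ h → proj₂ (val-diag (lower ∘ s) i j) (lower (⌊⌋-elim h))))
      where
      same-set : ∀ a → bits (Algebra.⟦_⟧ 𝔉 (op (ext (diag i j) tt)) Xs) a ≡ ⌊ pos a i ≡ pos a j ⌋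
      same-set a = ⌊⌋-cong (λ { (_ , _ , r) → lower r }) (λ r → [] , (λ ()) , lift r)
    meaning-homo (op (ext (repl i j) _)) Xs s =
      trans (val-ext (repl-at i j Xs) (lower ∘ s)) (sym (val-act (bits-resp (Xs zero)) (lower ∘ s) [ i ∣ j ]))
    meaning-homo (op (ext (swap i j) _)) Xs s =
      trans (val-ext (swap-at i j Xs) (lower ∘ s)) (sym (val-act (bits-resp (Xs zero)) (lower ∘ s) (transpose i j)))

    meaning-inj : ∀ {X Y} → (∀ s → Func.to (meaning X) s ≡ Func.to (meaning Y) s) → X ≐ˢ Y
    meaning-inj {X} {Y} e (lift a) = ≡true (into X Y e) (into Y X (λ s → sym (e s)))
      where
      into : ∀ X Y → (∀ s → Func.to (meaning X) s ≡ Func.to (meaning Y) s) → bits X a ≡ true → bits Y a ≡ true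
      into X Y e Xa = stable λ ¬Ya →
        let Z = λ b → bits X b ∧ᵇ notᵇ (bits Y b)
            (s , h) = val-some {Z} (λ q → cong₂ (λ u v → u ∧ᵇ notᵇ v) (bits-resp X q) (bits-resp Y q)) a
                        (∧-intro Xa (cong notᵇ (Bool.¬-not ¬Ya)))
            h′ = trans (sym (mem-∧ (joint _) _ _)) h
            y = trans (sym (prime (joint _) _)) (∧-elim₂ {val s (bits X)} h′)
        in true≢false (trans (sym (e (lift ∘ s))) (∧-elim₁ h′)) (not-elim y)

    meaning-embedding : Embedding 𝔉 (fullSetAlgebra em {τ = full} (cube points))
    meaning-embedding = record
      { map      = meaning
      ; map-cong = λ e s → val-ext (e ∘ lift) (lower ∘ s)
      ; map-inj  = λ {X} {Y} → meaning-inj {X} {Y}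
      ; map-homo = meaning-homo
      }

  -- Any algebra lying between the singletons and the full complex algebra. All of these have the
  -- same completion, whereas their first-order theories may be controlled separately.
  record Dense : Set (lsuc ℓ) where
    field
      algebra   : Algebra {n} full ℓ
      inclusion : Embedding algebra 𝔉
    open Embedding inclusion public
    open Algebra algebra using (Carrier)
    field
      single    : Atom → Carrier
      single-at : ∀ a b → Func.to (map (single a)) (lift b) ≡ ⌊ Same a b ⌋

  singleton : Atom → Subset atoms
  singleton a = record
    { to   = λ b → ⌊ Same a (lower b) ⌋
    ; cong = λ s → ⌊⌋-cong (λ t → same-trans t (lower s)) (λ t → same-trans t (same-sym (lower s)))
    }

  full-dense : Dense
  full-dense = record
    { algebra   = 𝔉
    ; inclusion = record
        { map = id ; map-cong = id ; map-inj = id ; map-homo = λ _ _ _ → refl }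
    ; single    = singleton
    ; single-at = λ _ _ → refl
    }

  module DenseAlgebra (D : Dense) (τ : Signature n) where
    open Dense D

    A : Algebra τ ℓ
    A = reduct (any τ) algebra
    open Algebra A renaming (_≤_ to _≤ᴬ_)
    private module ≈ = Setoid setoid

    _at_ : Carrier → Atom → Bool
    x at a = Func.to (map x) (lift a)

    at-resp : ∀ x {a b} → Same a b → x at a ≡ x at b
    at-resp x s = Func.cong (map x) (lift s)

    at-∧ : ∀ x y a → (x ∧ y) at a ≡ x at a ∧ᵇ y at a
    at-∧ x y a = map-homo (bool meet) (x ∷ y ∷ []) (lift a)

    at-𝟘 : ∀ a → 𝟘 at a ≡ false
    at-𝟘 a = map-homo (bool bot) [] (lift a)

    single-self : ∀ a → single a at a ≡ true
    single-self a = trans (single-at a a) (⌊⌋-intro same-refl)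

    single-same : ∀ {a b} → single a at b ≡ true → Same a b
    single-same {a} {b} h = ⌊⌋-elim (trans (sym (single-at a b)) h)

    ≤-at : ∀ {x y a} → x ≤ᴬ y → x at a ≡ true → y at a ≡ true
    ≤-at {x} {y} {a} le h = ∧-elim₂ {x at a} (trans (sym (at-∧ x y a)) (trans (map-cong le (lift a)) h))

    at-≤ : ∀ {x y} → (∀ a → x at a ≡ true → y at a ≡ true) → x ≤ᴬ y
    at-≤ {x} {y} f = map-inj λ { (lift a) → trans (at-∧ x y a) (absorb (f a)) }
      where
      absorb : ∀ {a b} → (a ≡ true → b ≡ true) → a ∧ᵇ b ≡ a
      absorb {false} _ = refl
      absorb {true}  g = g refl

    single-≤ : ∀ {a y} → y at a ≡ true → single a ≤ᴬ y
    single-≤ {a} {y} h = at-≤ λ b q → trans (at-resp y (same-sym (single-same q))) h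

    single-cong : ∀ {a b} → Same a b → single a ≈ single b
    single-cong {a} {b} s = map-inj λ { (lift c) → trans (single-at a c) (trans
      (⌊⌋-cong (same-trans (same-sym s)) (same-trans s)) (sym (single-at b c))) }

    single-atom : ∀ a → IsAtom A (single a)
    single-atom a = (λ z → true≢false (single-self a) (trans (map-cong z (lift a)) (at-𝟘 a))) , below
      where
      below : ∀ x → x ≤ᴬ single a → (x ≈ 𝟘) ⊎ (x ≈ single a)
      below x le with x at a in xa
      ... | true  = inj₂ (map-inj λ { (lift b) → ≡true (≤-at le) (λ h → trans (at-resp x (same-sym (single-same h))) xa) })
      ... | false = inj₁ (map-inj λ { (lift b) → ≡true
              (λ h → ⊥-elim (true≢false (trans (at-resp x (single-same (≤-at le h))) h) xa))
              (λ h → ⊥-elim (true≢false h (at-𝟘 b))) })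

    nonzero : ∀ x → ¬ (x ≈ 𝟘) → ∃ λ a → x at a ≡ true
    nonzero x nz = stable λ none → nz (map-inj λ { (lift a) → ≡true
      (λ h → ⊥-elim (none (a , h))) (λ h → ⊥-elim (true≢false h (at-𝟘 a))) })

    dense-atomic : Atomic A
    dense-atomic x nz = let (a , h) = nonzero x nz in single a , single-atom a , single-≤ h

    AtA : AtomStructure τ ℓ
    AtA = At A

    point : Atom → AtomStructure.Carrier AtA
    point a = single a , single-atom a

    unpoint : AtomStructure.Carrier AtA → Atom
    unpoint (x , x≢𝟘 , _) = proj₁ (nonzero x x≢𝟘)

    -- The singleton of a frame atom inside an atom of the algebra is nonzero and below it, so
    -- minimality makes the two equal.
    unpoint-≈ : ∀ α → single (unpoint α) ≈ proj₁ α
    unpoint-≈ (x , x≢𝟘 , min) with nonzero x x≢𝟘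
    ... | a , h with min (single a) (single-≤ h)
    ...   | inj₁ z = contradiction z (proj₁ (single-atom a))
    ...   | inj₂ e = e

    unpoint-at : ∀ α b → proj₁ α at b ≡ ⌊ Same (unpoint α) b ⌋
    unpoint-at α b = trans (map-cong (≈.sym (unpoint-≈ α)) (lift b)) (single-at (unpoint α) b)

    unpoint-cong : ∀ {α β} → proj₁ α ≈ proj₁ β → Same (unpoint α) (unpoint β)
    unpoint-cong {α} {β} e = ⌊⌋-elim (trans (sym (unpoint-at α (unpoint β)))
      (trans (map-cong e (lift (unpoint β))) (trans (unpoint-at β (unpoint β)) (⌊⌋-intro same-refl))))

    unpoint-point : ∀ a → Same (unpoint (point a)) a
    unpoint-point a = ⌊⌋-elim (trans (sym (unpoint-at (point a) a)) (single-self a))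

    FA : AtomStructure {n} full ℓ
    FA = At algebra

    R-to : ∀ o {α : Carrier × Atom} (as : Vector (Atom × Carrier) (operatorArity o)) →
           (∀ b → proj₁ α at b ≡ ⌊ Same (proj₂ α) b ⌋) →
           (∀ l b → proj₂ (as l) at b ≡ ⌊ Same (proj₁ (as l)) b ⌋) →
           (proj₁ α ≤ᴬ Algebra.⟦_⟧ algebra (op o) (proj₂ ∘ as) →
             Rel o (lift (proj₂ α)) (λ l → lift (proj₁ (as l)))) ×
           (Rel o (lift (proj₂ α)) (λ l → lift (proj₁ (as l))) →
             proj₁ α ≤ᴬ Algebra.⟦_⟧ algebra (op o) (proj₂ ∘ as))
    R-to o {x , a} as at-x at-as = forth , back
      where
      forth : x ≤ᴬ Algebra.⟦_⟧ algebra (op o) (proj₂ ∘ as) → Rel o (lift a) (λ l → lift (proj₁ (as l)))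
      forth le with ⌊⌋-elim (trans (sym (map-homo (op o) (proj₂ ∘ as) (lift a)))
                     (≤-at {x} {Algebra.⟦_⟧ algebra (op o) (proj₂ ∘ as)} le (trans (at-x a) (⌊⌋-intro same-refl))))
      ... | bs , m , r = Rel-resp o same-refl
              (λ l → same-sym (⌊⌋-elim (trans (sym (at-as l (lower (bs l)))) (m l)))) (lower r)
      back : Rel o (lift a) (λ l → lift (proj₁ (as l))) → x ≤ᴬ Algebra.⟦_⟧ algebra (op o) (proj₂ ∘ as)
      back r = at-≤ λ b xb → trans (map-homo (op o) (proj₂ ∘ as) (lift b)) (⌊⌋-intro
        ((λ l → lift (proj₁ (as l))) , (λ l → trans (at-as l _) (⌊⌋-intro same-refl))
        , lift (Rel-resp o {as = λ l → lift (proj₁ (as l))} (⌊⌋-elim (trans (sym (at-x b)) xb)) (λ _ → same-refl) r)))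

    R-iff : ∀ o α (βs : Vector (AtomStructure.Carrier FA) (operatorArity o)) →
            (AtomStructure.R FA o α βs → Rel o (lift (unpoint α)) (λ l → lift (unpoint (βs l)))) ×
            (Rel o (lift (unpoint α)) (λ l → lift (unpoint (βs l))) → AtomStructure.R FA o α βs)
    R-iff o α βs = R-to o {proj₁ α , unpoint α} (λ l → unpoint (βs l) , proj₁ (βs l))
      (unpoint-at α) (λ l → unpoint-at (βs l))

    -- The atom structure of a dense subalgebra is the frame, read through `point` and `unpoint`;
    -- hence the complex algebra over it is all of `𝔉`.
    CmAt≅ : reduct (any τ) 𝔉 ≅ 𝕮𝖒 em AtA
    CmAt≅ = record
      { bijection = record
          { to        = to
          ; cong      = λ e α → e (lift (unpoint α))
          ; bijective = (λ {X} {Y} e → λ { (lift a) → trans (Func.cong X (lift (same-sym (unpoint-point a))))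
                           (trans (e (point a)) (Func.cong Y (lift (unpoint-point a)))) })
                      , λ Y → from Y , λ {Z} e α → trans (e (lift (unpoint α))) (Func.cong Y (unpoint-≈ α))
          }
      ; homo = homo
      }
      where
      to : Subset atoms → Subset (AtomStructure.setoid AtA)
      to X = record { to = λ α → Func.to X (lift (unpoint α)) ; cong = λ {α} {β} e → Func.cong X (lift
          (unpoint-cong {α} {β} e)) }
      from : Subset (AtomStructure.setoid AtA) → Subset atoms
      from Y = record { to = λ a → Func.to Y (point (lower a)) ; cong = λ s → Func.cong Y (single-cong (lower s)) }
      out : ∀ o α (Xs : Vector (Subset atoms) (operatorArity o)) →
            (∃ λ as → (∀ l → as l ∈ˢ Xs l) × AtomStructure.R frame o (lift (unpoint α)) as) →
            ∃ λ βs → (∀ l → βs l ∈ˢ to (Xs l)) × AtomStructure.R FA o α βs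
      out o α Xs (as , m , r) = point ∘ lower ∘ as
        , (λ l → trans (Func.cong (Xs l) (lift (unpoint-point (lower (as l))))) (m l))
        , proj₂ (R-iff o α (point ∘ lower ∘ as))
            (Rel-resp o same-refl (λ l → same-sym (unpoint-point (lower (as l)))) (lower r))
      back : ∀ o α (Xs : Vector (Subset atoms) (operatorArity o)) →
             (∃ λ βs → (∀ l → βs l ∈ˢ to (Xs l)) × AtomStructure.R FA o α βs) →
             ∃ λ as → (∀ l → as l ∈ˢ Xs l) × AtomStructure.R frame o (lift (unpoint α)) as
      back o α Xs (βs , m , r) = (λ l → lift (unpoint (βs l))) , m , lift (proj₁ (R-iff o α βs) r)
      homo : ∀ f Xs → to (Algebra.⟦_⟧ (reduct (any τ) 𝔉) f Xs) ≐ˢ Algebra.⟦_⟧ (𝕮𝖒 em AtA) f (to ∘ Xs)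
      homo (bool join)  Xs α = refl
      homo (bool meet)  Xs α = refl
      homo (bool compl) Xs α = refl
      homo (bool top)   Xs α = refl
      homo (bool bot)   Xs α = refl
      homo (op (cyl i)) Xs α = ⌊⌋-cong (out (cyl i) α Xs) (back (cyl i) α Xs)
      homo (op (ext x p)) Xs α = ⌊⌋-cong (out (ext x tt) α Xs) (back (ext x tt) α Xs)

    ≅⇒embedding : ∀ {B C : Algebra τ ℓ} → B ≅ C → Embedding C B
    ≅⇒embedding {B} {C} iso = record
      { map = from ; map-cong = from-cong ; map-inj = from-inj ; map-homo = from-homo }
      where
      open _≅_ iso
      module B = Setoid (Algebra.setoid B)
      module C = Setoid (Algebra.setoid C)
      open Bijection bijection using (injective; strictlySurjective) renaming (cong to to-cong)
      from : C.Carrier → B.Carrier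
      from y = proj₁ (strictlySurjective y)
      to-from : ∀ y → to (from y) C.≈ y
      to-from y = proj₂ (strictlySurjective y)
      from-cong : ∀ {x y} → x C.≈ y → from x B.≈ from y
      from-cong e = injective (C.trans (to-from _) (C.trans e (C.sym (to-from _))))
      from-inj : ∀ {x y} → from x B.≈ from y → x C.≈ y
      from-inj e = C.trans (C.sym (to-from _)) (C.trans (to-cong e) (to-from _))
      from-homo : ∀ f ys → from (Algebra.⟦_⟧ C f ys) B.≈ Algebra.⟦_⟧ B f (from ∘ ys)
      from-homo f ys = injective (C.trans (to-from _) (C.trans
        (Algebra.⟦⟧-cong C f (λ l → C.sym (to-from (ys l)))) (C.sym (homo f (from ∘ ys)))))

    module _ {κ} {K : Pred (Algebra τ ℓ) κ} (between : Between K) (𝔐 : Models.Model em k P) where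
      open Between between
      open FromModel 𝔐

      cube-embedding : Embedding (reduct (any τ) 𝔉) (fullSetAlgebra em {τ = τ} (cube points))
      cube-embedding = record
        { map = E.map ; map-cong = λ {X} {Y} → E.map-cong {X} {Y} ; map-inj = λ {X} {Y} → E.map-inj {X} {Y}
        ; map-homo = λ { (bool b) → E.map-homo (bool b) ; (op (cyl i)) → E.map-homo (op (cyl i))
                       ; (op (ext e p)) → E.map-homo (op (ext e tt)) }
        }
        where module E = Embedding meaning-embedding

      -- Both `A` and its completion are represented in the full signature, where `embedding⇒PEA`
      -- applies, and enter `K` as reducts.
      dense∈Kₛ : A ∈ (_ₛ em K)
      dense∈Kₛ = above-PEA (embedding⇒PEA algebra points (meaning-embedding ∘ᵉ inclusion))
               , dense-atomic
               , resp-≅ CmAt≅ (above-PEA (embedding⇒PEA 𝔉 points meaning-embedding))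
               , embedding⇒representable _ (cube points) (cube-embedding ∘ᵉ ≅⇒embedding CmAt≅)

-- Ultraproducts and countable hulls

module Satisfaction {ℓ : Level} {n : ℕ} {τ : Signature n} (B : Algebra τ ℓ) where
  open Algebra B using (Carrier; _≈_; ⟦_⟧; ⟦⟧-cong; setoid)
  private module ≈ = Setoid setoid

  eval-cong : ∀ {m} {ρ ρ′ : Vector Carrier m} → (∀ j → ρ j ≈ ρ′ j) → ∀ t → eval B ρ t ≈ eval B ρ′ t
  eval-cong e (var x)    = e x
  eval-cong e (fun f ts) = ⟦⟧-cong f (λ l → eval-cong e (ts l))

  ∷-cong : ∀ {m x y} {ρ ρ′ : Vector Carrier m} → x ≈ y → (∀ j → ρ j ≈ ρ′ j) → ∀ j → (x ∷ ρ) j ≈ (y ∷ ρ′) j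
  ∷-cong p e zero    = p
  ∷-cong p e (suc j) = e j

  sat-cong : ∀ {m} {ρ ρ′ : Vector Carrier m} → (∀ j → ρ j ≈ ρ′ j) → ∀ φ → Satisfies B ρ φ → Satisfies B ρ′ φ
  sat-cong e (t ≐ u) s = ≈.trans (≈.sym (eval-cong e t)) (≈.trans s (eval-cong e u))
  sat-cong e (φ ⇒ ψ) s = λ h → sat-cong e ψ (s (sat-cong (λ j → ≈.sym (e j)) φ h))
  sat-cong e (∀̇ φ)   s = λ x → sat-cong (∷-cong ≈.refl e) φ (s x)

module Ultraproduct (em : ∀ {a} → ExcludedMiddle a) {ℓ : Level} {n : ℕ} {τ : Signature n}
                    {I : Set} (𝓕 : Uf I) (A : I → Algebra τ ℓ) where
  open Classical em
  open Quantifier em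
  private
    module A i = Algebra (A i)
    module ≈ i = Setoid (A.setoid i)

  Ult : Algebra τ ℓ
  Ult = record
    { setoid = record
      { Carrier       = ∀ i → A.Carrier i
      ; _≈_           = λ x y → Lift ℓ (Most 𝓕 (λ i → A._≈_ i (x i) (y i)))
      ; isEquivalence = record
        { refl  = lift (most-all 𝓕 (λ i → ≈.refl i))
        ; sym   = λ e → lift (most-mono 𝓕 (λ i → ≈.sym i) (lower e))
        ; trans = λ e f → lift (most-mono 𝓕 (λ i p → ≈.trans i (proj₁ p) (proj₂ p)) (most-∧ 𝓕 (lower e) (lower f)))
        }
      }
    ; ⟦_⟧     = λ f xs i → A.⟦_⟧ i f (λ l → xs l i)
    ; ⟦⟧-cong = λ f es → lift (most-mono 𝓕 (λ i → A.⟦⟧-cong i f) (most-all-fin 𝓕 (λ l → lower (es l))))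
    }

  eval-at : ∀ {m} (ρ : Vector (∀ i → A.Carrier i) m) t i → A._≈_ i (eval Ult ρ t i) (eval (A i) (λ j → ρ j i) t)
  eval-at ρ (var x)    i = ≈.refl i
  eval-at ρ (fun f ts) i = A.⟦⟧-cong i f (λ l → eval-at ρ (ts l) i)

  ∷-at : ∀ {m} x (ρ : Vector (∀ i → A.Carrier i) m) i j → A._≈_ i ((x ∷ ρ) j i) ((x i ∷ (λ j → ρ j i)) j)
  ∷-at x ρ i zero    = ≈.refl i
  ∷-at x ρ i (suc j) = ≈.refl i

  łoś : ∀ {m} (φ : Formula τ m) ρ →
        (Satisfies Ult ρ φ → Most 𝓕 (λ i → Satisfies (A i) (λ j → ρ j i) φ)) ×
        (Most 𝓕 (λ i → Satisfies (A i) (λ j → ρ j i) φ) → Satisfies Ult ρ φ)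
  łoś (t ≐ u) ρ =
      (λ s → most-mono 𝓕 (λ i e → ≈.trans i (≈.sym i (eval-at ρ t i)) (≈.trans i e (eval-at ρ u i))) (lower s))
    , (λ m → lift (most-mono 𝓕 (λ i e → ≈.trans i (eval-at ρ t i) (≈.trans i e (≈.sym i (eval-at ρ u i)))) m))
  łoś ⊥̇ ρ = (λ ()) , λ m → proj₂ (most-some 𝓕 m)
  łoś (φ ⇒ ψ) ρ = forth , λ m s → proj₂ (łoś ψ ρ)
      (most-mono 𝓕 (λ i p → proj₁ p (proj₂ p)) (most-∧ 𝓕 m (proj₁ (łoś φ ρ) s)))
    where
    forth : _ → Most 𝓕 (λ i → Satisfies (A i) (λ j → ρ j i) φ → Satisfies (A i) (λ j → ρ j i) ψ)
    forth s with em {P = Most 𝓕 (λ i → Satisfies (A i) (λ j → ρ j i) φ)}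
    ... | yes m = most-mono 𝓕 (λ i q _ → q) (proj₁ (łoś ψ ρ) (s (proj₂ (łoś φ ρ) m)))
    ... | no ¬m = most-mono 𝓕 (λ i np p → contradiction p np) (most-¬ 𝓕 ¬m)
  łoś (∀̇ φ) ρ = forth , λ m x → proj₂ (łoś φ (x ∷ ρ)) (most-mono 𝓕
      (λ i s → Satisfaction.sat-cong (A i) (λ j → ≈.sym i (∷-at x ρ i j)) φ (s (x i))) m)
    where
    forth : (∀ x → Satisfies Ult (x ∷ ρ) φ) → Most 𝓕 (λ i → ∀ x → Satisfies (A i) (x ∷ (λ j → ρ j i)) φ)
    forth s = stable λ ¬m → ¬most-¬ 𝓕 (most-mono 𝓕 refute (most-¬ 𝓕 ¬m)) (proj₁ (łoś φ (bad ∷ ρ)) (s bad))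
      where
      -- Excluded middle for the Σ-type returns the counterexample itself, which covers the usual
      -- appeal to choice; `𝟘` fills the factors that have none.
      counter : ∀ i → Dec (∃ λ x → ¬ Satisfies (A i) (x ∷ (λ j → ρ j i)) φ) → A.Carrier i
      counter i (yes (x , _)) = x
      counter i (no _)        = A.𝟘 i
      bad : ∀ i → A.Carrier i
      bad i = counter i em
      refute : ∀ i → ¬ (∀ x → Satisfies (A i) (x ∷ (λ j → ρ j i)) φ) → ¬ Satisfies (A i) (λ j → (bad ∷ ρ) j i) φ
      refute i ¬all q = go em (Satisfaction.sat-cong (A i) (∷-at bad ρ i) φ q)
        where
        go : (d : Dec (∃ λ x → ¬ Satisfies (A i) (x ∷ (λ j → ρ j i)) φ)) →
             ¬ Satisfies (A i) (counter i d ∷ (λ j → ρ j i)) φ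
        go (yes (x , np)) = np
        go (no none) _    = ¬all λ x → stable λ np → none (x , np)

  ult-⊨ : ∀ {Γ : Pred (Sentence τ) 0ℓ} → (∀ i → A i ⊨ Γ) → Ult ⊨ Γ
  ult-⊨ m φ φ∈Γ = proj₂ (łoś φ []) (most-all 𝓕 (λ i → Satisfaction.sat-cong (A i) (λ ()) φ (m i φ φ∈Γ)))

-- Codes of symbols and formulas, and Skolem hulls

data Tree : Set where
  leaf : ℕ → Tree
  node : Tree → Tree → Tree

tree-code : Tree → ℕ
tree-code (leaf j)   = pair 0 j
tree-code (node t u) = pair 1 (pair (tree-code t) (tree-code u))

tree-code-inj : ∀ {t u} → tree-code t ≡ tree-code u → t ≡ u
tree-code-inj {leaf i} {leaf j} e = cong leaf (proj₂ (pair-inj e))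
tree-code-inj {leaf i} {node u v} e with pair-inj {0} {i} {1} e
... | ()
tree-code-inj {node t u} {leaf j} e with pair-inj {1} {_} {0} {j} e
... | ()
tree-code-inj {node t u} {node v w} e =
  let (p , q) = pair-inj (proj₂ (pair-inj {1} {_} {1} e)) in cong₂ node (tree-code-inj p) (tree-code-inj q)

extra-code : ∀ {n} → Extra n → ℕ
extra-code (diag i j) = pair 0 (pair (toℕ i) (toℕ j))
extra-code (repl i j) = pair 1 (pair (toℕ i) (toℕ j))
extra-code (swap i j) = pair 2 (pair (toℕ i) (toℕ j))

extra-code-inj : ∀ {n} {e e′ : Extra n} → extra-code e ≡ extra-code e′ → e ≡ e′
extra-code-inj {e = diag i j} {diag i′ j′} q = let (_ , r) = pair-inj {0} {_} {0} q ; (a , b) = pair-inj r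
                                               in cong₂ diag (Fin.toℕ-injective a) (Fin.toℕ-injective b)
extra-code-inj {e = repl i j} {repl i′ j′} q = let (_ , r) = pair-inj {1} {_} {1} q ; (a , b) = pair-inj r
                                               in cong₂ repl (Fin.toℕ-injective a) (Fin.toℕ-injective b)
extra-code-inj {e = swap i j} {swap i′ j′} q = let (_ , r) = pair-inj {2} {_} {2} q ; (a , b) = pair-inj r
                                               in cong₂ swap (Fin.toℕ-injective a) (Fin.toℕ-injective b)
extra-code-inj {e = diag i j} {repl i′ j′} q with () ← proj₁ (pair-inj {0} {_} {1} q)
extra-code-inj {e = diag i j} {swap i′ j′} q with () ← proj₁ (pair-inj {0} {_} {2} q)
extra-code-inj {e = repl i j} {diag i′ j′} q with () ← proj₁ (pair-inj {1} {_} {0} q)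
extra-code-inj {e = repl i j} {swap i′ j′} q with () ← proj₁ (pair-inj {1} {_} {2} q)
extra-code-inj {e = swap i j} {diag i′ j′} q with () ← proj₁ (pair-inj {2} {_} {0} q)
extra-code-inj {e = swap i j} {repl i′ j′} q with () ← proj₁ (pair-inj {2} {_} {1} q)

boolean-code : BooleanSymbol → ℕ
boolean-code join  = 0
boolean-code meet  = 1
boolean-code compl = 2
boolean-code top   = 3
boolean-code bot   = 4

symbol-code : ∀ {n} {τ : Signature n} → Symbol τ → ℕ
symbol-code (bool b)         = pair 0 (boolean-code b)
symbol-code (op (cyl i))     = pair 1 (toℕ i)
symbol-code (op (ext e _))   = pair 2 (extra-code e)

symbol-code-inj : ∀ {n} {τ : Signature n} {f g : Symbol τ} → symbol-code f ≡ symbol-code g → f ≡ g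
symbol-code-inj {f = bool b} {bool b′} q = cong bool (go b b′ (proj₂ (pair-inj {0} {_} {0} q)))
  where
  go : ∀ b b′ → boolean-code b ≡ boolean-code b′ → b ≡ b′
  go join join _ = refl
  go meet meet _ = refl
  go compl compl _ = refl
  go top top _ = refl
  go bot bot _ = refl
symbol-code-inj {f = op (cyl i)} {op (cyl j)} q =
  cong (op ∘ cyl) (Fin.toℕ-injective (proj₂ (pair-inj {1} {_} {1} q)))
symbol-code-inj {τ = τ} {f = op (ext e p)} {op (ext e′ p′)} q with extra-code-inj {e = e} {e′} (proj₂
    (pair-inj {2} {_} {2} q))
... | refl = cong (λ r → op (ext e r)) (Bool.T-irrelevant p p′)
symbol-code-inj {f = bool b} {op (cyl i)} q with () ← proj₁ (pair-inj {0} {_} {1} q)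
symbol-code-inj {f = bool b} {op (ext e p)} q with () ← proj₁ (pair-inj {0} {_} {2} q)
symbol-code-inj {f = op (cyl i)} {bool b} q with () ← proj₁ (pair-inj {1} {_} {0} q)
symbol-code-inj {f = op (cyl i)} {op (ext e p)} q with () ← proj₁ (pair-inj {1} {_} {2} q)
symbol-code-inj {f = op (ext e p)} {bool b} q with () ← proj₁ (pair-inj {2} {_} {0} q)
symbol-code-inj {f = op (ext e p)} {op (cyl i)} q with () ← proj₁ (pair-inj {2} {_} {1} q)

-- Elements of the hull are named by trees, hence by numbers, so that classes of
-- them have canonical representatives without any appeal to choice.
module Hull (em : ∀ {a} → ExcludedMiddle a) {ℓ : Level} {n : ℕ} {τ : Signature n} (B : Algebra τ ℓ)
            (seed : ℕ → Algebra.Carrier B) (pick : Algebra.Carrier B → Algebra.Carrier B) where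
  open Classical em
  open Algebra B using (Carrier; _≈_; ⟦_⟧; ⟦⟧-cong; setoid)
  open Satisfaction B
  private module ≈ = Setoid setoid

  size : Tree → ℕ
  size (leaf j)   = j
  size (node _ _) = 0

  symbol : ℕ → Symbol τ
  symbol j with em {P = ∃ λ (f : Symbol τ) → symbol-code f ≡ j}
  ... | yes (f , _) = f
  ... | no _        = bool top

  symbol-code⁻ : ∀ f → symbol (symbol-code f) ≡ f
  symbol-code⁻ f with em {P = ∃ λ (g : Symbol τ) → symbol-code g ≡ symbol-code f}
  ... | yes (g , e) = symbol-code-inj e
  ... | no none     = contradiction (f , refl) none

  variable′ : ∀ m → ℕ → Term τ m
  variable′ zero    _       = fun (bool top) []
  variable′ (suc m) zero    = var zero
  variable′ (suc m) (suc j) with variable′ m j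
  ... | var i    = var (suc i)
  ... | fun _ _  = fun (bool top) []

  variable-onto : ∀ {m} (i : Fin m) → variable′ m (toℕ i) ≡ var i
  variable-onto zero = refl
  variable-onto {suc m} (suc i) with variable′ m (toℕ i) | variable-onto i
  ... | var .i | refl = refl

  -- Decoding is total: malformed trees become the constant for the top element or, among formulas,
  -- `⊥̇`. It is onto up to value and up to satisfaction, since argument functions are compared only
  -- pointwise.
  term : ∀ m → Tree → Term τ m
  args : ∀ m → Tree → ℕ → Term τ m
  term m (leaf j)          = variable′ m j
  term m (node t u)        = fun (symbol (size t)) (λ l → args m u (toℕ l))
  args m (leaf _)   _       = fun (bool top) []
  args m (node t u) zero    = term m t
  args m (node t u) (suc j) = args m u j

  formula : ∀ m → Tree → Formula τ m
  formula m (node (leaf 0) (node t u)) = term m t ≐ term m u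
  formula m (node (leaf 1) (node t u)) = formula m t ⇒ formula m u
  formula m (node (leaf 2) t)          = ∀̇ formula (suc m) t
  formula m _                          = ⊥̇

  listing : ∀ {r} → (Fin r → Tree) → Tree
  listing {zero}  ts = leaf 0
  listing {suc r} ts = node (ts zero) (listing (ts ∘ suc))

  args-listing : ∀ m {r} (ts : Fin r → Tree) l → args m (listing ts) (toℕ l) ≡ term m (ts l)
  args-listing m ts zero    = refl
  args-listing m ts (suc l) = args-listing m (ts ∘ suc) l

  term-onto : ∀ {m} (t : Term τ m) → ∃ λ u → ∀ ρ → eval B ρ t ≈ eval B ρ (term m u)
  term-onto {m} (var i) = leaf (toℕ i) , λ ρ → ≈.reflexive (cong (eval B ρ) (sym (variable-onto i)))
  term-onto {m} (fun f ts) = node (leaf (symbol-code f)) (listing us) , go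
    where
    us = λ l → proj₁ (term-onto (ts l))
    fun-cong : ∀ {f g} → g ≡ f → (ts′ : ℕ → Term τ m) → ∀ ρ →
               eval B ρ (fun f (λ l → ts′ (toℕ l))) ≈ eval B ρ (fun g (λ l → ts′ (toℕ l)))
    fun-cong refl ts′ ρ = ≈.refl
    go : ∀ ρ → eval B ρ (fun f ts) ≈ eval B ρ (term m (node (leaf (symbol-code f)) (listing us)))
    go ρ = ≈.trans (⟦⟧-cong f (λ l → ≈.trans (proj₂ (term-onto (ts l)) ρ)
               (≈.reflexive (cong (eval B ρ) (sym (args-listing m us l))))))
             (fun-cong (symbol-code⁻ f) (args m (listing us)) ρ)

  formula-onto : ∀ {m} (φ : Formula τ m) → ∃ λ u → ∀ ρ →
                 (Satisfies B ρ φ → Satisfies B ρ (formula m u)) × (Satisfies B ρ (formula m u) → Satisfies B ρ φ)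
  formula-onto (t ≐ u) = let (t′ , e) = term-onto t ; (u′ , e′) = term-onto u in node (leaf 0) (node t′ u′) , λ ρ →
      (λ s → ≈.trans (≈.sym (e ρ)) (≈.trans s (e′ ρ)))
    , (λ s → ≈.trans (e ρ) (≈.trans s (≈.sym (e′ ρ))))
  formula-onto ⊥̇ = leaf 0 , λ ρ → (λ s → s) , (λ s → s)
  formula-onto (φ ⇒ ψ) = let (t , e) = formula-onto φ ; (u , e′) = formula-onto ψ in node (leaf 1) (node t u) , λ ρ →
      (λ s h → proj₁ (e′ ρ) (s (proj₂ (e ρ) h)))
    , (λ s h → proj₂ (e′ ρ) (s (proj₁ (e ρ) h)))
  formula-onto (∀̇ φ) = let (t , e) = formula-onto φ in node (leaf 2) t , λ ρ →
      (λ s x → proj₁ (e (x ∷ ρ)) (s x))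
    , (λ s x → proj₂ (e (x ∷ ρ)) (s x))

  witness : ∀ {m} → Formula τ (suc m) → Vector Carrier m → Carrier
  witness φ ρ with em {P = ∃ λ b → ¬ Satisfies B (b ∷ ρ) φ}
  ... | yes (b , _) = b
  ... | no _        = seed 0

  witness-fails : ∀ {m} (φ : Formula τ (suc m)) ρ b → ¬ Satisfies B (b ∷ ρ) φ → ¬ Satisfies B (witness φ ρ ∷ ρ) φ
  witness-fails φ ρ b nb with em {P = ∃ λ b → ¬ Satisfies B (b ∷ ρ) φ}
  ... | yes (_ , np) = np
  ... | no none      = contradiction (b , nb) none

  -- The left subtree selects the kind of name: a leaf asks for `pick`, a node for the Skolem
  -- witness of the formula coded by `t`, with `size a` the number of its parameters.
  val : Tree → Carrier
  env : Tree → ℕ → Carrier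
  val (leaf j)              = seed j
  val (node (leaf _) u)     = pick (val u)
  val (node (node a t) u)   = witness (formula (suc (size a)) t) (λ j → env u (toℕ j))
  env (leaf _)   _       = seed 0
  env (node t u) zero    = val t
  env (node t u) (suc j) = env u j

  env-listing : ∀ {r} (ts : Fin r → Tree) l → env (listing ts) (toℕ l) ≡ val (ts l)
  env-listing ts zero    = refl
  env-listing ts (suc l) = env-listing (ts ∘ suc) l

  Named : Carrier → Set ℓ
  Named b = ∃ λ t → val t ≈ b

  -- The Tarski-Vaught criterion. The parameters are replaced by the values of their names, so that
  -- the Skolem witness is named as well.
  counterexample : ∀ {m} (φ : Formula τ (suc m)) (ρ : Vector Carrier m) → (∀ j → Named (ρ j)) →
                   ∀ b → ¬ Satisfies B (b ∷ ρ) φ → ∃ λ w → Named w × ¬ Satisfies B (w ∷ ρ) φ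
  counterexample {m} φ ρ named b nb with formula-onto φ
  ... | t , e = val tree , (tree , ≈.refl) , λ s →
          witness-fails (formula (suc m) t) ρ′ b
            (λ h → nb (sat-cong (∷-cong ≈.refl ρ′≈) φ (proj₂ (e (b ∷ ρ′)) h)))
            (proj₁ (e _) (sat-cong (∷-cong ≈.refl (λ j → ≈.sym (ρ′≈ j))) φ s))
    where
    list = listing (proj₁ ∘ named)
    tree = node (node (leaf m) t) list
    ρ′ : Vector Carrier m
    ρ′ j = env list (toℕ j)
    ρ′≈ : ∀ j → ρ′ j ≈ ρ j
    ρ′≈ j = ≈.trans (≈.reflexive (env-listing (proj₁ ∘ named) j)) (proj₂ (named j))

  hull : Subuniverse B
  hull = record
    { Member   = Named
    ; respects = λ { e (t , q) → t , ≈.trans q e }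
    ; closed   = closed
    }
    where
    closed : ∀ f xs → (∀ l → Named (xs l)) → Named (⟦ f ⟧ xs)
    -- Closure under `f` is an instance of witnessing: the formula denies that its first variable is
    -- the value of `f`, and the value refutes it.
    closed f xs named with counterexample ((var zero ≐ fun f (λ l → var (suc l))) ⇒ ⊥̇) xs named (⟦ f ⟧ xs)
                             (λ h → contradiction (h ≈.refl) λ ())
    ... | w , (t , q) , nw = t , ≈.trans q (stable λ ne → nw (λ e → contradiction e ne))

  A : Algebra τ ℓ
  A = subalgebra B hull

  eval-hull : ∀ {m} (ρ : Vector (Algebra.Carrier A) m) t → proj₁ (eval A ρ t) ≈ eval B (proj₁ ∘ ρ) t
  eval-hull ρ (var x)    = ≈.refl
  eval-hull ρ (fun f ts) = ⟦⟧-cong f (λ l → eval-hull ρ (ts l))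

  ∷-hull : ∀ {m} x (ρ : Vector (Algebra.Carrier A) m) j → proj₁ ((x ∷ ρ) j) ≈ (proj₁ x ∷ (proj₁ ∘ ρ)) j
  ∷-hull x ρ zero    = ≈.refl
  ∷-hull x ρ (suc j) = ≈.refl

  elementary : ∀ {m} (φ : Formula τ m) ρ → (Satisfies A ρ φ → Satisfies B (proj₁ ∘ ρ) φ) ×
                                          (Satisfies B (proj₁ ∘ ρ) φ → Satisfies A ρ φ)
  elementary (t ≐ u) ρ = (λ s → ≈.trans (≈.sym (eval-hull ρ t)) (≈.trans s (eval-hull ρ u)))
                       , (λ s → ≈.trans (eval-hull ρ t) (≈.trans s (≈.sym (eval-hull ρ u))))
  elementary ⊥̇ ρ = (λ s → s) , (λ s → s)
  elementary (φ ⇒ ψ) ρ = (λ s h → proj₁ (elementary ψ ρ) (s (proj₂ (elementary φ ρ) h)))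
                       , (λ s h → proj₂ (elementary ψ ρ) (s (proj₁ (elementary φ ρ) h)))
  elementary (∀̇ φ) ρ = forth , λ s x → proj₂ (elementary φ (x ∷ ρ))
                                  (sat-cong (λ j → ≈.sym (∷-hull x ρ j)) φ (s (proj₁ x)))
    where
    forth : (∀ x → Satisfies A (x ∷ ρ) φ) → ∀ b → Satisfies B (b ∷ (proj₁ ∘ ρ)) φ
    forth s b = stable λ nb → let (w , named , nw) = counterexample φ (proj₁ ∘ ρ) (proj₂ ∘ ρ) b nb in
      nw (sat-cong (∷-hull (w , named) ρ) φ (proj₁ (elementary φ ((w , named) ∷ ρ)) (s (w , named))))

  hull-⊨ : ∀ {Γ : Pred (Sentence τ) 0ℓ} → B ⊨ Γ → A ⊨ Γ
  hull-⊨ m φ φ∈Γ = proj₂ (elementary φ []) (sat-cong (λ ()) φ (m φ φ∈Γ))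

  seed-named : ∀ j → Named (seed j)
  seed-named j = leaf j , ≈.refl

  pick-named : (∀ {x y} → x ≈ y → pick x ≈ pick y) → ∀ {b} → Named b → Named (pick b)
  pick-named pick-cong (t , q) = node (leaf 0) t , pick-cong q

-- Obstructions to representability

module Obstructions (em : ∀ {a} → ExcludedMiddle a) (k : ℕ) where
  open Classical em
  open Quantifier em

  -- The common features of membership in a nonprincipal ultrafilter and of uncountability on which
  -- the Ramsey argument rests.
  record Largeness (V L : Set) : Set₁ where
    field
      Large       : (V → Set) → Set
      large-all   : Large (λ _ → ⊤)
      large-some  : ∀ {W} → Large W → ∃ W
      large-minus : ∀ {W} → Large W → ∀ u → Large (λ v → W v × v ≢ u)
      large-split : ∀ {W} → Large W → (β : V → L) → ∃ λ c → Large (λ v → W v × β v ≡ c)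

  module _ {V M : Set} {r : ℕ} (lg : Largeness V (M × Fin r)) (β : V → V → M × Fin r)
           (rule : ∀ {u v w m m′ i} → u ≢ v → u ≢ w → v ≢ w →
                   β u v ≡ (m , i) → β u w ≡ (m , i) → β v w ≡ (m′ , i) → ⊥) where
    open Largeness lg

    -- If the i-fibre of β u is large, then i is not used inside it; so the set
    -- of usable indices shrinks until it is empty.
    shrink : ∀ b (js : List (Fin r)) → L.length js ≤ b → ∀ {W} → Large W →
             (∀ {u v} → W u → W v → u ≢ v → proj₂ (β u v) ∈ˡ js) → ⊥
    shrink b js len {W} large allowed with large-some large
    ... | u , Wu with large-split (large-minus large u) (β u)
    ...   | (m , i) , large′ with large-some large′
    ...     | v , (Wv , v≢u) , e = descend b len
      where
      Fibre : V → Set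
      Fibre w = (W w × w ≢ u) × β u w ≡ (m , i)
      i∈js : i ∈ˡ js
      i∈js = subst (λ c → proj₂ c ∈ˡ js) e (allowed Wu Wv (v≢u ∘ sym))
      js′ : List (Fin r)
      js′ = L.filter (λ j → ¬? (j Fin.≟ i)) js
      shorter : L.length js′ < L.length js
      shorter = filter-notAll (λ j → ¬? (j Fin.≟ i)) js (Any.map (λ p q → q (sym p)) i∈js)
      allowed′ : ∀ {x y} → Fibre x → Fibre y → x ≢ y → proj₂ (β x y) ∈ˡ js′
      allowed′ {x} {y} ((Wx , x≢u) , ex) ((Wy , y≢u) , ey) x≢y =
        ∈-filter⁺ (λ j → ¬? (j Fin.≟ i)) (allowed Wx Wy x≢y)
          λ q → rule (x≢u ∘ sym) (y≢u ∘ sym) x≢y ex ey (cong (proj₁ (β x y) ,_) q)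
      descend : ∀ b → L.length js ≤ b → ⊥
      descend zero    le = ℕ.n≮0 (ℕ.<-≤-trans shorter le)
      descend (suc b) le = shrink b js′ (ℕ.≤-pred (ℕ.<-≤-trans shorter le)) large′ allowed′

    ramsey : ⊥
    ramsey = shrink _ (L.allFin r) ℕ.≤-refl large-all (λ _ _ _ → ∈-allFin _)

  module _ {ℓ : Level} {τ : Signature (3 + k)} (F : AtomStructure τ ℓ) where
    open AtomStructure F
    private module ≈ = Setoid setoid

    n : ℕ
    n = 3 + k

    Step : Fin n → Carrier → Carrier → Set ℓ
    Step i α β = R (cyl i) α (λ _ → β)

    -- `E i j` stands in for a diagonal. `Apex i x` and `Class i l` concern the face spanned by the
    -- entries other than `i`: it is marked by `x`, or its colour has the class `l`. The closure
    -- properties make these sets behave so in any representation, even where cylindrifiers are the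
    -- only operators.
    record Obstruction : Set (lsuc ℓ) where
      field
        V M       : Set
        r         : ℕ
        default   : M × Fin r
        large     : Largeness V (M × Fin r)
        principal : (J : Uf (M × Fin r)) → ∃ λ l → Most J (_≡ l)
        E         : Fin n → Fin n → Carrier → Set
        Apex      : Fin n → V → Carrier → Set
        Class     : Fin n → M × Fin r → Carrier → Set
        E-resp     : ∀ {i j α β} → α ≈ β → E i j α → E i j β
        Apex-resp  : ∀ {i x α β} → α ≈ β → Apex i x α → Apex i x β
        Class-resp : ∀ {i l α β} → α ≈ β → Class i l α → Class i l β
        E-step     : ∀ {i j l α β} → i ≢ l → j ≢ l → Step l α β → (E i j α → E i j β) × (E i j β → E i j α)
        Apex-step  : ∀ {i x α β} → Step i α β → Apex i x β → Apex i x α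
        Class-step : ∀ {i l α β} → Step i α β → Class i l β → Class i l α
        E-sym      : ∀ {i j α} → E i j α → E j i α
        E-trans    : ∀ {i j l α} → E i j α → E j l α → E i l α
        Apex-E     : ∀ {i j x α} → i ≢ j → E i j α → Apex i x α → Apex j x α
        Class-E    : ∀ {i j l α} → i ≢ j → E i j α → Class i l α → Class j l α
        Class-func : ∀ {i l l′ α} → Class i l α → Class i l′ α → l ≡ l′

      Generic : Carrier → Set
      Generic α = ∀ i j → i ≢ j → ¬ E i j α

      field
        some-generic : ∃ Generic
        identify     : ∀ i j → i ≢ j → ∀ α → ∃ λ β → Step i α β × E i j β
        attach       : ∀ x α → Generic α → ∃ λ β → Step zero α β × Generic β × Apex (suc zero) x β
        Apex-inj     : ∀ {i x y α} → Apex i x α → Apex i y α → x ≡ y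
        classify     : ∀ {x y α} → x ≢ y → Generic α → Apex (suc zero) x α → Apex zero y α →
                       ∃ λ l → Class (suc (suc zero)) l α
        clash        : ∀ {m m′ i α} → Generic α → Class (suc (suc zero)) (m , i) α →
                       Class (suc zero) (m , i) α → Class zero (m′ , i) α → ⊥

    module _ (O : Obstruction) (rep : Representable em (𝕮𝖒 em F)) where
      open Obstruction O
      open Representable rep
      private
        0F 1F 2F : Fin n
        0F = zero
        1F = suc zero
        2F = suc (suc zero)

        Resp : ∀ {p} → (Carrier → Set p) → Set (ℓ ⊔ p)
        Resp X = ∀ {α β} → α ≈ β → X α → X β

        ⟪_⟫ : ∀ {p} {X : Carrier → Set p} → Resp X → Subset setoid
        ⟪_⟫ {X = X} resp = record
          { to = λ α → ⌊ X α ⌋ ; cong = λ e → ⌊⌋-cong (resp e) (resp (≈.sym e)) }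

        module CM = Algebra (𝕮𝖒 em F)
        open _≅_ iso using (to; bijection; homo)
        open Bijection bijection using (injective) renaming (cong to to-cong)

        generic-resp : Resp Generic
        generic-resp e g i j ne q = g i j ne (E-resp (≈.sym e) q)

      base-at : Index → Base τ ℓ
      base-at ι = SetAlgebra.base (setAlgebras ι)

      Tup : Index → Set ℓ
      Tup ι = ∀ i → Setoid.Carrier (factors (base-at ι) i)

      h : ∀ ι → Subset setoid → Tup ι → Bool
      h ι X = Func.to (proj₁ (proj₁ (to X) ι))

      start : ∃ λ ι → ∃ λ (s : Tup ι) → h ι ⟪ generic-resp ⟫ s ≡ true
      start = stable λ none → absurd (injective {⟪ generic-resp ⟫} {CM.𝟘}
          (λ ι s → ≡true (λ q → ⊥-elim (none (ι , s , q))) (λ q → ⊥-elim (true≢false q (homo (bool bot) [] ι s)))))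
        where
        absurd : ¬ (⟪ generic-resp ⟫ CM.≈ CM.𝟘)
        absurd e = true≢false (⌊⌋-intro (proj₂ some-generic)) (e (proj₁ some-generic))

      module _ (ι : Index) (s⁰ : Tup ι) (h⁰ : h ι ⟪ generic-resp ⟫ s⁰ ≡ true) where
        private module U i = Setoid (factors (base-at ι) i)

        record Holds {p} {X : Carrier → Set p} (s : Tup ι) (rX : Resp X) : Set where
          constructor holds
          field truth : h ι ⟪ rX ⟫ s ≡ true
        open Holds

        module _ {p q} {X : Carrier → Set p} {Y : Carrier → Set q} {rX : Resp X} {rY : Resp Y} where

          ×-resp : Resp (λ α → X α × Y α)
          ×-resp e q = rX e (proj₁ q) , rY e (proj₂ q)

          holds-∧ : ∀ {s} → Holds s rX → Holds s rY → Holds s ×-resp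
          holds-∧ {s} hx hy = holds (trans (to-cong {⟪ ×-resp ⟫} {⟪ rX ⟫ CM.∧ ⟪ rY ⟫} pointwise ι s)
              (trans (homo (bool meet) (⟪ rX ⟫ ∷ ⟪ rY ⟫ ∷ []) ι s) (∧-intro (truth hx) (truth hy))))
            where
            pointwise : ∀ α → ⌊ X α × Y α ⌋ ≡ ⌊ X α ⌋ ∧ᵇ ⌊ Y α ⌋
            pointwise α = ≡true (λ e → ∧-intro (⌊⌋-intro (proj₁ (⌊⌋-elim e))) (⌊⌋-intro (proj₂ (⌊⌋-elim e))))
              (λ e → ⌊⌋-intro (⌊⌋-elim (∧-elim₁ e) , ⌊⌋-elim (∧-elim₂ {⌊ X α ⌋} e)))

          holds-mono : (∀ α → X α → Y α) → ∀ {s} → Holds s rX → Holds s rY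
          holds-mono f {s} hx = holds (∧-elim₂ {h ι ⟪ rX ⟫ s} (trans (sym (homo (bool meet) (⟪ rX ⟫ ∷ ⟪ rY ⟫ ∷ []) ι s))
              (trans (to-cong {⟪ rX ⟫ CM.∧ ⟪ rY ⟫} {⟪ rX ⟫} pointwise ι s) (truth hx))))
            where
            pointwise : ∀ α → ⌊ X α ⌋ ∧ᵇ ⌊ Y α ⌋ ≡ ⌊ X α ⌋
            pointwise α = ≡true ∧-elim₁ (λ e → ∧-intro e (⌊⌋-intro (f α (⌊⌋-elim e))))

        ¬-resp : ∀ {p} {X : Carrier → Set p} → Resp X → Resp (λ α → ¬ X α)
        ¬-resp r e nx x = nx (r (≈.sym e) x)

        holds-not : ∀ {p} {X : Carrier → Set p} (rX : Resp X) s → h ι ⟪ ¬-resp rX ⟫ s ≡ notᵇ (h ι ⟪ rX ⟫ s)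
        holds-not {X = X} rX s = trans (to-cong {⟪ ¬-resp rX ⟫} {CM.∁ ⟪ rX ⟫} pointwise ι s)
            (homo (bool compl) (⟪ rX ⟫ ∷ []) ι s)
          where
          pointwise : ∀ α → ⌊ (¬ X α) ⌋ ≡ notᵇ ⌊ X α ⌋
          pointwise α = ≡true (λ e → cong notᵇ (Bool.¬-not λ t → ⌊⌋-elim e (⌊⌋-elim t)))
            (λ e → ⌊⌋-intro λ x → true≢false (⌊⌋-intro x) (not-elim e))

        holds-some : ∀ {p} {X : Carrier → Set p} {rX : Resp X} {s} → Holds s rX → ∃ X
        holds-some {X = X} {rX} {s} hx = stable λ none → true≢false (truth hx)
          (trans (to-cong {⟪ rX ⟫} {CM.𝟘} (λ α → ≡true (λ e → ⊥-elim (none (α , ⌊⌋-elim e))) λ ()) ι s)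
            (homo (bool bot) [] ι s))

        Cyl : ∀ {p} → Fin n → (Carrier → Set p) → Carrier → Set (ℓ ⊔ p)
        Cyl i X α = ∃ λ β → Step i α β × X β

        cyl-resp : ∀ {p} i (X : Carrier → Set p) → Resp (Cyl i X)
        cyl-resp i X e (β , st , x) = β , R-resp (cyl i) e (λ _ → ≈.refl) st , x

        cyl-set≡ : ∀ {p} i {X : Carrier → Set p} (rX : Resp X) s →
                   h ι ⟪ cyl-resp i X ⟫ s ≡ ⌊ (∃ λ (t : Tup ι) → h ι ⟪ rX ⟫ t ≡ true × (∀ j → j ≢ i → U._≈_ j (t j)
                       (s j))) ⌋
        cyl-set≡ i {X} rX s = trans (to-cong {⟪ cyl-resp i X ⟫} {CM.c i ⟪ rX ⟫} pointwise ι s)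
            (homo (op (cyl i)) (⟪ rX ⟫ ∷ []) ι s)
          where
          pointwise : ∀ α → ⌊ Cyl i X α ⌋ ≡ Func.to (CM.c i ⟪ rX ⟫) α
          pointwise α = ⌊⌋-cong
            (λ { (β , st , x) → (λ _ → β) , (λ { zero → ⌊⌋-intro x }) , st })
            (λ { (βs , m , st) → βs zero , R-resp (cyl i) ≈.refl (λ { zero → ≈.refl }) st , ⌊⌋-elim (m zero) })

        holds-cyl : ∀ {p} i {X : Carrier → Set p} {rX : Resp X} {s} → Holds s (cyl-resp i X) →
                    ∃ λ t → Holds t rX × (∀ j → j ≢ i → U._≈_ j (t j) (s j))
        holds-cyl i {rX = rX} {s} hs = let (t , ht , e) = ⌊⌋-elim (trans (sym (cyl-set≡ i rX s)) (truth hs)) in t , holds ht , e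

        -- If `X` contains its own cylindrification along `i`, its truth cannot depend on the
        -- coordinate `i`.
        holds-move : ∀ {p} i {X : Carrier → Set p} {rX : Resp X} → (∀ {α β} → Step i α β → X β → X α) →
                     ∀ {s t} → (∀ j → j ≢ i → U._≈_ j (t j) (s j)) → Holds t rX → Holds s rX
        holds-move i {X} {rX} closed {s} {t} e ht = holds-mono {rX = cyl-resp i X} {rY = rX}
          (λ { α (β , st , x) → closed st x }) (holds (trans (cyl-set≡ i rX s) (⌊⌋-intro (t , truth ht , e))))

        -- Only three coordinates ever move; the other `k` stay those of the generic tuple `s⁰`.
        mk : U.Carrier 0F → U.Carrier 1F → U.Carrier 2F → Tup ι
        mk u v w zero                = u
        mk u v w (suc zero)          = v
        mk u v w (suc (suc zero))    = w
        mk u v w (suc (suc (suc l))) = s⁰ (suc (suc (suc l)))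

        E-r : ∀ i j → Resp (E i j)
        E-r i j = E-resp
        N-r : ∀ i j → Resp (λ α → ¬ E i j α)
        N-r i j = ¬-resp (E-r i j)
        A-r : ∀ i x → Resp (Apex i x)
        A-r i x = Apex-resp
        C-r : ∀ i l → Resp (Class i l)
        C-r i l = Class-resp

        module _ {p} {X : Carrier → Set p} {rX : Resp X} where

          move₀ : (∀ {α β} → Step 0F α β → X β → X α) → ∀ {u u′ v w} → Holds (mk u v w) rX → Holds (mk u′ v w) rX
          move₀ closed = holds-move 0F closed
            λ { zero ne → contradiction refl ne ; (suc zero) _ → U.refl _ ; (suc (suc zero)) _ → U.refl _ ; (suc
                (suc (suc l))) _ → U.refl _ }

          move₁ : (∀ {α β} → Step 1F α β → X β → X α) → ∀ {u v v′ w} → Holds (mk u v w) rX → Holds (mk u v′ w) rX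
          move₁ closed = holds-move 1F closed
            λ { zero _ → U.refl _ ; (suc zero) ne → contradiction refl ne ; (suc (suc zero)) _ → U.refl _ ; (suc
                (suc (suc l))) _ → U.refl _ }

          move₂ : (∀ {α β} → Step 2F α β → X β → X α) → ∀ {u v w w′} → Holds (mk u v w) rX → Holds (mk u v w′) rX
          move₂ closed = holds-move 2F closed
            λ { zero _ → U.refl _ ; (suc zero) _ → U.refl _ ; (suc (suc zero)) ne → contradiction refl ne ; (suc
                (suc (suc l))) _ → U.refl _ }

          settle : ∀ {s u v w} → (∀ j → U._≈_ j (s j) (mk u v w j)) → Holds s rX → Holds (mk u v w) rX
          settle e hs = holds (trans (Func.cong (proj₁ (proj₁ (to ⟪ rX ⟫) ι)) (λ j → U.sym j (e j))) (truth hs))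

        N-closed : ∀ {i j l} → i ≢ l → j ≢ l → ∀ {α β} → Step l α β → ¬ E i j β → ¬ E i j α
        N-closed p q st nb a = nb (proj₁ (E-step p q st) a)

        E-closed : ∀ {i j l} → i ≢ l → j ≢ l → ∀ {α β} → Step l α β → E i j β → E i j α
        E-closed p q st = proj₂ (E-step p q st)

        holds-em : ∀ {p} {X : Carrier → Set p} (rX : Resp X) s → Holds s rX ⊎ Holds s (¬-resp rX)
        holds-em rX s with h ι ⟪ rX ⟫ s in e
        ... | true  = inj₁ (holds e)
        ... | false = inj₂ (holds (trans (holds-not rX s) (cong notᵇ e)))

        ∃-resp : ∀ {p} {A : Set} {X : A → Carrier → Set p} → (∀ i → Resp (X i)) → Resp (λ α → ∃ λ i → X i α)
        ∃-resp r e (i , x) = i , r i e x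

        holds-fin : ∀ {p r} {X : Fin r → Carrier → Set p} {rX : ∀ i → Resp (X i)} {s} →
                    Holds s (∃-resp rX) → ∃ λ i → Holds s (rX i)
        holds-fin {r = zero} hs with holds-some hs
        ... | _ , () , _
        holds-fin {r = suc r} {X} {rX} {s} hs with holds-em (rX zero) s
        ... | inj₁ h₀ = zero , h₀
        ... | inj₂ n₀ = let (i , hi) = holds-fin {rX = λ i → rX (suc i)} (holds-mono {rY = ∃-resp (λ i → rX (suc i))}
                              (λ { α ((zero , x) , nx) → contradiction x nx ; α ((suc i , x) , _) → i , x })
                              (holds-∧ {rX = ∃-resp rX} {rY = ¬-resp (rX zero)} hs n₀))
                        in suc i , hi

        holds-clash : ∀ {p} {X : Carrier → Set p} {rX : Resp X} {s} → Holds s rX → ¬ Holds s (¬-resp rX)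
        holds-clash {rX = rX} {s} hx hn = true≢false (truth hx) (not-elim (trans (sym (holds-not rX s)) (truth hn)))

        -- The complement of genericity is a finite union of coincidences. A representation respects
        -- finite unions, so one of them would hold at `s`.
        generic-∧ : ∀ {s} → (∀ i j → toℕ i < toℕ j → Holds s (N-r i j)) → Holds s generic-resp
        generic-∧ {s} f with holds-em generic-resp s
        ... | inj₁ hg = hg
        ... | inj₂ hn = let (i , hi) = holds-fin {rX = λ i → ∃-resp (bad-resp i)} (holds-mono {rY = ∃-resp (λ i → ∃-resp (bad-resp i))} find hn)
                            (j , hj) = holds-fin {rX = bad-resp i} hi
                            (lt , e) = holds-some-pair hj
                        in ⊥-elim (holds-clash {rX = E-r i j} (holds-mono {rX = bad-resp i j} {rY = E-r i j}
                            (λ α → proj₂) hj) (f i j lt))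
          where
          Bad : Fin n → Fin n → Carrier → Set
          Bad i j α = toℕ i < toℕ j × E i j α
          bad-resp : ∀ i j → Resp (Bad i j)
          bad-resp i j e (lt , q) = lt , E-resp e q
          holds-some-pair : ∀ {i j} → Holds s (bad-resp i j) → toℕ i < toℕ j × ⊤
          holds-some-pair {i} {j} hb = proj₁ (proj₂ (holds-some {rX = bad-resp i j} hb)) , tt
          find : ∀ α → ¬ Generic α → ∃ λ i → ∃ λ j → Bad i j α
          find α ng = stable λ none → ng λ i j ne q → oriented none i j ne q (ℕ.<-cmp (toℕ i) (toℕ j))
            where
            oriented : ¬ (∃ λ i → ∃ λ j → Bad i j α) → ∀ i j → i ≢ j → E i j α → _ → ⊥
            oriented none i j ne q (tri< lt _ _) = none (i , j , lt , q)
            oriented none i j ne q (tri≈ _ e _)  = ne (Fin.toℕ-injective e)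
            oriented none i j ne q (tri> _ _ gt) = none (j , i , gt , E-sym q)

        Apex-closed : ∀ i x {α β} → Step i α β → Apex i x β → Apex i x α
        Apex-closed i x = Apex-step

        p : U.Carrier 2F
        p = s⁰ 2F

        base-generic : Holds (mk (s⁰ 0F) (s⁰ 1F) p) generic-resp
        base-generic = settle (λ { zero → U.refl _ ; (suc zero) → U.refl _ ; (suc (suc zero)) → U.refl _ ; (suc (suc
            (suc l))) → U.refl _ })
          (holds h⁰)

        attached-resp : ∀ x → Resp (λ α → Generic α × Apex 1F x α)
        attached-resp x e (g , a) = generic-resp e g , Apex-resp e a

        fetch₀ : ∀ {p} {X : Carrier → Set p} {rX : Resp X} {u v w} → Holds (mk u v w) (cyl-resp 0F X) →
                 ∃ λ u′ → Holds (mk u′ v w) rX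
        fetch₀ {rX = rX} h₀ = let (t , ht , e) = holds-cyl 0F {rX = rX} h₀ in t 0F , settle {rX = rX}
          (λ { zero → U.refl _ ; (suc zero) → e _ (λ ()) ; (suc (suc zero)) → e _ (λ ()) ; (suc (suc (suc l))) → e _
              (λ ()) }) ht

        fetch₁ : ∀ {p} {X : Carrier → Set p} {rX : Resp X} {u v w} → Holds (mk u v w) (cyl-resp 1F X) →
                 ∃ λ v′ → Holds (mk u v′ w) rX
        fetch₁ {rX = rX} h₀ = let (t , ht , e) = holds-cyl 1F {rX = rX} h₀ in t 1F , settle {rX = rX}
          (λ { zero → e _ (λ ()) ; (suc zero) → U.refl _ ; (suc (suc zero)) → e _ (λ ()) ; (suc (suc (suc l))) → e _
              (λ ()) }) ht

        fetch₂ : ∀ {p} {X : Carrier → Set p} {rX : Resp X} {u v w} → Holds (mk u v w) (cyl-resp 2F X) →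
                 ∃ λ w′ → Holds (mk u v w′) rX
        fetch₂ {rX = rX} h₀ = let (t , ht , e) = holds-cyl 2F {rX = rX} h₀ in t 2F , settle {rX = rX}
          (λ { zero → e _ (λ ()) ; (suc zero) → e _ (λ ()) ; (suc (suc zero)) → U.refl _ ; (suc (suc (suc l))) → e _
              (λ ()) }) ht

        abstract
          attached : ∀ x → ∃ λ u → Holds (mk u (s⁰ 1F) p) (attached-resp x)
          attached x = fetch₀ {rX = attached-resp x}
            (holds-mono {rX = generic-resp} {rY = cyl-resp 0F (λ α → Generic α × Apex 1F x α)} (attach x) base-generic)

        a : V → U.Carrier 0F
        a x = proj₁ (attached x)

        a-generic : ∀ x → Holds (mk (a x) (s⁰ 1F) p) generic-resp
        a-generic x = holds-mono {rX = attached-resp x} (λ α → proj₁) (proj₂ (attached x))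

        a-apex : ∀ x {v} → Holds (mk (a x) v p) (A-r 1F x)
        a-apex x = move₁ {rX = A-r 1F x} (Apex-closed 1F x) (holds-mono {rX = attached-resp x} (λ α → proj₂) (proj₂
            (attached x)))

        abstract
          -- A point cannot be moved to another coordinate, whose range may be a different set.
          -- Cylindrification provides a twin there, tied to it by `E`.
          twin₁ : ∀ x → ∃ λ v → Holds (mk (a x) v p) (E-r 1F 0F)
          twin₁ x = fetch₁ {rX = E-r 1F 0F}
            (holds-mono {rX = generic-resp} {rY = cyl-resp 1F (E 1F 0F)} (λ α _ → identify 1F 0F (λ ()) α) (a-generic x))

          twin₂ : ∀ x → ∃ λ w → Holds (mk (a x) (s⁰ 1F) w) (E-r 2F 0F)
          twin₂ x = fetch₂ {rX = E-r 2F 0F}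
            (holds-mono {rX = generic-resp} {rY = cyl-resp 2F (E 2F 0F)} (λ α _ → identify 2F 0F (λ ()) α) (a-generic x))

        b : V → U.Carrier 1F
        b x = proj₁ (twin₁ x)

        d : V → U.Carrier 2F
        d x = proj₁ (twin₂ x)

        ab : ∀ x {w} → Holds (mk (a x) (b x) w) (E-r 1F 0F)
        ab x = move₂ {rX = E-r 1F 0F} (E-closed (λ ()) (λ ())) (proj₂ (twin₁ x))

        ad : ∀ x {v} → Holds (mk (a x) v (d x)) (E-r 2F 0F)
        ad x = move₁ {rX = E-r 2F 0F} (E-closed (λ ()) (λ ())) (proj₂ (twin₂ x))

        -- The two twins are linked through their original in the coordinate `0F`, which may be
        -- changed afterwards.
        bd : ∀ x {u} → Holds (mk u (b x) (d x)) (E-r 2F 1F)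
        bd x = move₀ {rX = E-r 2F 1F} (E-closed (λ ()) (λ ()))
          (holds-mono {rY = E-r 2F 1F} (λ α q → E-trans (proj₂ q) (E-sym (proj₁ q)))
            (holds-∧ {rX = E-r 1F 0F} {rY = E-r 2F 0F} (ab x) (ad x)))

        generic-at : ∀ {s} i j → i ≢ j → Holds s generic-resp → Holds s (N-r i j)
        generic-at i j ne = holds-mono {rX = generic-resp} {rY = N-r i j} (λ α g → g i j ne)

        far : Fin k → Fin n
        far l = suc (suc (suc l))

        a-far : ∀ x l {v w} → Holds (mk (a x) v w) (N-r 0F (far l))
        a-far x l = move₂ {rX = N-r 0F (far l)} (N-closed (λ ()) (λ ()))
          (move₁ {rX = N-r 0F (far l)} (N-closed (λ ()) (λ ())) (generic-at 0F (far l) (λ ()) (a-generic x)))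

        b-far : ∀ x l {u w} → Holds (mk u (b x) w) (N-r 1F (far l))
        b-far x l = move₀ {rX = N-r 1F (far l)} (N-closed (λ ()) (λ ()))
          (holds-mono {rY = N-r 1F (far l)} (λ α q r → proj₂ q (E-trans (E-sym (proj₁ q)) r))
            (holds-∧ {rX = E-r 1F 0F} {rY = N-r 0F (far l)} (ab x) (a-far x l)))

        d-far : ∀ x l {u v} → Holds (mk u v (d x)) (N-r 2F (far l))
        d-far x l {u} {v} = move₀ {rX = N-r 2F (far l)} (N-closed (λ ()) (λ ()))
          (holds-mono {rY = N-r 2F (far l)} (λ α q r → proj₂ q (E-trans (E-sym (proj₁ q)) r))
            (holds-∧ {rX = E-r 2F 0F} {rY = N-r 0F (far l)} (ad x) (a-far x l)))

        p-far : ∀ l {u v} → Holds (mk u v p) (N-r 2F (far l))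
        p-far l = move₁ {rX = N-r 2F (far l)} (N-closed (λ ()) (λ ()))
          (move₀ {rX = N-r 2F (far l)} (N-closed (λ ()) (λ ())) (generic-at 2F (far l) (λ ()) base-generic))

        far-far : ∀ l l′ → toℕ l < toℕ l′ → ∀ {u v w} → Holds (mk u v w) (N-r (far l) (far l′))
        far-far l l′ lt = move₂ {rX = N-r (far l) (far l′)} (N-closed (λ ()) (λ ()))
          (move₁ {rX = N-r (far l) (far l′)} (N-closed (λ ()) (λ ()))
            (move₀ {rX = N-r (far l) (far l′)} (N-closed (λ ()) (λ ()))
              (generic-at (far l) (far l′) (λ { refl → ℕ.<-irrefl refl lt }) base-generic)))

        assemble : ∀ {x y w} → Holds (mk (a x) (b y) w) (N-r 0F 1F) → Holds (mk (a x) (b y) w) (N-r 0F 2F) →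
                   Holds (mk (a x) (b y) w) (N-r 1F 2F) → (∀ l → Holds (mk (a x) (b y) w) (N-r 2F (far l))) →
                   Holds (mk (a x) (b y) w) generic-resp
        assemble {x} {y} n₀₁ n₀₂ n₁₂ n₂ = generic-∧ λ
          { zero (suc zero) _ → n₀₁ ; zero (suc (suc zero)) _ → n₀₂ ; zero (suc (suc (suc l))) _ → a-far x l
          ; (suc zero) (suc zero) (s≤s ()) ; (suc zero) (suc (suc zero)) _ → n₁₂ ; (suc zero) (suc (suc
              (suc l))) _ → b-far y l
          ; (suc (suc zero)) (suc zero) (s≤s ()) ; (suc (suc zero)) (suc (suc zero)) (s≤s (s≤s ()))
          ; (suc (suc zero)) (suc (suc (suc l))) _ → n₂ l
          ; (suc (suc (suc l))) (suc zero) (s≤s ()) ; (suc (suc (suc l))) (suc (suc zero)) (s≤s (s≤s ()))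
          ; (suc (suc (suc l))) (suc (suc (suc l′))) (s≤s (s≤s (s≤s lt))) → far-far l l′ lt }

        b-apex : ∀ x {u} → Holds (mk u (b x) p) (A-r 0F x)
        b-apex x = move₀ {rX = A-r 0F x} (Apex-closed 0F x)
          (holds-mono {rY = A-r 0F x} (λ α q → Apex-E (λ ()) (proj₁ q) (proj₂ q))
            (holds-∧ {rX = E-r 1F 0F} {rY = A-r 1F x} (ab x) (a-apex x)))

        -- If the two points coincided, one face would carry the marks of both `x` and `y`, against
        -- `Apex-inj`.
        n-ab : ∀ {x y} → x ≢ y → ∀ {w} → Holds (mk (a x) (b y) w) (N-r 0F 1F)
        n-ab {x} {y} x≢y = move₂ {rX = N-r 0F 1F} (N-closed (λ ()) (λ ()))
          (holds-mono {rY = N-r 0F 1F} (λ α q e → x≢y (Apex-inj (proj₁ q) (Apex-E (λ ()) e (proj₂ q))))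
            (holds-∧ {rX = A-r 1F x} {rY = A-r 0F y} (a-apex x) (b-apex y)))

        n-ad : ∀ {x y} → x ≢ y → ∀ {v} → Holds (mk (a x) v (d y)) (N-r 0F 2F)
        n-ad {x} {y} x≢y = move₁ {rX = N-r 0F 2F} (N-closed (λ ()) (λ ()))
          (holds-mono {rY = N-r 0F 2F} (λ α q e → proj₁ q (E-trans e (proj₂ q)))
            (holds-∧ {rX = N-r 0F 1F} {rY = E-r 2F 1F} (n-ab x≢y) (bd y)))

        n-bd : ∀ {x y} → x ≢ y → ∀ {u} → Holds (mk u (b x) (d y)) (N-r 1F 2F)
        n-bd {x} {y} x≢y = move₀ {rX = N-r 1F 2F} (N-closed (λ ()) (λ ()))
          (holds-mono {rY = N-r 1F 2F} (λ α q e → proj₂ q (E-trans (E-sym (proj₁ q)) e))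
            (holds-∧ {rX = E-r 1F 0F} {rY = N-r 0F 2F} (ab x) (n-ad x≢y)))

        n-ap : ∀ x {v} → Holds (mk (a x) v p) (N-r 0F 2F)
        n-ap x = move₁ {rX = N-r 0F 2F} (N-closed (λ ()) (λ ())) (generic-at 0F 2F (λ ()) (a-generic x))

        n-bp : ∀ x {u} → Holds (mk u (b x) p) (N-r 1F 2F)
        n-bp x = move₀ {rX = N-r 1F 2F} (N-closed (λ ()) (λ ()))
          (holds-mono {rY = N-r 1F 2F} (λ α q e → proj₂ q (E-trans (E-sym (proj₁ q)) e))
            (holds-∧ {rX = E-r 1F 0F} {rY = N-r 0F 2F} (ab x) (n-ap x)))

        classified : ∀ {x y} → x ≢ y → Holds (mk (a x) (b y) p) (∃-resp (C-r 2F))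
        classified {x} {y} x≢y = holds-mono {rY = ∃-resp (C-r 2F)} (λ α q → classify x≢y (proj₁ q) (proj₁ (proj₂ q))
            (proj₂ (proj₂ q)))
          (holds-∧ {rX = generic-resp} {rY = ×-resp {rX = A-r 1F x} {rY = A-r 0F y}}
            (assemble (n-ab x≢y) (n-ap x) (n-bp y) (λ l → p-far l))
            (holds-∧ {rX = A-r 1F x} {rY = A-r 0F y} (a-apex x) (b-apex y)))

        class-resp : ∀ (Z : M × Fin r → Bool) → Resp (λ α → ∃ λ l → Class 2F l α × Z l ≡ true)
        class-resp Z e (l , c , z) = l , Class-resp e c , z

        -- A representation need not respect infinite joins, so a tuple whose face has some class
        -- only determines an ultrafilter of classes; the field `principal` extracts one class from
        -- it.
        class-uf : ∀ {s} → Holds s (∃-resp (C-r 2F)) → Uf (M × Fin r)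
        class-uf {s} hs = record
          { mem   = λ Z → h ι ⟪ class-resp Z ⟫ s
          ; mono  = λ X Y f hx → truth (holds-mono {rX = class-resp X} {rY = class-resp Y} (λ { α
              (l , c , z) → l , c , f l z }) {s} (holds hx))
          ; inter = λ X Y hx hy → truth (holds-mono {rY = class-resp (λ t → X t ∧ᵇ Y t)}
              (λ { α ((l , c , z) , l′ , c′ , z′) → l , c , ∧-intro z (subst (λ m → Y m ≡ true) (Class-func c′ c) z′) }) {s}
              (holds-∧ {rX = class-resp X} {rY = class-resp Y} (holds hx) (holds hy)))
          ; prime = λ X → trans (≡true
              (λ hn → trans (holds-not (class-resp X) s) (cong notᵇ (Bool.¬-not λ hx → both X (holds hx) (holds hn))))
              (λ hn → truth (holds-mono {rY = class-resp (notᵇ ∘ X)}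
                 (λ { α ((l , c) , none) → l , c , cong notᵇ (Bool.¬-not λ z → none (l , c , z)) }) {s}
                 (holds-∧ {rX = ∃-resp (C-r 2F)} {rY = ¬-resp (class-resp X)} hs (holds hn)))))
              (holds-not (class-resp X) s)
          }
          where
          both : ∀ X → Holds s (class-resp X) → Holds s (class-resp (notᵇ ∘ X)) → ⊥
          both X hx hn with holds-some {rX = ×-resp {rX = class-resp X} {rY = class-resp (notᵇ ∘ X)}}
                              (holds-∧ {rX = class-resp X} {rY = class-resp (notᵇ ∘ X)} hx hn)
          ... | α , (l , c , z) , l′ , c′ , z′ =
                true≢false (subst (λ m → X m ≡ true) (Class-func c c′) z) (not-elim z′)

        abstract
          colour : ∀ {x y} → x ≢ y → ∃ λ l → ∀ {w} → Holds (mk (a x) (b y) w) (C-r 2F l)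
          colour {x} {y} x≢y =
            let (l , m) = principal (class-uf (classified x≢y)) in
            l , move₂ {rX = C-r 2F l} Class-step
              (holds-mono {rX = class-resp (λ l′ → ⌊ l′ ≡ l ⌋)} {rY = C-r 2F l}
                (λ { α (l′ , c , e) → subst (λ q → Class 2F q α) (⌊⌋-elim e) c }) {mk (a x) (b y) p} (holds m))

        β : V → V → M × Fin r
        β x y with em {P = x ≡ y}
        ... | yes _ = default
        ... | no ne = proj₁ (colour ne)

        β₂ : ∀ {x y} → x ≢ y → ∀ {w} → Holds (mk (a x) (b y) w) (C-r 2F (β x y))
        β₂ {x} {y} x≢y with em {P = x ≡ y}
        ... | yes e = contradiction e x≢y
        ... | no ne = proj₂ (colour ne)

        β₁ : ∀ {x y} → x ≢ y → ∀ {v} → Holds (mk (a x) v (d y)) (C-r 1F (β x y))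
        β₁ {x} {y} x≢y = move₁ {rX = C-r 1F (β x y)} Class-step (holds-mono {rY = C-r 1F (β x y)}
          (λ α q → Class-E (λ ()) (proj₁ q) (proj₂ q))
          (holds-∧ {rX = E-r 2F 1F} {rY = C-r 2F (β x y)} (bd y) (β₂ x≢y)))

        β₀ : ∀ {x y} → x ≢ y → ∀ {u} → Holds (mk u (b x) (d y)) (C-r 0F (β x y))
        β₀ {x} {y} x≢y = move₀ {rX = C-r 0F (β x y)} Class-step (holds-mono {rY = C-r 0F (β x y)}
          (λ α q → Class-E (λ ()) (proj₁ q) (proj₂ q))
          (holds-∧ {rX = E-r 1F 0F} {rY = C-r 1F (β x y)} (ab x) (β₁ x≢y)))

        obstructed : ⊥
        obstructed = ramsey large β λ {x} {y} {z} {m} {m′} {i} x≢y x≢z y≢z e e′ e″ →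
          -- The points of `x`, `y` and `z` now fill the coordinates `0F`, `1F` and `2F` of one
          -- generic tuple. Omitting one of them leaves faces of classes `β y z`, `β x z` and
          -- `β x y`.
          let (α , g , c₂ , c₁ , c₀) = holds-some (holds-∧ {rX = generic-resp}
                (assemble (n-ab x≢y) (n-ad x≢z) (n-bd y≢z) (λ l → d-far z l))
                (holds-∧ {rX = C-r 2F (β x y)} (β₂ x≢y) (holds-∧ {rX = C-r 1F (β x z)} {rY = C-r 0F (β y z)}
                    (β₁ x≢z) (β₀ y≢z))))
          in clash {m} {m′} {i} g (subst (λ l → Class 2F l α) e c₂) (subst (λ l → Class 1F l α) e′ c₁) (subst
              (λ l → Class 0F l α) e″ c₀)

      obstruction⇒¬representable : ⊥
      obstruction⇒¬representable = let (ι , s⁰ , h⁰) = start in obstructed ι s⁰ h⁰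

-- Construction of labellings

module Scaffolds (em : ∀ {a} → ExcludedMiddle a) (k : ℕ) (P : Palette k) where
  open Classical em
  open Quantifier em
  open Frame em k P
  open Models em k P

  -- A point u with parents a is placed over the face a so that the simplex on
  -- u and a is sec u c when a has colour c. The other faces whose greatest
  -- point is u get flexible colours, all with the same fresh index.
  record Scaffold : Set₁ where
    field
      order : StrictOrder
    open StrictOrder order public
    field
      rank       : Pt → ℕ
      Par        : Pt → (Fin N → Pt) → Set
      par-desc   : ∀ {u a} → Par u a → Desc a
      par-below  : ∀ {u a} → Par u a → a zero <ᵖ u
      par-rank   : ∀ {u a} → Par u a → rank (a zero) < rank u
      par-unique : ∀ {u a a′} → Par u a → Par u a′ → a ≈ᵗ a′
      par-resp   : ∀ {u u′ a a′} → u ≈ᵖ u′ → a ≈ᵗ a′ → Par u a → Par u′ a′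
      sec        : Pt → Colour → Simp
      sec-zero   : ∀ u c → proj₁ (sec u c) zero ≡ c
      sec-resp   : ∀ {u u′} → u ≈ᵖ u′ → ∀ c → sec u c ≡ sec u′ c
      Ω          : Set
      𝓦          : Uf Ω
      flex       : (Fin N → Pt) → Fin N → Fin n → Ω → Colour
      flex-idx   : ∀ F m i ω → idx (flex F m i ω) ≡ just i
      flex-cong  : ∀ {F F′} → F ≈ᵗ F′ → ∀ m i ω → flex F m i ω ≡ flex F′ m i ω
      flex-law   : ∀ F i m m′ → mapᵘ (flex F m i) 𝓦 ≋ mapᵘ (flex F m′ i) 𝓦

  module Labelling (𝔖 : Scaffold) where
    open Scaffold 𝔖

    Face : Set
    Face = Fin N → Pt

    -- The faces through `F zero` of its simplex over the parents: these are the ones whose labels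
    -- `sec` dictates.
    Spec : Face → Set
    Spec F = ∃ λ a → ∃ λ m → Par (F zero) a × (∀ j → F (suc j) ≈ᵖ a (punchIn m j))

    side : Pt → Fin N → Uf Colour → Uf Colour
    side u m = mapᵘ (λ c → proj₁ (sec u c) (suc m))

    Avoids : (Face → Uf Colour) → Pt → Face → Fin n → Set
    Avoids L u a i = ∀ m → Most (side u m (L a)) (λ c → idx c ≢ just i)

    -- `first` makes the index depend only on which indices are avoided, hence invariant under `≈ᵖ`.
    -- A point without parents has no dictated sides, and `zero` will do.
    free : (Face → Uf Colour) → (u : Pt) → Dec (∃ λ a → Par u a) → Fin n
    free L u (yes (a , _)) = first (λ i → ⌊ Avoids L u a i ⌋)
    free L u (no _)        = zero

    step : (Face → Uf Colour) → (F : Face) → Dec (Spec F) → Uf Colour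
    step L F (yes (a , m , _)) = side (F zero) m (L a)
    step L F (no _)            = mapᵘ (flex F zero (free L (F zero) em)) 𝓦

    -- Recursion on the rank of the greatest point, with the numeral as fuel; by `lam-cong` every
    -- sufficient amount gives the same label.
    lam : ℕ → Face → Uf Colour
    lam zero    F = pure (filler zero zero)
    lam (suc d) F = step (lam d) F em

    label : Face → Uf Colour
    label F = lam (suc (rank (F zero))) F

    Agree : (Face → Uf Colour) → (Face → Uf Colour) → Pt → Pt → Set
    Agree L L′ u u′ = ∀ {a a′} → rank (a zero) < rank u → rank (a′ zero) < rank u′ → a ≈ᵗ a′ → L a ≋ L′ a′

    side-cong : ∀ {u u′} → u ≈ᵖ u′ → ∀ m {J J′ : Uf Colour} → J ≋ J′ → side u m J ≋ side u′ m J′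
    side-cong e m {J} j X = trans (mem-cong J _ _ (λ c → cong (λ K → X (proj₁ K (suc m))) (sec-resp e c))) (j _)

    free-cong : ∀ {L L′ u u′} → Agree L L′ u u′ → u ≈ᵖ u′ → ∀ D D′ → free L u D ≡ free L′ u′ D′
    free-cong {L} {L′} {u} {u′} ag e (yes (a , p)) (yes (a′ , p′)) =
      first-cong _ _ (λ i → ⌊⌋-cong (λ av m → most-≋ {J = side u m (L a)} {side u′ m
          (L′ a′)} {P = λ c → idx c ≢ just i} (sides m) (av m))
                                   (λ av m → most-≋ {J = side u′ m (L′ a′)} {side u m
                                       (L a)} {P = λ c → idx c ≢ just i} (λ X → sym (sides m X)) (av m)))
      where
      sides : ∀ m → side u m (L a) ≋ side u′ m (L′ a′)
      sides m = side-cong e m {L a} {L′ a′}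
        (ag (par-rank p) (par-rank p′) (par-unique (par-resp e (λ _ → ≈-refl) p) p′))
    free-cong ag e (yes (a , p)) (no ¬p) = contradiction (a , par-resp e (λ _ → ≈-refl) p) ¬p
    free-cong ag e (no ¬p) (yes (a , p)) = contradiction (a , par-resp (≈-sym e) (λ _ → ≈-refl) p) ¬p
    free-cong ag e (no _) (no _) = refl

    punch-unique : ∀ {r} {a : Fin (suc r) → Pt} → Desc a → ∀ m m′ →
                   (∀ j → a (punchIn m j) ≈ᵖ a (punchIn m′ j)) → m ≡ m′
    punch-unique {a = a} d m m′ e with m Fin.≟ m′
    ... | yes q = q
    ... | no ne with punch-surj m m′ (ne ∘ sym)
    ...   | j , q = ⊥-elim (Fin.punchInᵢ≢i m′ j (desc-inj d _ _
              (≈-sym (subst (λ z → a z ≈ᵖ a (punchIn m′ j)) q (e j)))))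

    spec-resp : ∀ {F F′} → F ≈ᵗ F′ → Spec F → Spec F′
    spec-resp e (a , m , p , q) = a , m , par-resp (e zero) (λ _ → ≈-refl) p , λ j → ≈-trans (≈-sym (e (suc j))) (q j)

    step-cong : ∀ {L L′ F F′} → Agree L L′ (F zero) (F′ zero) → F ≈ᵗ F′ → ∀ D D′ → step L F D ≋ step L′ F′ D′
    step-cong {L} {L′} {F} {F′} ag e (yes (a , m , p , q)) (yes (a′ , m′ , p′ , q′)) =
      subst (λ z → side (F zero) m (L a) ≋ side (F′ zero) z (L′ a′)) m≡m′
        (side-cong (e zero) m {L a} {L′ a′} (ag (par-rank p) (par-rank p′) a≈a′))
      where
      a≈a′ : a ≈ᵗ a′
      a≈a′ = par-unique (par-resp (e zero) (λ _ → ≈-refl) p) p′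
      m≡m′ : m ≡ m′
      m≡m′ = punch-unique (par-desc p′) m m′ (λ j → ≈-trans (≈-sym (a≈a′ _))
        (≈-trans (≈-sym (q j)) (≈-trans (e (suc j)) (q′ j))))
    step-cong ag e (yes s) (no ¬s) = contradiction (spec-resp e s) ¬s
    step-cong ag e (no ¬s) (yes s) = contradiction (spec-resp (λ i → ≈-sym (e i)) s) ¬s
    step-cong {L} {L′} {F} {F′} ag e (no _) (no _) X = mem-cong 𝓦 _ _ λ ω → cong X
      (trans (flex-cong e zero _ ω) (cong (λ i → flex F′ zero i ω) (free-cong {L} {L′} ag (e zero) em em)))

    lam-cong : ∀ d d′ {F F′} → rank (F zero) < d → rank (F′ zero) < d′ → F ≈ᵗ F′ → lam d F ≋ lam d′ F′
    lam-cong (suc d) (suc d′) {F} {F′} lt lt′ e = step-cong {lam d} {lam d′} {F} {F′}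
      (λ r r′ → lam-cong d d′ (ℕ.<-≤-trans r (ℕ.≤-pred lt)) (ℕ.<-≤-trans r′ (ℕ.≤-pred lt′))) e em em

    label-cong : ∀ {F F′} → F ≈ᵗ F′ → label F ≋ label F′
    label-cong = lam-cong _ _ ℕ.≤-refl ℕ.≤-refl

    agree-label : ∀ (F : Face) → Agree (lam (rank (F zero))) label (F zero) (F zero)
    agree-label F r r′ = lam-cong _ _ r ℕ.≤-refl

    index : Pt → Fin n
    index u = free label u em

    label-spec : ∀ F {a m} → Par (F zero) a → (∀ j → F (suc j) ≈ᵖ a (punchIn m j)) →
                 label F ≋ side (F zero) m (label a)
    label-spec F {a} {m} p q = step-cong {lam (rank (F zero))} {label} {F} {F} (agree-label F) (λ i → ≈-refl {F i})
      em (yes (a , m , p , q))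

    label-flex : ∀ F → ¬ Spec F → label F ≋ mapᵘ (flex F zero (index (F zero))) 𝓦
    label-flex F ¬s = step-cong {lam (rank (F zero))} {label} {F} {F} (agree-label F) (λ i → ≈-refl {F i}) em (no ¬s)

    index-free : ∀ {u a} → Par u a → Avoids label u a (index u)
    index-free {u} {a} p with em {P = ∃ λ a → Par u a}
    ... | no none = contradiction (a , p) none
    ... | yes (a′ , p′) = λ m → most-≋ {J = side u m (label a′)} {side u m (label a)} {P = λ c → idx c ≢ just (first
        (λ i → ⌊ Avoids label u a′ i ⌋))}
            (side-cong ≈-refl m {label a′} {label a} (label-cong (par-unique p′ p)))
            (⌊⌋-elim (first-true (λ i → ⌊ Avoids label u a′ i ⌋) (proj₁ exists) (⌊⌋-intro (proj₂ exists))) m)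
      where
      decided : ∀ m → Dec (∃ λ i → Most (side u m (label a′)) (λ c → idx c ≡ just i)) → Maybe (Fin n)
      decided m (yes (i , _)) = just i
      decided m (no _)        = nothing
      -- Each of the `N` sides concentrates on at most one index, so one of the `n` indices is
      -- avoided by all of them.
      exists : ∃ λ i → Avoids label u a′ i
      exists with free-index (λ m → decided m em)
      ... | i , fr = i , λ m → most-¬ (side u m (label a′)) {P = λ c → idx c ≡ just i} (λ mi → clash m em mi (fr m))
        where
        clash : ∀ m D → Most (side u m (label a′)) (λ c → idx c ≡ just i) → ¬ (decided m D ≢ just i)
        clash m (no none) mi _ = none (i , mi)
        clash m (yes (i′ , mi′)) mi ne with most-some (side u m
            (label a′)) {P = λ c → idx c ≡ just i × idx c ≡ just i′} (most-∧ (side u m (label a′))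
          {P = λ c → idx c ≡ just i} {Q = λ c → idx c ≡ just i′} mi mi′)
        ... | c , e , e′ = ne (trans (sym e′) e)

    face : (Fin n → Pt) → Fin N → Face
    face x m = x ∘ punchIn (suc m)

    choose : Bool → Colour → Colour → Colour
    choose true  c d = c
    choose false c d = d

    build : (Fin n → Pt) → Colour → (Fin N → Colour) → Ω → Fin n → Colour
    build x c cs ω zero    = c
    build x c cs ω (suc m) = choose ⌊ Spec (face x m) ⌋ (cs m) (flex (face x m) m (index (x zero)) ω)

    -- The base and the dictated faces are coloured independently. The flexible faces share one `ω`,
    -- through which they can be kept from clashing with one another.
    raw : (Fin n → Pt) → Uf (Fin n → Colour)
    raw x = bind (label (x ∘ suc)) λ c → bind (prod (label ∘ face x)) λ cs → mapᵘ (build x c cs) 𝓦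

    -- The default simplex is used on a small set only, wherever `raw-good` applies.
    simp : (K : Fin n → Colour) → Dec (Good K) → Simp
    simp K (yes g) = K , g
    simp K (no _)  = proj₁ (extend₁ zero (filler zero zero))

    joint-by : (x : Fin n → Pt) → Dec (Par (x zero) (x ∘ suc)) → Uf Simp
    joint-by x (yes _) = mapᵘ (sec (x zero)) (label (x ∘ suc))
    joint-by x (no _)  = mapᵘ (λ K → simp K em) (raw x)

    joint : (Fin n → Pt) → Uf Simp
    joint x = joint-by x em

    simp-ext : ∀ {K K′} → (∀ l → K l ≡ K′ l) → ∀ D D′ → ∀ l → proj₁ (simp K D) l ≡ proj₁ (simp K′ D′) l
    simp-ext e (yes _) (yes _) = e
    simp-ext e (yes g) (no ¬g) = ⊥-elim (¬g (good-ext e g))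
    simp-ext e (no ¬g) (yes g) = ⊥-elim (¬g (good-ext (λ l → sym (e l)) g))
    simp-ext e (no _)  (no _)  = λ _ → refl

    index-resp : ∀ {u u′} → u ≈ᵖ u′ → index u ≡ index u′
    index-resp e = free-cong {label} {label} (λ _ _ → label-cong) e em em

    joint-cong : ∀ {x x′} → x ≈ᵗ x′ → ∀ {W} → Ext W → mem (joint x) W ≡ mem (joint x′) W
    joint-cong {x} {x′} e {W} ext-W = go em em
      where
      go : ∀ D D′ → mem (joint-by x D) W ≡ mem (joint-by x′ D′) W
      go (yes _) (yes _) = trans (mem-cong (label (x ∘ suc)) _ _ (λ c → cong W (sec-resp (e zero) c)))
        (label-cong (e ∘ suc) _)
      go (yes p) (no ¬p) = contradiction (par-resp (e zero) (e ∘ suc) p) ¬p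
      go (no ¬p) (yes p) = contradiction (par-resp (≈-sym (e zero)) (λ j → ≈-sym (e (suc j))) p) ¬p
      go (no _)  (no _)  = trans
        (mem-cong (label (x ∘ suc)) _ _ λ c → trans
          (mem-cong (prod (label ∘ face x)) _ _ λ cs → mem-cong 𝓦 _ _ λ ω → ext-W {simp (build x c cs ω) em} {simp
              (build x′ c cs ω) em} (simp-ext (same c cs ω) em em))
          (prod-cong {Js = label ∘ face x} {label ∘ face x′} (λ m → label-cong (e ∘ punchIn (suc m)))
            (λ cs → mem 𝓦 (λ ω → W (simp (build x′ c cs ω) em)))))
        (label-cong (e ∘ suc) _)
        where
        same : ∀ c cs ω l → build x c cs ω l ≡ build x′ c cs ω l
        same c cs ω zero = refl
        same c cs ω (suc m) = trans
          (cong (λ q → choose q (cs m) (flex (face x m) m (index (x zero)) ω))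
            (⌊⌋-cong (spec-resp (e ∘ punchIn (suc m))) (spec-resp (λ j → ≈-sym (e (punchIn (suc m) j))))))
          (cong (choose ⌊ Spec (face x′ m) ⌋ (cs m)) (trans (flex-cong (e ∘ punchIn (suc m)) m _ ω)
            (cong (λ i → flex (face x′ m) m i ω) (index-resp (e zero)))))

    -- Two dictated faces with the same greatest point cover the base, which would then consist of
    -- the parents of that point.
    spec-once : ∀ {x} → Desc x → ¬ Par (x zero) (x ∘ suc) → ∀ {m m′} → Spec (face x m) → Spec (face x m′) → m ≡ m′
    spec-once {x} dx ¬par {m} {m′} (a , u , p , q) (a′ , u′ , p′ , q′) = stable λ m≢m′ →
      ¬par (par-resp ≈-refl (λ j → ≈-sym (z≈a m≢m′ j)) p)
      where
      within : m ≢ m′ → ∀ j → ∃ λ l → x (suc j) ≈ᵖ a l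
      within m≢m′ j with j Fin.≟ m
      ... | no ne = let (i , e) = punch-surj m j ne in punchIn u i , subst (λ z → x (suc z) ≈ᵖ a (punchIn u i)) e (q i)
      ... | yes refl = let (i , e) = punch-surj m′ j m≢m′ in
            punchIn u′ i , ≈-trans (subst (λ z → x (suc z) ≈ᵖ a′ (punchIn u′ i)) e (q′ i)) (par-unique p′ p _)
      z≈a : m ≢ m′ → (x ∘ suc) ≈ᵗ a
      z≈a ne = desc-unique (desc-tail dx) (par-desc p) (within ne)
        (λ l → let (j , e) = injective⇒onto (proj₁ ∘ within ne) inj l
               in j , ≈-sym (subst (λ z → x (suc j) ≈ᵖ a z) e (proj₂ (within ne j))))
        where
        inj : Inj (proj₁ ∘ within ne)
        inj i j e = Fin.suc-injective (desc-inj dx _ _ (≈-trans (proj₂ (within ne i))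
          (subst (λ z → a z ≈ᵖ x (suc j)) (sym e) (≈-sym (proj₂ (within ne j))))))

    FlexOld FlexGood : (Fin n → Pt) → Set
    FlexOld x = let i = index (x zero) in
      Most (label (x ∘ suc)) λ c → Most 𝓦 λ ω → ∀ m m′ → m ≢ m′ →
        ¬ Bad c (flex (face x m) m i ω) (flex (face x m′) m′ i ω)
    FlexGood x = let i = index (x zero) in
      Most 𝓦 λ ω → ∀ m m′ m″ → m ≢ m′ → m ≢ m″ → m′ ≢ m″ →
        ¬ Bad (flex (face x m) m i ω) (flex (face x m′) m′ i ω) (flex (face x m″) m″ i ω)

    -- Clashing colours share their index. The dictated face avoids the flexible index, while by
    -- `spec-once` any three faces including it also include a flexible one. The other triples
    -- consist of flexible faces and possibly the base, which are the two hypotheses.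
    raw-good : ∀ {x} → Desc x → ¬ Par (x zero) (x ∘ suc) → FlexOld x → FlexGood x → Most (raw x) Good
    raw-good {x} dx ¬par old good = most-bind (label (x ∘ suc)) outer {P = Good} (most-mono (label (x ∘ suc))
        (λ c oldc → most-bind 𝓒 (λ cs → mapᵘ (build x c cs) 𝓦) {P = Good} (most-mono 𝓒
          (λ cs clear → most-mono 𝓦 (λ ω og → all-good c cs ω clear (proj₁ og) (proj₂ og))
            (most-∧ 𝓦 oldc good))
          clear-index))
        old)
      where
      i = index (x zero)
      S : Fin N → Set
      S m = Spec (face x m)
      𝓒 : Uf (Fin N → Colour)
      𝓒 = prod (label ∘ face x)
      outer : Colour → Uf (Fin n → Colour)
      outer c = bind 𝓒 λ cs → mapᵘ (build x c cs) 𝓦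
      Clear : (Fin N → Colour) → Set
      Clear cs = ∀ m → S m → idx (cs m) ≢ just i
      clear-index : Most 𝓒 Clear
      clear-index = most-all-fin 𝓒 {P = λ m cs → S m → idx (cs m) ≢ just i} λ m → one m em
        where
        one : ∀ m → Dec (S m) → Most 𝓒 (λ cs → S m → idx (cs m) ≢ just i)
        one m (no ¬s) = most-all 𝓒 {P = λ cs → S m → idx (cs m) ≢ just i} (λ cs s → contradiction s ¬s)
        one m (yes (a , l , p , q)) = most-mono 𝓒 {P = λ cs → idx (cs m) ≢ just i} {Q = λ cs → S m → idx
            (cs m) ≢ just i} (λ cs h _ → h)
          (most-≋ {J = label (face x m)} {mapᵘ (λ cs → cs m) 𝓒} {P = λ c → idx c ≢ just i}
            (λ X → sym (prod-marginal (label ∘ face x) m X))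
            (most-≋ {J = side (x zero) l (label a)} {label (face x m)} {P = λ c → idx c ≢ just i}
              (λ X → sym (label-spec (face x m) {a} {l} p q X)) (index-free p l)))
      all-good : ∀ c cs ω → Clear cs → _ → _ → Good (build x c cs ω)
      all-good c cs ω clear o g u v w u≢v u≢w v≢w b = finish u v w u≢v u≢w v≢w b
          (λ m e s → no-spec u≢v u≢w v≢w e s b)
          (λ m e s → no-spec (u≢v ∘ sym) v≢w u≢w e s (bad-swap₁ b))
          (λ m e s → no-spec (u≢w ∘ sym) (v≢w ∘ sym) u≢v e s (bad-swap₁ (bad-swap₂ b)))
        where
        K = build x c cs ω
        K-flex : ∀ m → ¬ S m → K (suc m) ≡ flex (face x m) m i ω
        K-flex m ¬s with em {P = S m}
        ... | yes s = contradiction s ¬s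
        ... | no _  = refl
        K-spec : ∀ m → S m → K (suc m) ≡ cs m
        K-spec m s with em {P = S m}
        ... | yes _ = refl
        ... | no ¬s = contradiction s ¬s
        flex-index : ∀ {m} → ¬ S m → idx (K (suc m)) ≡ just i
        flex-index {m} ¬s = trans (cong idx (K-flex m ¬s)) (flex-idx (face x m) m i ω)
        spec-index : ∀ {m} → S m → idx (K (suc m)) ≢ just i
        spec-index {m} s e = clear m s (trans (cong idx (sym (K-spec m s))) e)
        no-spec : ∀ {u v w m} → u ≢ v → u ≢ w → v ≢ w → u ≡ suc m → S m → ¬ Bad (K u) (K v) (K w)
        no-spec {v = suc v′} u≢v u≢w v≢w refl s b = spec-index s
          (trans (bad-idx b) (flex-index (λ s′ → u≢v (cong suc (spec-once dx ¬par s s′)))))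
        no-spec {v = zero} {suc w′} u≢v u≢w v≢w refl s b = spec-index s
          (trans (bad-idx (bad-swap₂ b)) (flex-index (λ s′ → u≢w (cong suc (spec-once dx ¬par s s′)))))
        no-spec {v = zero} {zero} u≢v u≢w v≢w refl s b = v≢w refl
        finish : ∀ u v w → u ≢ v → u ≢ w → v ≢ w → Bad (K u) (K v) (K w) → (∀ m → u ≡ suc m → ¬ S m) →
                 (∀ m → v ≡ suc m → ¬ S m) → (∀ m → w ≡ suc m → ¬ S m) → ⊥
        finish zero zero w p q r b nu nv nw = p refl
        finish zero (suc v) zero p q r b nu nv nw = q refl
        finish (suc u) zero zero p q r b nu nv nw = r refl
        finish zero (suc v) (suc w) p q r b nu nv nw = o v w (r ∘ cong suc)
          (subst₂ (Bad c) (K-flex v (nv v refl)) (K-flex w (nw w refl)) b)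
        finish (suc u) zero (suc w) p q r b nu nv nw = o u w (q ∘ cong suc)
          (subst₂ (Bad c) (K-flex u (nu u refl)) (K-flex w (nw w refl)) (bad-swap₁ b))
        finish (suc u) (suc v) zero p q r b nu nv nw = o u v (p ∘ cong suc)
          (subst₂ (Bad c) (K-flex u (nu u refl)) (K-flex v (nv v refl)) (bad-swap₁ (bad-swap₂ b)))
        finish (suc u) (suc v) (suc w) p q r b nu nv nw = g u v w (p ∘ cong suc) (q ∘ cong suc) (r ∘ cong suc)
          (subst (λ z → Bad z _ _) (K-flex u (nu u refl)) (subst₂ (Bad _) (K-flex v (nv v refl)) (K-flex w (nw w refl)) b))

    module _ (old  : ∀ {x} → Desc x → ¬ Par (x zero) (x ∘ suc) → FlexOld x)
             (good : ∀ {x} → Desc x → ¬ Par (x zero) (x ∘ suc) → FlexGood x)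
             (realizable : ∀ {a} → Desc a → ∀ {W} → Ext W →
               Most (label a) (λ c → ∃ λ K → proj₁ K zero ≡ c × W K ≡ true) →
               ∃ λ b → Par b a × Most (label a) (λ c → W (sec b c) ≡ true)) where

      marginal : ∀ {x} → Desc x → ∀ m → mapᵘ (λ K → proj₁ K m) (joint x) ≋ label (x ∘ punchIn m)
      marginal {x} dx m X = go em m
        where
        go : ∀ D m → mem (joint-by x D) (λ K → X (proj₁ K m)) ≡ mem (label (x ∘ punchIn m)) X
        go (yes p) zero    = mem-cong (label (x ∘ suc)) _ _ (λ c → cong X (sec-zero (x zero) c))
        go (yes p) (suc m) = sym (label-spec (face x m) {x ∘ suc} {m} p (λ _ → ≈-refl) X)
        go (no ¬p) m = trans (most-agree (raw x) {X = λ K → X (proj₁ (simp K em) m)} {Y = λ K → X (K m)} (most-mono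
            (raw x) {P = Good} (λ K g → cong X (simp-good K g em)) (raw-good dx ¬p (old dx ¬p) (good dx ¬p)))) (law m)
          where
          simp-good : ∀ K → Good K → ∀ D → proj₁ (simp K D) m ≡ K m
          simp-good K g (yes _) = refl
          simp-good K g (no ¬g) = ⊥-elim (¬g g)
          law : ∀ m → mem (raw x) (λ K → X (K m)) ≡ mem (label (x ∘ punchIn m)) X
          law zero = mem-cong (label (x ∘ suc)) _ _ λ c →
            trans (mem-cong (prod (label ∘ face x)) _ _ (λ cs → mem-const 𝓦 (X c))) (mem-const (prod
                (label ∘ face x)) (X c))
          law (suc m) = trans (mem-cong (label (x ∘ suc)) _ _ λ c → inner c em) (mem-const (label (x ∘ suc)) _)
            where
            F = face x m
            inner : ∀ c (D : Dec (Spec F)) → mem (prod (label ∘ face x)) (λ cs → mem 𝓦 (λ ω →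
                      X (choose (does D) (cs m) (flex F m (index (x zero)) ω)))) ≡ mem (label F) X
            inner c (yes s) = trans (mem-cong (prod (label ∘ face x)) _ _ (λ cs → mem-const 𝓦 (X (cs m))))
              (prod-marginal (label ∘ face x) m X)
            -- The flexible colour depends on the position `m` of the face in the simplex, but its
            -- distribution does not; the label was defined with position `zero`.
            inner c (no ¬s) = trans (mem-const (prod (label ∘ face x)) _)
              (trans (flex-law F (index (x zero)) m zero X) (sym (label-flex F ¬s X)))

      model : Model
      model = record
        { order      = order
        ; label      = label
        ; joint      = joint
        ; label-cong = label-cong
        ; joint-cong = λ e {W} → joint-cong e {W}
        ; marginal   = marginal
        ; realize    = λ {a} da {W} ext-W m → let (b , p , mb) = realizable da ext-W m in
            b , par-below p , realized b p em (most⇒mem (label a) mb)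
        }
        where
        realized : ∀ {a W} b → Par b a → ∀ D → mem (label a) (W ∘ sec b) ≡ true → mem (joint-by (b ∷ a) D) W ≡ true
        realized b p (yes _) h = h
        realized b p (no ¬p) h = contradiction p ¬p

-- Colours of the faces of a tuple

module Faces (em : ∀ {a} → ExcludedMiddle a) (k : ℕ) (P : Palette k) where
  open Classical em
  open Frame em k P

  -- The point `m` missed by the other entries exists and is unique, so the second clause does
  -- assert a colour.
  FaceCol : Fin n → Colour → Atom → Set
  FaceCol i c a = (∀ u v → u ≢ i → v ≢ i → pos a u ≡ pos a v → u ≡ v) ×
                  (∀ m → (∀ u → u ≢ i → pos a u ≢ m) → col a m ≡ c)

  off-inj : ∀ {i} {p : Fin n → Fin n} → (∀ u v → u ≢ i → v ≢ i → p u ≡ p v → u ≡ v) → Inj (p ∘ punchIn i)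
  off-inj {i} inj x y e = Fin.punchIn-injective i x y (inj _ _ (Fin.punchInᵢ≢i i x) (Fin.punchInᵢ≢i i y) e)

  off-miss : ∀ {i m} {p : Fin n → Fin n} → (∀ l → p (punchIn i l) ≢ m) → ∀ u → u ≢ i → p u ≢ m
  off-miss {i} {p = p} ms u ne with punch-surj i u ne
  ... | l , refl = ms l

  faceCol-same : ∀ {i c a b} → SameOn (Off i) a b → FaceCol i c a → FaceCol i c b
  faceCol-same {i} {c} {a} {b} s (inj , cl) = inj′ , λ m ms →
      let (m′ , ms′) = missing (pos a ∘ punchIn i) in
      trans (sym (lab s (punchIn i) (Fin.punchInᵢ≢i i) (off-inj inj , ms′)
                  (off-inj inj′ , λ l → ms (punchIn i l) (Fin.punchInᵢ≢i i l))))
            (cl m′ (off-miss {p = pos a} ms′))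
    where
    inj′ : ∀ u v → u ≢ i → v ≢ i → pos b u ≡ pos b v → u ≡ v
    inj′ u v pu pv e = inj u v pu pv (ker⁻ s pu pv e)

  -- When two entries coincide, omitting either of them leaves the same face. Colours travel between
  -- coordinates in this way, without substitutions.
  faceCol-merge : ∀ {i j c a} → i ≢ j → pos a i ≡ pos a j → FaceCol i c a → FaceCol j c a
  faceCol-merge {i} {j} {c} {a} i≢j e (inj , cl) = inj′ , λ m ms → cl m (λ u ne → go ms u (u Fin.≟ j))
    where
    go : ∀ {m} → (∀ u → u ≢ j → pos a u ≢ m) → ∀ u → Dec (u ≡ j) → pos a u ≢ m
    go ms u (no ne)    = ms u ne
    go ms u (yes refl) = λ q → ms i i≢j (trans e q)
    inj′ : ∀ u v → u ≢ j → v ≢ j → pos a u ≡ pos a v → u ≡ v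
    inj′ u v pu pv q with u Fin.≟ i | v Fin.≟ i
    ... | yes refl | yes refl = refl
    ... | yes refl | no v≢i   = contradiction (sym (inj j v (i≢j ∘ sym) v≢i (trans (sym e) q))) pv
    ... | no u≢i   | yes refl = contradiction (sym (inj j u (i≢j ∘ sym) u≢i (trans (sym e) (sym q)))) pu
    ... | no u≢i   | no v≢i   = inj u v u≢i v≢i q

  faceCol-unique : ∀ {i c c′ a} → FaceCol i c a → FaceCol i c′ a → c ≡ c′
  faceCol-unique {i} {a = a} (inj , cl) (_ , cl′) = let (m , ms) = missing (pos a ∘ punchIn i) in
    trans (sym (cl m (off-miss {p = pos a} ms))) (cl′ m (off-miss {p = pos a} ms))

  faceCol-generic : ∀ {a} → Inj (pos a) → ∀ i → FaceCol i (col a (pos a i)) a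
  faceCol-generic {a} inj i = (λ u v _ _ → inj u v) , λ m ms → cong (col a)
    (missing-unique (off-inj (λ u v _ _ → inj u v)) (λ l → ms _ (Fin.punchInᵢ≢i i l)) (proj₂ (punch-miss (pos a) i inj)))

  -- Faces opposite to different points can be coloured independently, so one is kept while the
  -- other gets the colour `c`.
  recolour : ∀ {a} → Inj (pos a) → ∀ {i j} → i ≢ j → ∀ c →
             ∃ λ b → SameOn (Off i) a b × Inj (pos b) × FaceCol j c b
  recolour {a} inj {i} {j} i≢j c with extend (λ e → i≢j (inj i j e)) (col a (pos a i)) c
  ... | K , at-i , at-j = atom (pos a) K , record
          { ker = λ _ _ e → e ; ker⁻ = λ _ _ e → e
          ; lab = λ θ off {m} {m′} x y →
              let m≡ = missing-unique (proj₁ x) (proj₂ x) (λ l e → off l (inj _ _ e))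
                  m′≡ = missing-unique (proj₁ y) (proj₂ y) (λ l e → off l (inj _ _ e))
              in trans (cong (col a) m≡) (trans (sym at-i) (cong (proj₁ K) (sym m′≡)))
          } , inj , subst (λ z → FaceCol j z (atom (pos a) K)) at-j (faceCol-generic {atom (pos a) K} inj j)

-- Obstructions from sequences of atoms

module SequencesModulo (em : ∀ {a} → ExcludedMiddle a) (k : ℕ) {I : Set} (𝓕 : Uf I) (P : I → Palette k) where
  open Classical em
  open Quantifier em
  open Obstructions em k hiding (n)
  private
    module F i = Frame em k (P i)
    module C i = Faces em k (P i)
    n = 3 + k
    0F 1F 2F : Fin n
    0F = zero
    1F = suc zero
    2F = suc (suc zero)

  Colours : Set
  Colours = ∀ i → Palette.Colour (P i)

  -- The atoms of a structure as sequences of atoms modulo 𝓕.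
  record Sequential {ℓ} {τ : Signature n} (S : AtomStructure τ ℓ) : Set (lsuc ℓ) where
    open AtomStructure S
    field
      rep      : Carrier → ∀ i → F.Atom i
      rep-cong : ∀ {α β} → α ≈ β → Most 𝓕 (λ i → F.Same i (rep α i) (rep β i))
      rep-step : ∀ {l α β} → Step S l α β → Most 𝓕 (λ i → F.SameOn i (F.Off i l) (rep α i) (rep β i))
      V        : Set
      apex     : V → Colours
      apex-inj : ∀ {x y} → Most 𝓕 (λ i → apex x i ≡ apex y i) → x ≡ y
      fetch-E  : ∀ l i j α → Most 𝓕 (λ ν → ∃ λ b → F.SameOn ν (F.Off ν l) (rep α ν) b × F.pos b i ≡ F.pos b j) →
                 ∃ λ β → Step S l α β × Most 𝓕 (λ ν → F.pos (rep β ν) i ≡ F.pos (rep β ν) j)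
      fetch-apex : ∀ l x α → Most 𝓕 (λ ν → ∃ λ b → F.SameOn ν (F.Off ν l) (rep α ν) b × Inj
          (F.pos b) × C.FaceCol ν 1F (apex x ν) b) →
                 ∃ λ β → Step S l α β × Most 𝓕 (λ ν → Inj (F.pos (rep β ν)) × C.FaceCol ν 1F (apex x ν) (rep β ν))
      generic  : ∃ λ α → Most 𝓕 (λ i → Inj (F.pos (rep α i)))
      M        : Set
      r        : ℕ
      default  : M × Fin r
      large    : Largeness V (M × Fin r)
      principal : (J : Uf (M × Fin r)) → ∃ λ l → Most J (_≡ l)
      Cl       : Colours → M × Fin r → Set
      Cl-func  : ∀ {c c′ l l′} → Most 𝓕 (λ i → c i ≡ c′ i) → Cl c l → Cl c′ l′ → l ≡ l′
      Cl-some  : ∀ {x y α} → x ≢ y → Most 𝓕 (λ i → Inj (F.pos (rep α i))) →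
                 Most 𝓕 (λ i → C.FaceCol i 1F (apex x i) (rep α i)) →
                 Most 𝓕 (λ i → C.FaceCol i 0F (apex y i) (rep α i)) →
                 ∃ λ l → Cl (λ i → F.col i (rep α i) (F.pos (rep α i) 2F)) l
      Cl-clash : ∀ {c c′ c″ m m′ q} → Most 𝓕 (λ i → ¬ Palette.Bad (P i) (c i) (c′ i) (c″ i)) →
                 Cl c″ (m , q) → Cl c′ (m , q) → Cl c (m′ , q) → ⊥

  module _ {ℓ} {τ : Signature n} {S : AtomStructure τ ℓ} (𝔔 : Sequential S) where
    open AtomStructure S
    open Sequential 𝔔

    E : Fin n → Fin n → Carrier → Set
    E i j α = Most 𝓕 (λ ν → F.pos (rep α ν) i ≡ F.pos (rep α ν) j)

    Colour-at : Fin n → Colours → Carrier → Set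
    Colour-at i c α = Most 𝓕 (λ ν → C.FaceCol ν i (c ν) (rep α ν))

    same-colour : ∀ {i c α β} → Most 𝓕 (λ ν → F.SameOn ν (F.Off ν i) (rep α ν) (rep β ν)) →
                  Colour-at i c α → Colour-at i c β
    same-colour {α = α} {β} s f = most-mono 𝓕 (λ ν q → C.faceCol-same ν {a = rep α ν} {rep β ν} (proj₁ q) (proj₂ q))
        (most-∧ 𝓕 s f)

    colour-resp : ∀ {i c α β} → α ≈ β → Colour-at i c α → Colour-at i c β
    colour-resp {i} {c} {α} {β} e = same-colour {i} {c} {α} {β} (most-mono 𝓕 (λ ν → F.weaken ν _) (rep-cong e))

    colour-step : ∀ {i c α β} → Step S i α β → Colour-at i c β → Colour-at i c α
    colour-step {i} {c} {α} {β} st = same-colour {i} {c} {β} {α} (most-mono 𝓕 (λ ν → F.same-sym ν) (rep-step st))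

    colour-E : ∀ {i j c α} → i ≢ j → E i j α → Colour-at i c α → Colour-at j c α
    colour-E {α = α} i≢j e f = most-mono 𝓕 (λ ν q → C.faceCol-merge ν {a = rep α ν} i≢j (proj₁ q) (proj₂ q)) (most-∧ 𝓕 e f)

    colour-unique : ∀ {i c c′ α} → Colour-at i c α → Colour-at i c′ α → Most 𝓕 (λ ν → c ν ≡ c′ ν)
    colour-unique {α = α} f g = most-mono 𝓕 (λ ν q → C.faceCol-unique ν {a = rep α ν} (proj₁ q) (proj₂ q)) (most-∧ 𝓕 f g)

    inj-pos : ∀ {α} → (∀ i j → i ≢ j → ¬ E i j α) → Most 𝓕 (λ ν → Inj (F.pos (rep α ν)))
    inj-pos {α} g = most-mono 𝓕 (λ ν h i j e → stable λ ne → h i j ne e)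
      (most-all-fin 𝓕 λ i → most-all-fin 𝓕 λ j → one i j (i Fin.≟ j))
      where
      one : ∀ i j → Dec (i ≡ j) → Most 𝓕 (λ ν → i ≢ j → ¬ (F.pos (rep α ν) i ≡ F.pos (rep α ν) j))
      one i j (yes e) = most-all 𝓕 (λ ν ne → contradiction e ne)
      one i j (no ne) = most-mono 𝓕 (λ ν h _ → h) (most-¬ 𝓕 (g i j ne))

    pos-inj : ∀ {α} → Most 𝓕 (λ ν → Inj (F.pos (rep α ν))) → ∀ i j → i ≢ j → ¬ E i j α
    pos-inj m i j ne e with most-some 𝓕 (most-∧ 𝓕 m e)
    ... | ν , inj , q = ne (inj i j q)

    good-triple : ∀ {α c₀ c₁ c₂} → Most 𝓕 (λ ν → Inj (F.pos
        (rep α ν))) → Colour-at 0F c₀ α → Colour-at 1F c₁ α → Colour-at 2F c₂ α →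
                  Most 𝓕 (λ ν → ¬ Palette.Bad (P ν) (c₀ ν) (c₁ ν) (c₂ ν))
    good-triple {α} {c₀} {c₁} {c₂} m f₀ f₁ f₂ = most-mono 𝓕
      (λ ν (inj , f₀ , f₁ , f₂) b → proj₂ (F.sim (rep α ν)) _ _ _
        (λ e → case inj 0F 1F e of λ ()) (λ e → case inj 0F 2F e of λ ()) (λ e → case inj 1F 2F e of λ ())
        (subst (λ z → Palette.Bad (P ν) z _ _) (C.faceCol-unique ν {a = rep α ν} f₀ (C.faceCol-generic ν {rep α ν} inj 0F))
          (subst₂ (Palette.Bad (P ν) (c₀ ν)) (C.faceCol-unique ν {a = rep α ν} f₁ (C.faceCol-generic ν {rep α ν} inj 1F))
            (C.faceCol-unique ν {a = rep α ν} f₂ (C.faceCol-generic ν {rep α ν} inj 2F)) b)))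
      (most-∧ 𝓕 m (most-∧ 𝓕 f₀ (most-∧ 𝓕 f₁ f₂)))

    obstruction : Obstruction S
    obstruction = record
      { V = V ; M = M ; r = r ; default = default ; large = large ; principal = principal
      ; E          = E
      ; Apex       = λ i x → Colour-at i (apex x)
      ; Class      = λ i l α → ∃ λ c → Colour-at i c α × Cl c l
      ; E-resp     = λ e m → most-mono 𝓕 (λ ν q → F.ker (proj₁ q) tt tt (proj₂ q)) (most-∧ 𝓕 (rep-cong e) m)
      ; Apex-resp  = λ {i} {x} {α} {β} → colour-resp {i} {apex x} {α} {β}
      ; Class-resp = λ { {i} {l} {α} {β} e (c , f , q) → c , colour-resp {i} {c} {α} {β} e f , q }
      ; E-step     = λ i≢l j≢l st →
            (λ m → most-mono 𝓕 (λ ν q → F.ker (proj₁ q) i≢l j≢l (proj₂ q)) (most-∧ 𝓕 (rep-step st) m))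
          , (λ m → most-mono 𝓕 (λ ν q → F.ker⁻ (proj₁ q) i≢l j≢l (proj₂ q)) (most-∧ 𝓕 (rep-step st) m))
      ; Apex-step  = λ {i} {x} {α} {β} → colour-step {i} {apex x} {α} {β}
      ; Class-step = λ { {i} {l} {α} {β} st (c , f , q) → c , colour-step {i} {c} {α} {β} st f , q }
      ; E-sym      = λ m → most-mono 𝓕 (λ ν → sym) m
      ; E-trans    = λ m m′ → most-mono 𝓕 (λ ν q → trans (proj₁ q) (proj₂ q)) (most-∧ 𝓕 m m′)
      ; Apex-E     = λ {i} {j} {x} {α} → colour-E {i} {j} {apex x} {α}
      ; Class-E    = λ { {i} {j} {l} {α} ne e (c , f , q) → c , colour-E {i} {j} {c} {α} ne e f , q }
      ; Class-func = λ { {i} {l} {l′} {α} (c , f , q) (c′ , f′ , q′) → Cl-func (colour-unique {i} {c} {c′} {α} f f′) q q′ }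
      ; some-generic = proj₁ generic , pos-inj (proj₂ generic)
      ; identify   = λ i j i≢j α → fetch-E i i j α (most-all 𝓕 λ ν → F.act ν (rep α ν) [ i ∣ j ]
          , F.same-sym ν (record
              { ker  = λ p q e → subst₂ (λ y z → F.pos (rep α ν) y ≡ F.pos (rep α ν) z) (F.sub-id ν p) (F.sub-id ν q) e
              ; ker⁻ = λ p q e → subst₂ (λ y z → F.pos (rep α ν) y ≡ F.pos (rep α ν) z) (sym (F.sub-id ν p)) (sym
                  (F.sub-id ν q)) e
              ; lab  = λ θ A x y → cong (F.col ν (rep α ν)) (missing-unique (proj₁ x) (proj₂ x)
                  (λ l q → proj₂ y l (trans (cong (F.pos (rep α ν)) (sym (F.sub-id ν (A l)))) q)))
              })
          , trans (cong (F.pos (rep α ν)) (F.sub-at ν i j))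
              (sym (cong (F.pos (rep α ν)) (F.sub-id ν (i≢j ∘ sym)))))
      ; attach     = λ x α g → let (β , st , m) = fetch-apex 0F x α
                                     (most-mono 𝓕 (λ ν inj → C.recolour ν {rep α ν} inj {0F} {1F} (λ ()) (apex x ν))
                                         (inj-pos g))
                               in β , st , pos-inj (most-mono 𝓕 (λ ν → proj₁) m) , most-mono 𝓕 (λ ν → proj₂) m
      ; Apex-inj   = λ {i} {x} {y} {α} f f′ → apex-inj (colour-unique {i} {apex x} {apex y} {α} f f′)
      ; classify   = λ {x} {y} {α} x≢y g f f′ → let (l , q) = Cl-some {α = α} x≢y (inj-pos g) f f′ in
          l , _ , most-mono 𝓕 (λ ν inj → C.faceCol-generic ν {rep α ν} inj 2F) (inj-pos g) , q
      ; clash      = λ { {α = α} g (c₂ , f₂ , q₂) (c₁ , f₁ , q₁) (c₀ , f₀ , q₀) →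
          Cl-clash (good-triple {α} {c₀} {c₁} {c₂} (inj-pos g) f₀ f₁ f₂) q₂ q₁ q₀ }
      }

-- A nonprincipal ultrafilter: colours that are windows

nth : List ℕ → ℕ → ℕ
nth L.[]       _       = 0
nth (x L.∷ xs) zero    = x
nth (x L.∷ xs) (suc i) = nth xs i

nth-drop : ∀ m xs i → nth (L.drop m xs) i ≡ nth xs (m + i)
nth-drop zero    xs         i = refl
nth-drop (suc m) L.[]       i = refl
nth-drop (suc m) (x L.∷ xs) i = nth-drop m xs i

nth-take : ∀ m xs {i} → i < m → nth (L.take m xs) i ≡ nth xs i
nth-take (suc m) L.[]       _               = refl
nth-take (suc m) (x L.∷ xs) {zero}  _       = refl
nth-take (suc m) (x L.∷ xs) {suc i} (s≤s q) = nth-take m xs q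

interval : ℕ → ℕ → List ℕ
interval t zero    = L.[]
interval t (suc m) = t L.∷ interval (suc t) m

nth-interval : ∀ t m {i} → i < m → nth (interval t m) i ≡ t + i
nth-interval t (suc m) {zero}  _       = sym (ℕ.+-identityʳ t)
nth-interval t (suc m) {suc i} (s≤s q) = trans (nth-interval (suc t) m q) (sym (ℕ.+-suc t i))

module Windows (em : ∀ {a} → ExcludedMiddle a) (k : ℕ) where
  open Classical em
  open Quantifier em

  private
    N n : ℕ
    N = 2 + k
    n = 3 + k

  module _ (len : ℕ) where

    Distinct : List ℕ → Set
    Distinct x = ∀ i j → i < len → j < len → nth x i ≡ nth x j → i ≡ j

    Shift : ℕ → List ℕ → List ℕ → Set
    Shift d x y = ∀ i → i + d < len → nth y i ≡ nth x (i + d)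

    -- Lists with repetitions are adjacent to nothing, because the amount of a shift between them
    -- might be ambiguous.
    Adj : List ℕ → List ℕ → Set
    Adj x y = Distinct x × Distinct y × ∃ λ d → 0 < d × d < n × (Shift d x y ⊎ Shift d y x)

    adj-sym : ∀ {x y} → Adj x y → Adj y x
    adj-sym (dx , dy , d , p , q , inj₁ s) = dy , dx , d , p , q , inj₂ s
    adj-sym (dx , dy , d , p , q , inj₂ s) = dy , dx , d , p , q , inj₁ s

    Clash : List ℕ × Fin n → List ℕ × Fin n → List ℕ × Fin n → Set
    Clash (x , i) (y , j) (z , l) = i ≡ j × j ≡ l × ¬ Adj x y × ¬ Adj x z × ¬ Adj y z

    window : ℕ → List ℕ → List ℕ
    window m y = L.take len (L.drop m y)

    nth-window : ∀ m y {i} → i < len → nth (window m y) i ≡ nth y (m + i)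
    nth-window m y {i} lt = trans (nth-take len (L.drop m y) lt) (nth-drop m y i)

    window-distinct : ∀ b y → (∀ i j → i < b + len → j < b + len → nth y i ≡ nth y j → i ≡ j) →
                      ∀ m → m ≤ b → Distinct (window m y)
    window-distinct b y dist m m≤b i j p q e = ℕ.+-cancelˡ-≡ m i j
      (dist (m + i) (m + j) (ℕ.+-mono-≤-< m≤b p) (ℕ.+-mono-≤-< m≤b q)
        (trans (sym (nth-window m y p)) (trans e (nth-window m y q))))

    window-shift : ∀ y m d → Shift d (window m y) (window (m + d) y)
    window-shift y m d i lt = trans (nth-window (m + d) y (ℕ.≤-<-trans (ℕ.m≤m+n i d) lt))
      (trans (cong (nth y) (trans (ℕ.+-assoc m d i) (cong (m +_) (ℕ.+-comm d i)))) (sym (nth-window m y lt)))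

    window-adj : ∀ b y → b < n → (∀ i j → i < b + len → j < b + len → nth y i ≡ nth y j → i ≡ j) →
                 ∀ {m m′} → m ≤ b → m′ ≤ b → m ≢ m′ → Adj (window m y) (window m′ y)
    window-adj b y b<n dist {m} {m′} p p′ ne with ℕ.<-cmp m m′
    ... | tri≈ _ e _ = contradiction e ne
    ... | tri< lt _ _ = window-distinct b y dist m p , window-distinct b y dist m′ p′ , m′ ∸ m , ℕ.m<n⇒0<n∸m lt
        , ℕ.≤-<-trans (ℕ.≤-trans (ℕ.m∸n≤m m′ m) p′) b<n
        , inj₁ (subst (λ z → Shift (m′ ∸ m) (window m y) (window z y)) (ℕ.m+[n∸m]≡n (ℕ.<⇒≤ lt)) (window-shift y m (m′ ∸ m)))
    ... | tri> _ _ gt = window-distinct b y dist m p , window-distinct b y dist m′ p′ , m ∸ m′ , ℕ.m<n⇒0<n∸m gt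
        , ℕ.≤-<-trans (ℕ.≤-trans (ℕ.m∸n≤m m m′) p) b<n
        , inj₂ (subst (λ z → Shift (m ∸ m′) (window m′ y) (window z y)) (ℕ.m+[n∸m]≡n (ℕ.<⇒≤ gt)) (window-shift y m′
            (m ∸ m′)))

    palette : Palette k
    palette = record
      { Colour      = List ℕ × Fin n
      ; Bad         = Clash
      ; bad-swap₁   = λ {x} {y} (p , q , a , b , c) → sym p , trans p q , (λ h → a (adj-sym {proj₁ y} {proj₁ x} h)) , c , b
      ; bad-swap₂   = λ {x} {y} {z} (p , q , a , b , c) → trans p q , sym q , b , a , (λ h → c
          (adj-sym {proj₁ z} {proj₁ y} h))
      ; idx         = λ c → just (proj₂ c)
      ; bad-idx     = λ (p , _) → cong just p
      -- The windows of `0, 1, 2, …` that start at different places below `n` have distinct entries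
      -- and are shifts of each other, so they are adjacent.
      ; filler      = λ i m → window (toℕ m) (interval 0 (N + len)) , i
      ; filler-idx  = λ i m → refl
      ; filler-good = λ { i {l} {m} l≢m _ _ (_ , _ , na , _) → na
          (window-adj N (interval 0 (N + len)) ℕ.≤-refl
            (λ u v p q e → trans (sym (nth-interval 0 (N + len) p)) (trans e (nth-interval 0 (N + len) q)))
            (ℕ.≤-pred (Fin.toℕ<n l)) (ℕ.≤-pred (Fin.toℕ<n m)) (λ e → l≢m (Fin.toℕ-injective e))) }
      }

  list-code : List ℕ → ℕ
  list-code L.[]       = 0
  list-code (x L.∷ xs) = suc (pair x (list-code xs))

  list-code-inj : ∀ {xs ys} → list-code xs ≡ list-code ys → xs ≡ ys
  list-code-inj {L.[]}     {L.[]}     e = refl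
  list-code-inj {x L.∷ xs} {y L.∷ ys} e =
    let (p , q) = pair-inj (ℕ.suc-injective e) in cong₂ L._∷_ p (list-code-inj q)

  module Iterated (𝓓 : Uf ℕ) (nonprincipal : ∀ x → Most 𝓓 (_≢ x)) where

    -- The `d`-fold tensor power of `𝓓`. Nonprincipality makes the entries of a typical list
    -- distinct.
    gen : ℕ → Uf (List ℕ)
    gen zero    = pure L.[]
    gen (suc d) = bind 𝓓 λ x → mapᵘ (x L.∷_) (gen d)

    gen-drop : ∀ m d → mapᵘ (L.drop m) (gen (m + d)) ≋ gen d
    gen-drop zero    d X = refl
    gen-drop (suc m) d X = trans (mem-const 𝓓 _) (gen-drop m d X)

    gen-take : ∀ d e → mapᵘ (L.take d) (gen (d + e)) ≋ gen d
    gen-take zero    e X = mem-const (gen e) (X L.[])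
    gen-take (suc d) e X = mem-cong 𝓓 _ _ (λ x → gen-take d e (X ∘ (x L.∷_)))

    -- Dropping initial entries and cutting off final ones both discard factors of the tensor power,
    -- and the remaining factors are copies of `𝓓` in the same order.
    gen-window : ∀ len b m → m ≤ b → mapᵘ (window len m) (gen (b + len)) ≋ gen len
    gen-window len b m m≤b X = trans
      (cong (λ d → mem (gen d) (X ∘ window len m)) b+len≡)
      (trans (gen-drop m (len + (b ∸ m)) (X ∘ L.take len)) (gen-take len (b ∸ m) X))
      where
      b+len≡ : b + len ≡ m + (len + (b ∸ m))
      b+len≡ = trans (cong (_+ len) (sym (ℕ.m+[n∸m]≡n m≤b)))
        (trans (ℕ.+-assoc m (b ∸ m) len) (cong (m +_) (ℕ.+-comm (b ∸ m) len)))

    gen-avoids : ∀ d x → Most (gen d) (λ y → ∀ i → i < d → nth y i ≢ x)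
    gen-avoids zero    x = most-all (gen zero) {P = λ y → ∀ i → i < 0 → nth y i ≢ x} (λ _ i ())
    gen-avoids (suc d) x = most-bind 𝓓 (λ z → mapᵘ (z L.∷_) (gen d)) {P = λ y → ∀ i → i < suc d → nth y i ≢ x}
      (most-mono 𝓓 (λ z z≢x → most-mono (gen d)
        (λ { y f zero _ → z≢x ; y f (suc i) (s≤s p) → f i p }) (gen-avoids d x)) (nonprincipal x))

    gen-distinct : ∀ d → Most (gen d) (λ y → ∀ i j → i < d → j < d → nth y i ≡ nth y j → i ≡ j)
    gen-distinct zero    = most-all (gen zero)
      {P = λ y → ∀ i j → i < 0 → j < 0 → nth y i ≡ nth y j → i ≡ j} (λ _ i j ())
    gen-distinct (suc d) = most-bind 𝓓 (λ x → mapᵘ (x L.∷_) (gen d))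
      {P = λ y → ∀ i j → i < suc d → j < suc d → nth y i ≡ nth y j → i ≡ j} (most-all 𝓓 λ x → most-mono (gen d)
      (λ { y (av , dis) zero zero _ _ e → refl
         ; y (av , dis) zero (suc j) _ (s≤s q) e → contradiction (sym e) (av j q)
         ; y (av , dis) (suc i) zero (s≤s p) _ e → contradiction e (av i p)
         ; y (av , dis) (suc i) (suc j) (s≤s p) (s≤s q) e → cong suc (dis i j p q e) })
      (most-∧ (gen d) (gen-avoids d x) (gen-distinct d)))

-- Numerical codes of tuples and simplices

unpair-sum : ∀ k → proj₁ (unpair k) + proj₂ (unpair k) ≤ k
unpair-sum zero = z≤n
unpair-sum (suc k) with unpair k | unpair-sum k
... | zero  , b | le = ℕ.≤-trans (ℕ.≤-reflexive (ℕ.+-identityʳ (suc b))) (s≤s le)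
... | suc a , b | le = ℕ.≤-trans (ℕ.≤-reflexive (ℕ.+-suc a b)) (ℕ.m≤n⇒m≤1+n le)

pair-≥ : ∀ a b → a + b ≤ pair a b
pair-≥ a b = subst (λ q → proj₁ q + proj₂ q ≤ pair a b) (unpair-pair a b) (unpair-sum (pair a b))

decode : ∀ r → ℕ → Fin r → ℕ
decode (suc r) t zero    = proj₁ (unpair t)
decode (suc r) t (suc l) = decode r (proj₂ (unpair t)) l

encode : ∀ r → (Fin r → ℕ) → ℕ
encode zero    f = 0
encode (suc r) f = pair (f zero) (encode r (f ∘ suc))

decode-encode : ∀ r f l → decode r (encode r f) l ≡ f l
decode-encode (suc r) f zero    = cong proj₁ (unpair-pair _ _)
decode-encode (suc r) f (suc l) = trans (cong (λ q → decode r (proj₂ q) l) (unpair-pair _ _)) (decode-encode r (f ∘ suc) l)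

module Codes (em : ∀ {a} → ExcludedMiddle a) (k : ℕ) (P : Palette k)
             (code : Palette.Colour P → ℕ) (code-inj : ∀ {c d} → code c ≡ code d → c ≡ d) where
  open Classical em
  open Frame em k P

  simp-code : Simp → ℕ
  simp-code K = encode n (code ∘ proj₁ K)

  simp-code-inj : ∀ K K′ → simp-code K ≡ simp-code K′ → ∀ l → proj₁ K l ≡ proj₁ K′ l
  simp-code-inj K K′ e l = code-inj (trans (sym (decode-encode n (code ∘ proj₁ K) l))
    (trans (cong (λ t → decode n t l) e) (decode-encode n (code ∘ proj₁ K′) l)))

  simp-of : ℕ → Simp
  simp-of t with em {P = ∃ λ K → simp-code K ≡ t}
  ... | yes (K , _) = K
  ... | no _        = proj₁ (extend₁ zero (filler zero zero))

  simp-of-code : ∀ K l → proj₁ (simp-of (simp-code K)) l ≡ proj₁ K l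
  simp-of-code K l with em {P = ∃ λ K′ → simp-code K′ ≡ simp-code K}
  ... | yes (K′ , e) = simp-code-inj K′ K e l
  ... | no none      = contradiction (K , refl) none

-- Points are pairs of a stage and a real. The real codes the reals of the
-- parents and the set of simplices the point is to meet; reals are ordered
-- lexicographically, so that no choice of a linear order is needed.
module Reals (em : ∀ {a} → ExcludedMiddle a) where
  open Classical em

  Lex : (ℕ → Bool) → (ℕ → Bool) → Set
  Lex r s = ∃ λ j → (∀ i → i < j → r i ≡ s i) × r j ≡ false × s j ≡ true

  lex-irr : ∀ {r s} → (∀ i → r i ≡ s i) → ¬ Lex r s
  lex-irr e (j , _ , p , q) = true≢false (trans (e j) q) p

  lex-trans : ∀ {r s t} → Lex r s → Lex s t → Lex r t
  lex-trans (j , e , p , q) (j′ , e′ , p′ , q′) with ℕ.<-cmp j j′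
  ... | tri< lt _ _ = j , (λ i i<j → trans (e i i<j) (e′ i (ℕ.<-trans i<j lt))) , p , trans (sym (e′ j lt)) q
  ... | tri≈ _ refl _ = ⊥-elim (true≢false q p′)
  ... | tri> _ _ gt = j′ , (λ i i<j′ → trans (e i (ℕ.<-trans i<j′ gt)) (e′ i i<j′)) , trans (e j′ gt) p′ , q′

  lex-resp : ∀ {r r′ s s′} → (∀ i → r i ≡ r′ i) → (∀ i → s i ≡ s′ i) → Lex r s → Lex r′ s′
  lex-resp er es (j , e , p , q) = j , (λ i lt → trans (sym (er i)) (trans (e i lt) (es i))) , trans (sym
      (er j)) p , trans (sym (es j)) q

  lex-tri : ∀ r s → Lex r s ⊎ (∀ i → r i ≡ s i) ⊎ Lex s r
  lex-tri r s with em {P = ∃ λ i → r i ≢ s i}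
  ... | no none = inj₂ (inj₁ (λ i → stable λ ne → none (i , ne)))
  ... | yes ex with least (λ i → r i ≢ s i) ex
  ...   | j , ne , min with r j in er | s j in es
  ...     | true  | true  = contradiction refl ne
  ...     | false | false = contradiction refl ne
  ...     | false | true  = inj₁ (j , (λ i lt → stable λ q → ℕ.<⇒≱ lt (min i q)) , er , es)
  ...     | true  | false = inj₂ (inj₂ (j , (λ i lt → stable λ q → ℕ.<⇒≱ lt (min i (q ∘ sym))) , es , er))

  Stage : Set
  Stage = ℕ × (ℕ → Bool)

  _<ˢ_ _≈ˢ_ : Stage → Stage → Set
  (t , r) <ˢ (t′ , r′) = t < t′ ⊎ (t ≡ t′ × Lex r r′)
  (t , r) ≈ˢ (t′ , r′) = t ≡ t′ × (∀ i → r i ≡ r′ i)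

  stage-order : StrictOrder
  stage-order = record
    { Pt      = Stage
    ; _≈ᵖ_    = _≈ˢ_
    ; ≈-refl  = refl , λ _ → refl
    ; ≈-sym   = λ (p , e) → sym p , λ i → sym (e i)
    ; ≈-trans = λ (p , e) (q , f) → trans p q , λ i → trans (e i) (f i)
    ; _<ᵖ_    = _<ˢ_
    ; <-irr   = irr
    ; <-trans = tr
    ; <-resp  = resp
    ; <-tri   = tri
    ; base    = 0 , λ _ → false
    ; above   = λ (t , r) → (suc t , r) , inj₁ ℕ.≤-refl
    }
    where
    irr : ∀ {u v} → u ≈ˢ v → ¬ (u <ˢ v)
    irr (refl , e) (inj₁ lt)      = ℕ.<-irrefl refl lt
    irr (refl , e) (inj₂ (_ , l)) = lex-irr e l
    tr : ∀ {u v w} → u <ˢ v → v <ˢ w → u <ˢ w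
    tr (inj₁ p)          (inj₁ q)          = inj₁ (ℕ.<-trans p q)
    tr (inj₁ p)          (inj₂ (refl , _)) = inj₁ p
    tr (inj₂ (refl , _)) (inj₁ q)          = inj₁ q
    tr (inj₂ (refl , p)) (inj₂ (refl , q)) = inj₂ (refl , lex-trans p q)
    resp : ∀ {u u′ v v′} → u ≈ˢ u′ → v ≈ˢ v′ → u <ˢ v → u′ <ˢ v′
    resp (refl , e) (refl , f) (inj₁ p)       = inj₁ p
    resp (refl , e) (refl , f) (inj₂ (p , l)) = inj₂ (p , lex-resp e f l)
    tri : ∀ u v → (u <ˢ v) ⊎ (u ≈ˢ v) ⊎ (v <ˢ u)
    tri (t , r) (t′ , r′) with ℕ.<-cmp t t′
    ... | tri< lt _ _ = inj₁ (inj₁ lt)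
    ... | tri> _ _ gt = inj₂ (inj₂ (inj₁ gt))
    ... | tri≈ _ refl _ with lex-tri r r′
    ...   | inj₁ l        = inj₁ (inj₂ (refl , l))
    ...   | inj₂ (inj₁ e) = inj₂ (inj₁ (refl , e))
    ...   | inj₂ (inj₂ l) = inj₂ (inj₂ (inj₂ (refl , l)))

  slice : ℕ → (ℕ → Bool) → ℕ → Bool
  slice l r j = r (pair l j)

  glue : (ℕ → ℕ → Bool) → ℕ → Bool
  glue f t = f (proj₁ (unpair t)) (proj₂ (unpair t))

  slice-glue : ∀ f l j → slice l (glue f) j ≡ f l j
  slice-glue f l j = cong (λ q → f (proj₁ q) (proj₂ q)) (unpair-pair l j)

module RealScaffold (em : ∀ {a} → ExcludedMiddle a) (k : ℕ) (P : Palette k)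
                    (code : Palette.Colour P → ℕ) (code-inj : ∀ {c d} → code c ≡ code d → c ≡ d)
                    {Ω : Set} (𝓦 : Uf Ω) (flex : Fin (2 + k) → Fin (3 + k) → Ω → Palette.Colour P)
                    (flex-idx : ∀ m i ω → Palette.idx P (flex m i ω) ≡ just i)
                    (flex-law : ∀ i m m′ → mapᵘ (flex m i) 𝓦 ≋ mapᵘ (flex m′ i) 𝓦)
                    (flex-apart : ∀ i → Quantifier.Most em 𝓦 (λ ω → ∀ m m′ c → m ≢ m′ →
                                  ¬ Palette.Bad P c (flex m i ω) (flex m′ i ω))) where
  open Classical em
  open Quantifier em
  open Frame em k P
  open Codes em k P code code-inj
  open Reals em
  open StrictOrder stage-order
  open Scaffolds em k P
  open Models em k P

  parent : Stage → Fin N → Stage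
  parent (t , r) l = decode N (proj₂ (unpair t)) l , slice (suc (toℕ l)) r

  Wanted : Stage → Colour → ℕ → Set
  Wanted (t , r) c j = slice 0 r j ≡ true × proj₁ (simp-of j) zero ≡ c

  -- The least wanted code makes the section a function of the real up to pointwise equality.
  section-by : ∀ u c → Dec (∃ (Wanted u c)) → Simp
  section-by u c (yes w) = simp-of (proj₁ (least (Wanted u c) w))
  section-by u c (no _)  = proj₁ (extend₁ zero c)

  section-zero : ∀ u c D → proj₁ (section-by u c D) zero ≡ c
  section-zero u c (yes w) = proj₂ (proj₁ (proj₂ (least (Wanted u c) w)))
  section-zero u c (no _)  = proj₂ (extend₁ zero c)

  section-resp : ∀ {u u′} → u ≈ˢ u′ → ∀ c D D′ → section-by u c D ≡ section-by u′ c D′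
  section-resp {u} {u′} (_ , e) c = go
    where
    to : ∀ j → Wanted u c j → Wanted u′ c j
    to j (p , q) = trans (sym (e _)) p , q
    from : ∀ j → Wanted u′ c j → Wanted u c j
    from j (p , q) = trans (e _) p , q
    go : ∀ D D′ → section-by u c D ≡ section-by u′ c D′
    go (yes w) (yes w′) = cong simp-of (least-unique to from w w′)
    go (yes (j , w)) (no ¬w) = contradiction (j , to j w) ¬w
    go (no ¬w) (yes (j , w)) = contradiction (j , from j w) ¬w
    go (no _) (no _) = refl

  scaffold : Scaffold
  scaffold = record
    { order      = stage-order
    ; rank       = proj₁
    ; Par        = λ u a → Desc a × proj₁ (a zero) < proj₁ u × a ≈ᵗ parent u
    ; par-desc   = proj₁
    ; par-below  = λ p → inj₁ (proj₁ (proj₂ p))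
    ; par-rank   = λ p → proj₁ (proj₂ p)
    ; par-unique = λ (_ , _ , p) (_ , _ , q) i → ≈-trans (p i) (≈-sym (q i))
    ; par-resp   = λ { {u} {u′} {a} {a′} (refl , e) f (d , lt , p) →
        (λ i j q → <-resp (f j) (f i) (d i j q)) , subst (_< proj₁ u) (proj₁ (f zero)) lt
        , λ i → ≈-trans (≈-sym (f i)) (≈-trans (p i) (refl , λ j → e _)) }
    ; sec        = λ u c → section-by u c em
    ; sec-zero   = λ u c → section-zero u c em
    ; sec-resp   = λ {u} {u′} e c → section-resp {u} {u′} e c em em
    ; Ω          = Ω
    ; 𝓦          = 𝓦
    ; flex       = λ _ → flex
    ; flex-idx   = λ _ → flex-idx
    ; flex-cong  = λ _ _ _ _ → refl
    ; flex-law   = λ _ → flex-law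
    }

  open Labelling scaffold

  -- The label may be nonprincipal, so no single simplex can be aimed at. The whole set `W` is
  -- written into the real, and every colour of the base selects its own member of it.
  realizable : ∀ {a} → Desc a → ∀ {W} → Ext W →
               Most (label a) (λ c → ∃ λ K → proj₁ K zero ≡ c × W K ≡ true) →
               ∃ λ b → Scaffold.Par scaffold b a × Most (label a) (λ c → W (section-by b c em) ≡ true)
  realizable {a} da {W} ext-W m = b , (da , below , parents) , most-mono
      (label a) {P = λ c → ∃ λ K → proj₁ K zero ≡ c × W K ≡ true} (λ c w → meets c w em) m
    where
    stages : ℕ
    stages = encode N (proj₁ ∘ a)
    real : ℕ → ℕ → Bool
    real zero    j = ⌊ (∃ λ K → simp-code K ≡ j × W K ≡ true) ⌋
    real (suc l) j with l ℕ.<? N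
    ... | yes lt = proj₂ (a (fromℕ< lt)) j
    ... | no _   = false
    b : Stage
    -- The first component only lifts the stage above that of the greatest parent; the second one
    -- codes the stages of all parents.
    b = pair (suc (proj₁ (a zero))) stages , glue real
    below : proj₁ (a zero) < proj₁ b
    below = ℕ.≤-trans (ℕ.m≤m+n _ stages) (pair-≥ (suc (proj₁ (a zero))) stages)
    real-at : ∀ l j → real (suc (toℕ l)) j ≡ proj₂ (a l) j
    real-at l j with toℕ l ℕ.<? N
    ... | yes lt = cong (λ i → proj₂ (a i) j) (Fin.fromℕ<-toℕ l lt)
    ... | no ¬lt = contradiction (Fin.toℕ<n l) ¬lt
    parents : a ≈ᵗ parent b
    parents l = sym (trans (cong (λ q → decode N (proj₂ q) l) (unpair-pair _ stages)) (decode-encode N (proj₁ ∘ a) l))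
              , λ j → sym (trans (slice-glue real (suc (toℕ l)) j) (real-at l j))
    hit : ∀ j → slice 0 (glue real) j ≡ true → W (simp-of j) ≡ true
    hit j h with ⌊⌋-elim (trans (sym (slice-glue real 0 j)) h)
    ... | K , refl , WK = trans (ext-W (simp-of-code K)) WK
    meets : ∀ c → (∃ λ K → proj₁ K zero ≡ c × W K ≡ true) → ∀ D → W (section-by b c D) ≡ true
    meets c _ (yes w) = hit _ (proj₁ (proj₁ (proj₂ (least (Wanted b c) w))))
    meets c (K , e , WK) (no none) = contradiction
      (simp-code K , trans (slice-glue real 0 _) (⌊⌋-intro (K , refl , WK)) , trans (simp-of-code K zero) e) none

  real-model : Model
  real-model = model
    (λ {x} dx np → most-all (label (x ∘ suc)) {P = λ c → Most 𝓦 (λ ω → ∀ m m′ → m ≢ m′ → ¬ Bad c (flex m (index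
        (x zero)) ω) (flex m′ (index (x zero)) ω))}
      λ c → most-mono 𝓦 (λ ω f m m′ ne → f m m′ c ne) (flex-apart (index (x zero))))
    (λ {x} dx np → most-mono 𝓦 (λ ω f m m′ m″ _ _ ne → f m′ m″ (flex m (index (x zero)) ω) ne) (flex-apart (index
        (x zero))))
    realizable

-- Shift classes of sequences and offsets modulo the dimension

module Offsets (em : ∀ {a} → ExcludedMiddle a) (k : ℕ) (𝓓 : Uf ℕ)
               (nonprincipal : ∀ x → Quantifier.Most em 𝓓 (_≢ x))
               {T : Set} (code : T → ℕ) (code-inj : ∀ {s t} → code s ≡ code t → s ≡ t)
               (seq : T → ℕ → List ℕ) where
  open Classical em
  open Quantifier em
  open Windows em k using (Distinct; Adj)
  private
    N n : ℕ
    N = 2 + k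
    n = 3 + k

  -- c and c′ are windows of one sequence, up to boundedly many entries at
  -- either end: the entry number a of c is the entry number b of c′.
  Off : (ℕ → List ℕ) → (ℕ → List ℕ) → ℕ → ℕ → Set
  Off c c′ a b = ∃ λ w → Most 𝓓 (λ m → ∀ i → i + w < m → nth (c m) (i + a) ≡ nth (c′ m) (i + b))

  Dist : (ℕ → List ℕ) → Set
  Dist c = Most 𝓓 (λ m → Distinct m (c m))

  most-beyond : ∀ w → Most 𝓓 (w <_)
  most-beyond w = most-mono 𝓓 (λ m f → ℕ.≰⇒> λ m≤w → f (fromℕ< (s≤s m≤w)) (sym (Fin.toℕ-fromℕ< (s≤s m≤w))))
    (most-all-fin 𝓓 {r = suc w} {P = λ i m → m ≢ toℕ i} λ i → nonprincipal (toℕ i))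

  off-refl : ∀ {c c′} → Most 𝓓 (λ m → c m ≡ c′ m) → Off c c′ 0 0
  off-refl e = 0 , most-mono 𝓓 (λ m q i _ → cong (λ x → nth x (i + 0)) q) e

  off-sym : ∀ {c c′ a b} → Off c c′ a b → Off c′ c b a
  off-sym (w , m) = w , most-mono 𝓓 (λ m f i lt → sym (f i lt)) m

  off-trans : ∀ {c c′ c″ a b a′ b′} → Off c c′ a b → Off c′ c″ a′ b′ → Off c c″ (a + a′) (b′ + b)
  off-trans {c} {c′} {c″} {a} {b} {a′} {b′} (w , m) (w′ , m′) = w + a′ + (w′ + b) , most-mono 𝓓
      (λ len (f , g) i lt → trans (cong (nth (c len)) (e₁ i)) (trans (f (i + a′) (bound₁ i lt))
        (trans (cong (nth (c′ len)) (e₂ i)) (trans (g (i + b) (bound₂ i lt)) (cong (nth (c″ len)) (e₃ i))))))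
      (most-∧ 𝓓 m m′)
    where
    open +-*-Solver
    e₁ : ∀ i → i + (a + a′) ≡ i + a′ + a
    e₁ = solve 3 (λ a a′ i → i :+ (a :+ a′) := i :+ a′ :+ a) refl a a′
    e₂ : ∀ i → i + a′ + b ≡ i + b + a′
    e₂ = solve 3 (λ a′ b i → i :+ a′ :+ b := i :+ b :+ a′) refl a′ b
    e₃ : ∀ i → i + b + b′ ≡ i + (b′ + b)
    e₃ = solve 3 (λ b b′ i → i :+ b :+ b′ := i :+ (b′ :+ b)) refl b b′
    bound₁ : ∀ i {len} → i + (w + a′ + (w′ + b)) < len → i + a′ + w < len
    bound₁ i lt = ℕ.≤-<-trans (ℕ.≤-trans (ℕ.m≤m+n (i + a′ + w) (w′ + b))
      (ℕ.≤-reflexive (solve 5 (λ i a′ w w′ b → i :+ a′ :+ w :+ (w′ :+ b) := i :+ (w :+ a′ :+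
          (w′ :+ b))) refl i a′ w w′ b))) lt
    bound₂ : ∀ i {len} → i + (w + a′ + (w′ + b)) < len → i + b + w′ < len
    bound₂ i lt = ℕ.≤-<-trans (ℕ.≤-trans (ℕ.m≤m+n (i + b + w′) (w + a′))
      (ℕ.≤-reflexive (solve 5 (λ i a′ w w′ b → i :+ b :+ w′ :+ (w :+ a′) := i :+ (w :+ a′ :+
          (w′ :+ b))) refl i a′ w w′ b))) lt

  -- Distinct entries exclude proper shifts of a sequence onto itself, which makes offsets well
  -- defined. A length beyond `w + (a + b)` ensures that the compared entries exist.
  off-self : ∀ {c a b} → Dist c → Off c c a b → a ≡ b
  off-self {c} {a} {b} d (w , m) with most-some 𝓓 (most-∧ 𝓓 (most-∧ 𝓓 d m) (most-beyond (w + (a + b))))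
  ... | len , (dist , f) , lt = dist a b
        (ℕ.≤-<-trans (ℕ.≤-trans (ℕ.m≤m+n a b) (ℕ.m≤n+m (a + b) w)) lt)
        (ℕ.≤-<-trans (ℕ.≤-trans (ℕ.m≤n+m b a) (ℕ.m≤n+m (a + b) w)) lt)
        (f 0 (ℕ.≤-<-trans (ℕ.m≤m+n w (a + b)) lt))

  Reach : T → (ℕ → List ℕ) → Set
  Reach t c = ∃ λ a → ∃ λ b → Off (seq t) c a b

  First : T → (ℕ → List ℕ) → Set
  First t c = Reach t c × (∀ t′ → Reach t′ c → code t ≤ code t′)

  -- As `N` is -1 modulo `n`, this is `a − b` modulo `n`, written without subtraction.
  residue : ℕ → ℕ → Fin n
  residue a b = fromℕ< (m%n<n (a + b * N) n)

  -- The offset is measured from the least coded sequence of the shift class. Sequences with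
  -- repetitions have no definite offset and get `zero`; this is harmless, as they have no
  -- neighbours.
  Res : (ℕ → List ℕ) → Fin n → Set
  Res c ρ = (Dist c × ∃ λ t → First t c × ∃ λ a → ∃ λ b → Off (seq t) c a b × ρ ≡ residue a b)
          ⊎ (¬ Dist c × ρ ≡ zero)

  res-some : ∀ t → ∃ (Res (seq t))
  res-some t with em {P = Dist (seq t)}
  ... | no ¬d = zero , inj₂ (¬d , refl)
  ... | yes d with least (λ j → ∃ λ s → code s ≡ j × Reach s (seq t))
                    (code t , t , refl , 0 , 0 , off-refl {seq t} {seq t} (most-all 𝓓 (λ _ → refl)))
  ...   | j , (s , refl , a , b , o) , min =
          residue a b , inj₁ (d , s , ((a , b , o) , λ t′ r → min (code t′) (t′ , refl , r)) , a , b , o , refl)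

  -- Sequences in one shift class are reached by the same trees, so their first trees coincide.
  -- Going around through this common origin is a shift of `c′` onto itself, to which `off-self`
  -- applies.
  off-first : ∀ {c c′ t t′ a b a′ b′ x y} → Dist c′ → First t c → First t′ c′ → Off c c′ x y →
              Off (seq t) c a b → Off (seq t′) c′ a′ b′ → y + b + a′ ≡ b′ + (a + x)
  off-first {c} {c′} {t} {t′} {a} {b} {a′} {b′} {x} {y} d (r , min) (r′ , min′) s o o′ =
      off-self {c′} d (off-trans {c′} {seq t} {c′} {y + b} {a + x} {a′} {b′}
        (off-sym {seq t} {c′} {a + x} {y + b} (off-trans {seq t} {c} {c′} {a} {b} {x} {y} o s))
        (subst (λ z → Off (seq z) c′ a′ b′) (sym t≡t′) o′))
    where
    reach : Reach t c′
    reach = _ , _ , off-trans {seq t} {c} {c′} {a} {b} {x} {y} o s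
    reach′ : Reach t′ c
    reach′ = _ , _ , off-trans {seq t′} {c′} {c} {a′} {b′} {y} {x} o′ (off-sym {c} {c′} {x} {y} s)
    t≡t′ : t ≡ t′
    t≡t′ = code-inj (ℕ.≤-antisym (min t′ reach′) (min′ t reach))

  residue-cong : ∀ {a b a′ b′} → b + a′ ≡ b′ + a → residue a b ≡ residue a′ b′
  residue-cong {a} {b} {a′} {b′} e = Fin.toℕ-injective (trans (Fin.toℕ-fromℕ< _) (trans mod (sym (Fin.toℕ-fromℕ< _))))
    where
    open +-*-Solver
    shifted : a + b * N + b′ * n ≡ a′ + b′ * N + b * n
    shifted = trans (solve 4 (λ a b b′ N → a :+ b :* N :+ b′ :* (con 1 :+ N) := (b′ :+ a) :+
        (b :* N :+ b′ :* N)) refl a b b′ N)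
      (trans (cong (_+ (b * N + b′ * N)) (sym e))
        (solve 4 (λ a′ b b′ N → (b :+ a′) :+ (b :* N :+ b′ :* N) := a′ :+ b′ :* N :+ b :* (con 1 :+ N)) refl a′ b b′ N))
    mod : (a + b * N) % n ≡ (a′ + b′ * N) % n
    mod = trans (sym ([m+kn]%n≡m%n (a + b * N) b′ n)) (trans (cong (_% n) shifted) ([m+kn]%n≡m%n (a′ + b′ * N) b n))

  -- Equal residues would make `n` divide `d`, although `0 < d < n`.
  residue-shift : ∀ {a b a′ b′ d} → 0 < d → d < n → b + a′ ≡ b′ + (a + d) → residue a b ≢ residue a′ b′
  residue-shift {a} {b} {a′} {b′} {d} d>0 d<n e same = ℕ.<⇒≱ d<n (∣⇒≤ ⦃ >-nonZero d>0 ⦄ (∣m+n∣m⇒∣n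
      {m = (x / n) * n} (divides ((x + d) / n) (ℕ.+-cancelˡ-≡ (x % n) _ _ total)) (divides (x / n) refl)))
    where
    open +-*-Solver
    x = a + b * N
    x′ = a′ + b′ * N
    mod : x % n ≡ x′ % n
    mod = trans (sym (Fin.toℕ-fromℕ< _)) (trans (cong toℕ same) (Fin.toℕ-fromℕ< _))
    shifted : (x + d) + b′ * n ≡ x′ + b * n
    shifted = trans (solve 5 (λ a b b′ d N → (a :+ b :* N :+ d) :+ b′ :* (con 1 :+ N) := (b′ :+ (a :+ d)) :+
        (b :* N :+ b′ :* N)) refl a b b′ d N)
      (trans (cong (_+ (b * N + b′ * N)) (sym e))
        (solve 4 (λ a′ b b′ N → (b :+ a′) :+ (b :* N :+ b′ :* N) := a′ :+ b′ :* N :+ b :* (con 1 :+ N)) refl a′ b b′ N))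
    mod-d : (x + d) % n ≡ x % n
    mod-d = trans (sym ([m+kn]%n≡m%n (x + d) b′ n)) (trans (cong (_% n) shifted) (trans ([m+kn]%n≡m%n x′ b n) (sym mod)))
    total : x % n + ((x / n) * n + d) ≡ x % n + ((x + d) / n) * n
    total = trans (sym (ℕ.+-assoc (x % n) _ d)) (trans (cong (_+ d) (sym (m≡m%n+[m/n]*n x n)))
      (trans (m≡m%n+[m/n]*n (x + d) n) (cong (_+ ((x + d) / n) * n) mod-d)))

  res-func : ∀ {c c′ ρ ρ′} → Most 𝓓 (λ m → c m ≡ c′ m) → Res c ρ → Res c′ ρ′ → ρ ≡ ρ′
  res-func {c} {c′} e (inj₁ (d , t , f , a , b , o , refl)) (inj₁ (d′ , t′ , f′ , a′ , b′ , o′ , refl)) =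
    residue-cong {a} {b} {a′} {b′} (trans (off-first {c} {c′} {t} {t′} {a} {b} {a′} {b′} {0} {0} d′ f f′
        (off-refl {c} {c′} e) o o′)
      (cong (b′ +_) (ℕ.+-identityʳ a)))
  res-func e (inj₂ (_ , refl)) (inj₂ (_ , refl)) = refl
  res-func e (inj₁ (d , _)) (inj₂ (¬d , _)) =
    contradiction (most-mono 𝓓 (λ m (q , p) → subst (Distinct m) q p) (most-∧ 𝓓 e d)) ¬d
  res-func e (inj₂ (¬d , _)) (inj₁ (d , _)) =
    contradiction (most-mono 𝓓 (λ m (q , p) → subst (Distinct m) (sym q) p) (most-∧ 𝓓 e d)) ¬d

  Directed : (ℕ → List ℕ) → (ℕ → List ℕ) → Set
  Directed c c′ = ∃ λ d → 0 < d × d < n × (Off c c′ d 0 ⊎ Off c c′ 0 d)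

  -- The amount and direction of the shift vary with the length, but have finitely many values, so
  -- both are constant on a large set.
  directed : ∀ {c c′} → Most 𝓓 (λ m → Adj m (c m) (c′ m)) → Directed c c′
  directed {c} {c′} adj with most-fin 𝓓 {r = n} {P = λ i m → 0 < toℕ i × (Windows.Shift em k m (toℕ i) (c m)
      (c′ m) ⊎ Windows.Shift em k m (toℕ i) (c′ m) (c m))}
      (most-mono 𝓓 (λ m (_ , _ , d , p , q , s) → fromℕ< q , subst (0 <_) (sym (Fin.toℕ-fromℕ< q)) p
        , subst (λ d → Windows.Shift em k m d (c m) (c′ m) ⊎ Windows.Shift em k m d (c′ m) (c m)) (sym
            (Fin.toℕ-fromℕ< q)) s) adj)
  ... | i , mi with most-⊎ 𝓓 (most-mono 𝓓 (λ m → proj₂) mi)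
  ...   | inj₁ s = toℕ i , proj₁ (proj₂ (most-some 𝓓 mi)) , Fin.toℕ<n i , inj₁ (toℕ i , most-mono 𝓓
            (λ m f j lt → trans (sym (f j lt)) (cong (nth (c′ m)) (sym (ℕ.+-identityʳ j)))) s)
  ...   | inj₂ s = toℕ i , proj₁ (proj₂ (most-some 𝓓 mi)) , Fin.toℕ<n i , inj₂ (toℕ i , most-mono 𝓓
            (λ m f j lt → trans (cong (nth (c m)) (ℕ.+-identityʳ j)) (f j lt)) s)

  res-adj : ∀ {c c′ ρ} → Most 𝓓 (λ m → Adj m (c m) (c′ m)) → Res c ρ → Res c′ ρ → ⊥
  res-adj {c} {c′} adj (inj₂ (¬d , _)) _ = ¬d (most-mono 𝓓 (λ m → proj₁) adj)
  res-adj {c} {c′} adj (inj₁ _) (inj₂ (¬d , _)) = ¬d (most-mono 𝓓 (λ m q → proj₁ (proj₂ q)) adj)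
  res-adj {c} {c′} adj (inj₁ (dc , t , f , a , b , o , q)) (inj₁
      (dc′ , t′ , f′ , a′ , b′ , o′ , q′)) with directed {c} {c′} adj
  ... | d , d>0 , d<n , inj₁ s = residue-shift {a} {b} {a′} {b′} d>0 d<n
          (off-first {c} {c′} {t} {t′} {a} {b} {a′} {b′} {d} {0} dc′ f f′ s o o′) (trans (sym q) q′)
  ... | d , d>0 , d<n , inj₂ s = residue-shift {a′} {b′} {a} {b} d>0 d<n flipped (trans (sym q′) q)
    where
    open +-*-Solver
    flipped : b′ + a ≡ b + (a′ + d)
    flipped = trans (cong (b′ +_) (sym (ℕ.+-identityʳ a)))
      (trans (sym (off-first {c} {c′} {t} {t′} {a} {b} {a′} {b′} {0} {d} dc′ f f′ s o o′))
        (solve 3 (λ b a′ d → d :+ b :+ a′ := b :+ (a′ :+ d)) refl b a′ d))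

-- Failure of elementarity from a nonprincipal ultrafilter

module UltrafilterCase (em : ∀ {a} → ExcludedMiddle a) (ℓ : Level) (k : ℕ) (τ : Signature (3 + k))
                       (𝓓 : Uf ℕ) (nonprincipal : ∀ x → Quantifier.Most em 𝓓 (_≢ x)) where
  open Classical em
  open Quantifier em
  open Windows em k
  open Iterated 𝓓 nonprincipal
  private
    N n : ℕ
    N = 2 + k
    n = 3 + k
    1F 2F : Fin n
    1F = suc zero
    2F = suc (suc zero)
    module F (m : ℕ) = Frame em k (palette m)
    module C (m : ℕ) = Faces em k (palette m)
    module S (m : ℕ) = Algebras em ℓ k (palette m)

  colour-code : List ℕ × Fin n → ℕ
  colour-code (x , i) = pair (list-code x) (toℕ i)

  colour-code-inj : ∀ {c d} → colour-code c ≡ colour-code d → c ≡ d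
  colour-code-inj e = let (p , q) = pair-inj e in cong₂ _,_ (list-code-inj p) (Fin.toℕ-injective q)

  -- The flexible colours are windows of one generic list: they are equally distributed by
  -- `gen-window`, and being pairwise adjacent no two of them clash with any third colour.
  window-model : ∀ m → Models.Model em k (palette m)
  window-model m = RealScaffold.real-model em k (palette m) colour-code colour-code-inj (gen (N + m))
    (λ l i y → window m (toℕ l) y , i) (λ _ _ _ → refl)
    (λ i l l′ X → trans (gen-window m N (toℕ l) (ℕ.<⇒≤ (Fin.toℕ<n l)) (λ x → X (x , i)))
                        (sym (gen-window m N (toℕ l′) (ℕ.<⇒≤ (Fin.toℕ<n l′)) (λ x → X (x , i)))))
    (λ i → most-mono (gen (N + m)) {P = λ y → ∀ u v → u < N + m → v < N + m → nth y u ≡ nth y v → u ≡ v}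
        {Q = λ y → ∀ l l′ c → l ≢ l′ → ¬ Clash m c (window m (toℕ l) y , i) (window m (toℕ l′) y , i)}
            (λ y dist l l′ c l≢l′ (_ , _ , _ , _ , na) → na
        (window-adj m N y ℕ.≤-refl dist (ℕ.<⇒≤ (Fin.toℕ<n l)) (ℕ.<⇒≤ (Fin.toℕ<n l′)) (λ e → l≢l′ (Fin.toℕ-injective e))))
      (gen-distinct (N + m)))

  A : ℕ → Algebra τ ℓ
  A m = S.DenseAlgebra.A m (S.full-dense m) τ

  A∈Kₛ : ∀ {κ} {K : Pred (Algebra τ ℓ) κ} → Between K → ∀ m → A m ∈ (_ₛ em K)
  A∈Kₛ between m = S.DenseAlgebra.dense∈Kₛ m (S.full-dense m) τ between (window-model m)

  open Ultraproduct em 𝓓 A using (Ult; ult-⊨)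

  apex : ℕ → ∀ m → List ℕ × Fin n
  apex x m = interval x m , zero

  -- The diagonals, like the marked tuples `𝔸`, become seeds of the hull, which thus contains them
  -- in every signature.
  𝔼 : Fin n → Fin n → Algebra.Carrier Ult
  𝔼 i j m = record
    { to   = λ a → ⌊ F.pos (lower a) i ≡ F.pos (lower a) j ⌋
    ; cong = λ s → ⌊⌋-cong (F.ker (lower s) tt tt) (F.ker⁻ (lower s) tt tt)
    }

  Marked : ∀ x m → F.Atom m → Set
  Marked x m a = Inj (F.pos a) × C.FaceCol m 1F (apex x m) a

  marked-resp : ∀ x m {a b} → F.Same m a b → Marked x m a → Marked x m b
  marked-resp x m s (inj , fc) = (λ i j e → inj i j (F.ker⁻ s tt tt e)) , C.faceCol-same m (F.weaken m _ s) fc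

  𝔸 : ℕ → Algebra.Carrier Ult
  𝔸 x m = record
    { to   = λ a → ⌊ Marked x m (lower a) ⌋
    ; cong = λ s → ⌊⌋-cong (marked-resp x m (lower s)) (marked-resp x m (F.same-sym m (lower s)))
    }

  fin : ℕ → Fin n
  fin j with j ℕ.<? n
  ... | yes lt = fromℕ< lt
  ... | no _   = zero

  fin-toℕ : ∀ i → fin (toℕ i) ≡ i
  fin-toℕ i with toℕ i ℕ.<? n
  ... | yes lt = Fin.fromℕ<-toℕ i lt
  ... | no ¬lt = contradiction (Fin.toℕ<n i) ¬lt

  seed-of : ℕ × ℕ → Algebra.Carrier Ult
  seed-of (zero , j)  = 𝔼 (fin (proj₁ (unpair j))) (fin (proj₂ (unpair j)))
  seed-of (suc _ , x) = 𝔸 x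

  choose-by : ∀ m (X : Subset (S.atoms m)) → Dec (∃ λ a → Func.to X (lift a) ≡ true) → F.Atom m
  choose-by m X (yes (a , _)) = a
  choose-by m X (no _)        = F.atom id (proj₁ (F.extend₁ m zero (apex 0 m)))

  choose : ∀ m → Subset (S.atoms m) → F.Atom m
  choose m X = choose-by m X em

  choose-in : ∀ m X → (∃ λ a → Func.to X (lift a) ≡ true) → Func.to X (lift (choose m X)) ≡ true
  choose-in m X ex = go em
    where
    go : ∀ D → Func.to X (lift (choose-by m X D)) ≡ true
    go (yes (_ , h)) = h
    go (no none)     = contradiction ex none

  -- Closing under the choice of an atom in each factor provides the hull with sequences of
  -- singletons. The choice need not respect equality modulo `𝓓`, so it acts on the values of names.
  open Hull em Ult (seed-of ∘ unpair) (λ y m → S.singleton m (choose m (y m)))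
    renaming (A to H) using (val; Named; hull; hull-⊨; pick-named; seed-named)

  HC : Set ℓ
  HC = Algebra.Carrier H

  _at_ : HC → ∀ m → F.Atom m → Bool
  (x at m) a = Func.to (proj₁ x m) (lift a)

  named-𝔼 : ∀ i j → Named (𝔼 i j)
  named-𝔼 i j = subst Named (trans (cong seed-of (unpair-pair 0 (pair (toℕ i) (toℕ j))))
      (trans (cong (λ q → 𝔼 (fin (proj₁ q)) (fin (proj₂ q))) (unpair-pair (toℕ i) (toℕ j)))
        (cong₂ 𝔼 (fin-toℕ i) (fin-toℕ j))))
    (seed-named (pair 0 (pair (toℕ i) (toℕ j))))

  named-𝔸 : ∀ x → Named (𝔸 x)
  named-𝔸 x = subst Named (cong seed-of (unpair-pair 1 x)) (seed-named (pair 1 x))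

  single-isAtom : ∀ (s : ∀ m → F.Atom m) (nm : Named (λ m → S.singleton m (s m))) →
                  IsAtom H ((λ m → S.singleton m (s m)) , nm)
  single-isAtom s nm = nonzero , minimal
    where
    self : ∀ m → ⌊ F.Same m (s m) (s m) ⌋ ≡ true
    self m = ⌊⌋-intro (F.same-refl m)
    nonzero : ¬ _
    nonzero (lift z) with most-some 𝓓 z
    ... | m , e = true≢false (self m) (e (lift (s m)))
    minimal : ∀ x → _ → _
    minimal x (lift le) with em {P = Most 𝓓 (λ m → (x at m) (s m) ≡ true)}
    ... | yes q = inj₂ (lift (most-mono 𝓓 (λ { m (h , le) (lift a) → ≡true
            (λ xa → ∧-elim₂ {(x at m) a} (trans (le (lift a)) xa))
            (λ sa → trans (Func.cong (proj₁ x m) (lift (F.same-sym m (⌊⌋-elim sa)))) h) }) (most-∧ 𝓓 q le)))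
    ... | no ¬q = inj₁ (lift (most-mono 𝓓 (λ { m (h , le) (lift a) → ≡true
            (λ xa → ⊥-elim (h (trans (Func.cong (proj₁ x m) (lift (⌊⌋-elim (∧-elim₂ {(x at m) a} (trans (le
                (lift a)) xa))))) xa)))
            (λ ()) }) (most-∧ 𝓓 (most-¬ 𝓓 ¬q) le)))

  AtH : AtomStructure τ ℓ
  AtH = At H
  open AtomStructure AtH using (Carrier) renaming (_≈_ to _≈ᵃ_)

  tree : Carrier → Tree
  tree ((_ , t , _) , _) = t

  rep : Carrier → ∀ m → F.Atom m
  rep α m = choose m (val (tree α) m)

  -- The sequence of singletons picked from the name of `α` belongs to the hull, is nonzero and lies
  -- below `α`; as `α` is an atom, they are equal modulo `𝓓`.
  rep-spec : ∀ α → Most 𝓓 (λ m → ∀ a → (proj₁ α at m) a ≡ ⌊ F.Same m (rep α m) a ⌋)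
  rep-spec α@((b , t , lift e) , nz , min) = finish (min x (lift le))
    where
    x : HC
    x = (λ m → S.singleton m (choose m (val t m))) , node (leaf 0) t , lift (most-all 𝓓 (λ m a → refl))
    occupied : Most 𝓓 (λ m → ∃ λ a → Func.to (val t m) (lift a) ≡ true)
    occupied = stable λ ¬o → nz (lift (most-mono 𝓓 (λ { m (none , e) (lift a) →
      trans (sym (e (lift a))) (Bool.¬-not (λ h → none (a , h))) }) (most-∧ 𝓓 (most-¬ 𝓓 ¬o) e)))
    le : Most 𝓓 (λ m → ∀ a → Func.to (proj₁ x m) a ∧ᵇ Func.to (b m) a ≡ Func.to (proj₁ x m) a)
    le = most-mono 𝓓 (λ { m (ex , e) (lift a) → ≡true ∧-elim₁ (λ h → ∧-intro h
        (trans (Func.cong (b m) (lift (F.same-sym m (⌊⌋-elim h)))) (trans (sym (e (lift (choose m (val t m)))))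
            (choose-in m (val t m) ex)))) })
      (most-∧ 𝓓 occupied e)
    finish : _ → Most 𝓓 (λ m → ∀ a → Func.to (b m) (lift a) ≡ ⌊ F.Same m (choose m (val t m)) a ⌋)
    finish (inj₁ z) = contradiction z (proj₁ (single-isAtom (λ m → choose m (val t m)) (proj₂ x)))
    finish (inj₂ (lift q)) = most-mono 𝓓 (λ m f a → sym (f (lift a))) q

  rep-cong : ∀ {α β} → α ≈ᵃ β → Most 𝓓 (λ m → F.Same m (rep α m) (rep β m))
  rep-cong {α} {β} (lift e) = most-mono 𝓓 (λ m (p , q , r) → ⌊⌋-elim (trans (sym (p (rep β m)))
    (trans (r (lift (rep β m))) (trans (q (rep β m)) (⌊⌋-intro (F.same-refl m))))))
    (most-∧ 𝓓 (rep-spec α) (most-∧ 𝓓 (rep-spec β) e))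

  open Obstructions em k using (Step)

  rep-step : ∀ {l α β} → Step AtH l α β → Most 𝓓 (λ m → F.SameOn m (F.Off m l) (rep α m) (rep β m))
  rep-step {l} {α} {β} (lift le) = most-mono 𝓓
      (λ m (p , q , r) → let (b , sm , h) = S.cyl-out m l (λ _ → proj₁ (proj₁ β) m) (rep α m)
                               (∧-elim₂ {(proj₁ α at m) (rep α m)} (trans (r (lift (rep α m))) (trans (p (rep α m))
                                   (⌊⌋-intro (F.same-refl m)))))
                         in F.same-trans m sm (F.weaken m _ (F.same-sym m (⌊⌋-elim (trans (sym (q b)) h)))))
      (most-∧ 𝓓 (rep-spec α) (most-∧ 𝓓 (rep-spec β) le))

  step-rep : ∀ {l α β} → Most 𝓓 (λ m → F.SameOn m (F.Off m l) (rep α m) (rep β m)) → Step AtH l α β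
  step-rep {l} {α} {β} s = lift (most-mono 𝓓 (λ { m (p , q , r) (lift a) → ≡true ∧-elim₁ (λ h → ∧-intro h
      (S.cyl-in m l (λ _ → proj₁ (proj₁ β) m) a (rep β m)
        (F.same-trans m (F.weaken m _ (F.same-sym m (⌊⌋-elim (trans (sym (p a)) h)))) r)
        (trans (q (rep β m)) (⌊⌋-intro (F.same-refl m))))) })
    (most-∧ 𝓓 (rep-spec α) (most-∧ 𝓓 (rep-spec β) s)))

  below : ∀ (e : HC) → Most 𝓓 (λ m → ∃ λ a → (e at m) a ≡ true) →
          ∃ λ β → Most 𝓓 (λ m → (e at m) (rep β m) ≡ true)
  below (b , t , lift q) ex = β , most-mono 𝓓 (λ { m ((a , h) , e , sp) →
        trans (Func.cong (b m) (lift (F.same-sym m (⌊⌋-elim (trans (sym (sp (rep β m))) (⌊⌋-intro (same-choice m)))))))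
          (trans (sym (e (lift (choose m (val t m))))) (choose-in m (val t m) (a , trans (e (lift a)) h))) })
      (most-∧ 𝓓 ex (most-∧ 𝓓 q (most-all 𝓓 {P = λ m → ∀ a → ⌊ F.Same m (choose m (val t m)) a ⌋ ≡ ⌊ F.Same m
          (choose m (val t m)) a ⌋} λ m a → refl)))
    where
    s : ∀ m → F.Atom m
    s m = choose m (val t m)
    nm : Named (λ m → S.singleton m (s m))
    nm = node (leaf 0) t , lift (most-all 𝓓 (λ m a → refl))
    β : Carrier
    β = ((λ m → S.singleton m (s m)) , nm) , single-isAtom s nm
    same-choice : ∀ m → F.Same m (s m) (rep β m)
    same-choice m = ⌊⌋-elim (choose-in m (S.singleton m (s m)) (s m , ⌊⌋-intro (F.same-refl m)))

  -- The cylinder of `α`, intersected with `T`, is an element of the hull and nonzero in most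
  -- factors; `below` finds an atom of the hull in it.
  fetch : ∀ l α (T : HC) → Most 𝓓 (λ m → ∃ λ b → F.SameOn m (F.Off m l) (rep α m) b × (T at m) b ≡ true) →
          ∃ λ β → Step AtH l α β × Most 𝓓 (λ m → (T at m) (rep β m) ≡ true)
  fetch l α T ex = β , step-rep {l} {α} {β} (most-mono 𝓓 (λ m (h , p) → near m p (∧-elim₁ h)) (most-∧ 𝓓 hβ (rep-spec α)))
                     , most-mono 𝓓 (λ m h → ∧-elim₂ {(C′ at m) (rep β m)} h) hβ
    where
    C′ : HC
    C′ = Algebra.c H l (proj₁ α)
    e : HC
    e = Algebra._∧_ H C′ T
    found : ∃ λ β → Most 𝓓 (λ m → (e at m) (rep β m) ≡ true)
    found = below e (most-mono 𝓓 (λ { m ((b , s , t) , p) → b , ∧-intro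
      (S.cyl-in m l (λ j → proj₁ ((proj₁ α ∷ []) j) m) b (rep α m) (F.same-sym m s) (trans (p (rep α m)) (⌊⌋-intro
          (F.same-refl m)))) t })
      (most-∧ 𝓓 ex (rep-spec α)))
    β = proj₁ found
    hβ = proj₂ found
    near : ∀ m → (∀ a → (proj₁ α at m) a ≡ ⌊ F.Same m (rep α m) a ⌋) → (C′ at m) (rep β m) ≡ true →
           F.SameOn m (F.Off m l) (rep α m) (rep β m)
    near m p h = let (b , s , q) = S.cyl-out m l (λ j → proj₁ ((proj₁ α ∷ []) j) m) (rep β m) h in
      F.same-sym m (F.same-trans m s (F.weaken m _ (F.same-sym m (⌊⌋-elim (trans (sym (p b)) q)))))

  marked-some : ∀ x m → ∃ λ a → Marked x m a
  marked-some x m = F.atom id K , (λ i j e → e) ,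
      subst (λ c → C.FaceCol m 1F c (F.atom id K)) (proj₂ (F.extend₁ m 1F (apex x m)))
          (C.faceCol-generic m {F.atom id K} (λ i j e → e) 1F)
    where
    K : F.Simp m
    K = proj₁ (F.extend₁ m 1F (apex x m))

  -- The list in the colour of the third face. Atoms have trees as names, so these sequences are
  -- coded by numbers, and a first one exists in each shift class.
  trace : Tree → ℕ → List ℕ
  trace t m = let a = choose m (val t m) in proj₁ (F.col m a (F.pos a 2F))

  open Offsets em k 𝓓 nonprincipal tree-code tree-code-inj trace using (Res; res-some; res-func; res-adj)

  large : Obstructions.Largeness em k ℕ (⊤ × Fin (n * n))
  large = record
    { Large       = Most 𝓓
    ; large-all   = most-all 𝓓 (λ _ → tt)
    ; large-some  = most-some 𝓓
    ; large-minus = λ W u → most-∧ 𝓓 W (nonprincipal u)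
    ; large-split = λ {W} large β →
        let (i , m) = most-fin 𝓓 {P = λ i v → W v × proj₂ (β v) ≡ i} (most-mono 𝓓 (λ v w → proj₂ (β v) , w , refl) large)
        in (tt , i) , most-mono 𝓓 (λ v (w , e) → w , cong (tt ,_) e) m
    }

  principal-fin : ∀ {r} (J : Uf (⊤ × Fin r)) → ∃ λ l → Most J (_≡ l)
  principal-fin J = let (i , m) = most-fin J {P = λ i t → t ≡ (tt , i)} (most-all J (λ t → proj₂ t , refl)) in (tt , i) , m

  -- Residue and index are packed into one element of `Fin (n * n)`. With finitely many classes in
  -- all, every ultrafilter of classes is principal.
  Class : (∀ m → List ℕ × Fin n) → ⊤ × Fin (n * n) → Set
  Class c (_ , q) = ∃ λ ρ → ∃ λ i → q ≡ combine ρ i × Most 𝓓 (λ m → proj₂ (c m) ≡ i) × Res (proj₁ ∘ c) ρ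

  combine-same : ∀ {q ρ i ρ′ i′} → q ≡ combine {n} {n} ρ i → q ≡ combine ρ′ i′ → ρ ≡ ρ′ × i ≡ i′
  combine-same {ρ = ρ} {i} {ρ′} {i′} e e′ = Fin.combine-injective ρ i ρ′ i′ (trans (sym e) e′)

  AdjMost : (∀ m → List ℕ × Fin n) → (∀ m → List ℕ × Fin n) → Set
  AdjMost c c′ = Most 𝓓 (λ z → Adj z (proj₁ (c z)) (proj₁ (c′ z)))

  some-adjacent : ∀ {c c′ c″ i} → Most 𝓓 (λ m → ¬ Clash m (c m) (c′ m) (c″ m)) → Most 𝓓 (λ m → proj₂ (c m) ≡ i) →
                  Most 𝓓 (λ m → proj₂ (c′ m) ≡ i) → Most 𝓓 (λ m → proj₂ (c″ m) ≡ i) →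
                  AdjMost c c′ ⊎ (AdjMost c c″ ⊎ AdjMost c′ c″)
  some-adjacent {c} {c′} {c″} {i} ok m m′ m″ = Sum.map₂ (most-⊎ 𝓓 {P = λ z → Adj z (proj₁ (c z)) (proj₁ (c″ z))})
      (most-⊎ 𝓓 {P = λ z → Adj z (proj₁ (c z)) (proj₁ (c′ z))} (most-mono 𝓓 split (most-∧ 𝓓 ok (most-∧ 𝓓 m
          (most-∧ 𝓓 m′ m″)))))
    where
    split : ∀ z → ¬ Clash z (c z) (c′ z) (c″ z) × proj₂ (c z) ≡ i × proj₂ (c′ z) ≡ i × proj₂ (c″ z) ≡ i →
            Adj z (proj₁ (c z)) (proj₁ (c′ z)) ⊎ (Adj z (proj₁ (c z)) (proj₁ (c″ z)) ⊎ Adj z (proj₁ (c′ z)) (proj₁ (c″ z)))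
    split z (ok , e , e′ , e″) = stable λ none → ok
      (trans e (sym e′) , trans e′ (sym e″) , none ∘ inj₁ , none ∘ inj₂ ∘ inj₁ , none ∘ inj₂ ∘ inj₂)

  -- Three colours of one index avoid a clash only through an adjacent pair, and adjacent sequences
  -- have different residues.
  class-clash : ∀ {c c′ c″ q} → Most 𝓓 (λ m → ¬ Clash m (c m) (c′ m) (c″ m)) →
                Class c″ (tt , q) → Class c′ (tt , q) → Class c (tt , q) → ⊥
  class-clash {c} {c′} {c″} ok (ρ″ , i″ , e″ , m″ , r″) (ρ′ , i′ , e′ , m′ , r′) (ρ , i , e , m , r) =
      finish (some-adjacent {c} {c′} {c″} ok m (subst (λ j → Most 𝓓 (λ z → proj₂ (c′ z) ≡ j)) (proj₂ q′) m′)
                                            (subst (λ j → Most 𝓓 (λ z → proj₂ (c″ z) ≡ j)) (proj₂ q″) m″))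
    where
    q′ = combine-same {ρ = ρ′} {i′} {ρ} {i} e′ e
    q″ = combine-same {ρ = ρ″} {i″} {ρ} {i} e″ e
    R′ : Res (proj₁ ∘ c′) ρ
    R′ = subst (Res (proj₁ ∘ c′)) (proj₁ q′) r′
    R″ : Res (proj₁ ∘ c″) ρ
    R″ = subst (Res (proj₁ ∘ c″)) (proj₁ q″) r″
    finish : _ → ⊥
    finish (inj₁ adj)        = res-adj {proj₁ ∘ c} {proj₁ ∘ c′} adj r R′
    finish (inj₂ (inj₁ adj)) = res-adj {proj₁ ∘ c} {proj₁ ∘ c″} adj r R″
    finish (inj₂ (inj₂ adj)) = res-adj {proj₁ ∘ c′} {proj₁ ∘ c″} adj R′ R″

  sequential : SequencesModulo.Sequential em k 𝓓 palette AtH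
  sequential = record
    { rep        = rep
    ; rep-cong   = λ {α} {β} → rep-cong {α} {β}
    ; rep-step   = λ {l} {α} {β} → rep-step {l} {α} {β}
    ; V          = ℕ
    ; apex       = apex
    ; apex-inj   = λ e → apex-inj (most-some 𝓓 (most-∧ 𝓓 e (nonprincipal 0)))
    ; fetch-E    = λ l i j α ex → let (β , st , m) = fetch l α (𝔼 i j , named-𝔼 i j)
                                        (most-mono 𝓓 (λ m (b , s , e) → b , s , ⌊⌋-intro e) ex)
                                  in β , st , most-mono 𝓓 (λ m → ⌊⌋-elim) m
    ; fetch-apex = λ l x α ex → let (β , st , m) = fetch l α (𝔸 x , named-𝔸 x)
                                      (most-mono 𝓓 (λ m (b , s , e) → b , s , ⌊⌋-intro e) ex)
                                in β , st , most-mono 𝓓 (λ m → ⌊⌋-elim) m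
    ; generic    = let (β , m) = below (𝔸 0 , named-𝔸 0) (most-all 𝓓 (λ m → let (a , h) = marked-some 0 m in a , ⌊⌋-intro h))
                   in β , most-mono 𝓓 (λ m h → proj₁ (⌊⌋-elim h)) m
    ; M          = ⊤
    ; r          = n * n
    ; default    = tt , zero
    ; large      = large
    ; principal  = principal-fin
    ; Cl         = Class
    ; Cl-func    = λ { e (ρ , i , refl , m , r) (ρ′ , i′ , refl , m′ , r′) → cong (tt ,_) (cong₂ combine
                       (res-func (most-mono 𝓓 (λ z → cong proj₁) e) r r′)
                       (let (z , q , q′ , e) = most-some 𝓓 (most-∧ 𝓓 m (most-∧ 𝓓 m′ e)) in trans (sym q) (trans
                           (cong proj₂ e) q′))) }
    ; Cl-some    = λ {_} {_} {α} _ _ _ _ →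
                     let (i , m) = most-fin 𝓓 {P = λ i m → proj₂ (F.col m (rep α m) (F.pos (rep α m) 2F)) ≡ i} (most-all 𝓓 (λ m → _ , refl))
                         (ρ , r) = res-some (tree α)
                     in (tt , combine ρ i) , ρ , i , refl , m , r
    ; Cl-clash   = λ {c} {c′} {c″} → class-clash {c} {c′} {c″}
    }
    where
    apex-inj : ∀ {x y} → (∃ λ m → apex x m ≡ apex y m × m ≢ 0) → x ≡ y
    apex-inj (zero , _ , ne)   = contradiction refl ne
    apex-inj (suc m , e , _)   = cong (λ c → nth (proj₁ c) 0) e

  not-elementary : ∀ {κ} {K : Pred (Algebra τ ℓ) κ} → Between K → ¬ Elementary (_ₛ em K)
  not-elementary between (Γ , iff) = Obstructions.obstruction⇒¬representable em k AtH
      (SequencesModulo.obstruction em k 𝓓 palette sequential)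
      (proj₂ (proj₂ (proj₂ (Equivalence.from (iff H) (hull-⊨ (ult-⊨ (λ m → Equivalence.to (iff (A m))
          (A∈Kₛ between m))))))))

-- No nonprincipal ultrafilter: finitely supported elements

module GreenBlue (k : ℕ) where
  private
    n : ℕ
    n = 3 + k

  Colour₂ : Set → Set
  Colour₂ X = X ⊎ (ℕ × Fin n)

  Clash₂ : ∀ {X : Set} → Colour₂ X → Colour₂ X → Colour₂ X → Set
  Clash₂ (inj₁ _) (inj₁ _) (inj₁ _) = ⊤
  Clash₂ (inj₂ (p , i)) (inj₂ (q , j)) (inj₂ (r , l)) = i ≡ j × j ≡ l × (p ≡ q ⊎ (p ≡ r ⊎ q ≡ r))
  Clash₂ _ _ _ = ⊥

  index₂ : ∀ {X : Set} → Colour₂ X → Maybe (Fin n)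
  index₂ (inj₁ _)       = nothing
  index₂ (inj₂ (_ , i)) = just i

  green-blue : Set → Palette k
  green-blue X = record
    { Colour      = Colour₂ X
    ; Bad         = Clash₂
    ; bad-swap₁   = λ {a} {b} {c} → swap₁ a b c
    ; bad-swap₂   = λ {a} {b} {c} → swap₂ a b c
    ; idx         = index₂
    ; bad-idx     = λ {a} {b} {c} → same-idx a b c
    ; filler      = λ i m → inj₂ (toℕ m , i)
    ; filler-idx  = λ _ _ → refl
    ; filler-good = λ { i l≢m l≢o m≢o (_ , _ , inj₁ e) → l≢m (Fin.toℕ-injective e)
                      ; i l≢m l≢o m≢o (_ , _ , inj₂ (inj₁ e)) → l≢o (Fin.toℕ-injective e)
                      ; i l≢m l≢o m≢o (_ , _ , inj₂ (inj₂ e)) → m≢o (Fin.toℕ-injective e) }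
    }
    where
    swap₁ : ∀ (a b c : Colour₂ X) → Clash₂ a b c → Clash₂ b a c
    swap₁ (inj₁ _) (inj₁ _) (inj₁ _) _ = tt
    swap₁ (inj₂ _) (inj₂ _) (inj₂ _) (p , q , inj₁ e)        = sym p , trans p q , inj₁ (sym e)
    swap₁ (inj₂ _) (inj₂ _) (inj₂ _) (p , q , inj₂ (inj₁ e)) = sym p , trans p q , inj₂ (inj₂ e)
    swap₁ (inj₂ _) (inj₂ _) (inj₂ _) (p , q , inj₂ (inj₂ e)) = sym p , trans p q , inj₂ (inj₁ e)
    swap₂ : ∀ (a b c : Colour₂ X) → Clash₂ a b c → Clash₂ a c b
    swap₂ (inj₁ _) (inj₁ _) (inj₁ _) _ = tt
    swap₂ (inj₂ _) (inj₂ _) (inj₂ _) (p , q , inj₁ e)        = trans p q , sym q , inj₂ (inj₁ e)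
    swap₂ (inj₂ _) (inj₂ _) (inj₂ _) (p , q , inj₂ (inj₁ e)) = trans p q , sym q , inj₁ e
    swap₂ (inj₂ _) (inj₂ _) (inj₂ _) (p , q , inj₂ (inj₂ e)) = trans p q , sym q , inj₂ (inj₂ (sym e))
    same-idx : ∀ (a b c : Colour₂ X) → Clash₂ a b c → index₂ a ≡ index₂ b
    same-idx (inj₁ _) (inj₁ _) (inj₁ _) _ = refl
    same-idx (inj₂ _) (inj₂ _) (inj₂ _) (p , _) = cong just p

sum : ∀ {r} → (Fin r → ℕ) → ℕ
sum {zero}  f = 0
sum {suc r} f = f zero + sum (f ∘ suc)

sum-punch : ∀ {r} (f : Fin (suc r) → ℕ) m → sum f ≡ f m + sum (f ∘ punchIn m)
sum-punch f zero = refl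
sum-punch {suc r} f (suc m) = trans (cong (f zero +_) (sum-punch (f ∘ suc) m))
  (trans (sym (ℕ.+-assoc (f zero) (f (suc m)) (sum (f ∘ suc ∘ punchIn m)))) (trans (cong (_+ sum
      (f ∘ suc ∘ punchIn m)) (ℕ.+-comm (f zero) (f (suc m))))
    (ℕ.+-assoc (f (suc m)) (f zero) (sum (f ∘ suc ∘ punchIn m)))))

sum-cong : ∀ {r} {f g : Fin r → ℕ} → (∀ i → f i ≡ g i) → sum f ≡ sum g
sum-cong {zero}  e = refl
sum-cong {suc r} e = cong₂ _+_ (e zero) (sum-cong (e ∘ suc))

<2^suc : ∀ b → b < 2 ^ suc b
<2^suc zero    = s≤s z≤n
<2^suc (suc b) = ℕ.≤-trans (ℕ.+-mono-≤ (ℕ.m^n>0 2 (suc b)) (<2^suc b))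
  (ℕ.≤-reflexive (cong (2 ^ suc b +_) (sym (ℕ.+-identityʳ _))))

-- The representation over ℕ of the structure with countably many greens. Its
-- flexible colours are numbers coding the face they colour, which exceed all
-- numbers used below the greatest point of the face.
module Numbers (em : ∀ {a} → ExcludedMiddle a) (k : ℕ)
               (principal : (J : Uf ℕ) → ∃ λ x → Quantifier.Most em J (_≡ x)) where
  open Classical em
  open Quantifier em
  open GreenBlue k
  open Frame em k (green-blue ℕ)

  colour-code : Colour₂ ℕ → ℕ
  colour-code (inj₁ x)       = pair 0 x
  colour-code (inj₂ (j , i)) = pair 1 (pair j (toℕ i))

  colour-code-inj : ∀ {c d} → colour-code c ≡ colour-code d → c ≡ d
  colour-code-inj {inj₁ x} {inj₁ y} e = cong inj₁ (proj₂ (pair-inj e))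
  colour-code-inj {inj₁ x} {inj₂ _} e with () ← proj₁ (pair-inj {0} {_} {1} e)
  colour-code-inj {inj₂ _} {inj₁ y} e with () ← proj₁ (pair-inj {1} {_} {0} e)
  colour-code-inj {inj₂ (j , i)} {inj₂ (j′ , i′)} e = let (p , q) = pair-inj (proj₂ (pair-inj {1} {_} {1} e))
                                                    in cong inj₂ (cong₂ _,_ p (Fin.toℕ-injective q))

  open Codes em k (green-blue ℕ) colour-code colour-code-inj
  open Scaffolds em k (green-blue ℕ)
  open Models em k (green-blue ℕ)

  number-order : StrictOrder
  number-order = record
    { Pt = ℕ ; _≈ᵖ_ = _≡_ ; ≈-refl = refl ; ≈-sym = sym ; ≈-trans = trans
    ; _<ᵖ_ = _<_ ; <-irr = λ { refl → ℕ.<-irrefl refl } ; <-trans = ℕ.<-trans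
    ; <-resp = λ { refl refl lt → lt } ; <-tri = tri ; base = 0 ; above = λ u → suc u , ℕ.≤-refl }
    where
    tri : ∀ u v → (u < v) ⊎ (u ≡ v) ⊎ (v < u)
    tri u v with ℕ.<-cmp u v
    ... | tri< lt _ _ = inj₁ lt
    ... | tri≈ _ e _  = inj₂ (inj₁ e)
    ... | tri> _ _ gt = inj₂ (inj₂ gt)
  open StrictOrder number-order

  parent : ℕ → Fin N → ℕ
  parent b = decode N (proj₁ (unpair (proj₂ (unpair b))))

  wish : ℕ → Simp
  wish b = simp-of (proj₂ (unpair (proj₂ (unpair b))))

  Small : ℕ → Colour₂ ℕ → Set
  Small b c = ∀ j i → c ≡ inj₂ (j , i) → j < b

  -- The last two conditions bound the numbers that `b` brings in: those of its wish lie below `b`,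
  -- those of the fallback `spare` below `n`.
  Par : ℕ → (Fin N → ℕ) → Set
  Par b a = Desc a × a zero < b × (∀ l → a l ≡ parent b l) × n ≤ b × (∀ m → Small b (proj₁ (wish b) m))

  -- Used when the base does not have the wished colour. A green has no number and the fillers have
  -- numbers below `n`, so nothing large appears on the sides.
  spare : ∀ c → ∃ λ (K : Simp) → (proj₁ K zero ≡ c × proj₁ K (suc zero) ≡ inj₁ 0) ×
          (∀ l → l ≢ zero → l ≢ suc zero → ∃ λ i → proj₁ K l ≡ inj₂ (toℕ l , i))
  spare c = extend-filled {zero} {suc zero} (λ ()) c (inj₁ 0)

  section-by : ∀ b c → Dec (proj₁ (wish b) zero ≡ c) → Simp
  section-by b c (yes _) = wish b
  section-by b c (no _)  = proj₁ (spare c)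

  section-zero : ∀ b c D → proj₁ (section-by b c D) zero ≡ c
  section-zero b c (yes e) = e
  section-zero b c (no _)  = proj₁ (proj₁ (proj₂ (spare c)))

  -- The binary code of the set of points. For a descending face it lies between `2 ^ F zero` and
  -- `2 ^ suc (F zero)`, and different faces of one simplex have different codes.
  face-code : (Fin N → ℕ) → ℕ
  face-code F = sum (λ i → 2 ^ F i)

  scaffold : Scaffold
  scaffold = record
    { order      = number-order
    ; rank       = id
    ; Par        = Par
    ; par-desc   = proj₁
    ; par-below  = λ p → proj₁ (proj₂ p)
    ; par-rank   = λ p → proj₁ (proj₂ p)
    ; par-unique = λ (_ , _ , p , _) (_ , _ , q , _) l → trans (p l) (sym (q l))
    ; par-resp   = λ { refl e (d , lt , p , q) →
        (λ i j l → subst₂ _<_ (e j) (e i) (d i j l)) , subst (_< _) (e zero) lt , (λ l → trans (sym (e l)) (p l)) , q }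
    ; sec        = λ b c → section-by b c em
    ; sec-zero   = λ b c → section-zero b c em
    ; sec-resp   = λ { refl c → refl }
    ; Ω          = ⊤
    ; 𝓦          = pure tt
    ; flex       = λ F _ i _ → inj₂ (face-code F , i)
    ; flex-idx   = λ _ _ _ _ → refl
    ; flex-cong  = λ e _ i _ → cong (λ z → inj₂ (z , i)) (sum-cong (λ l → cong (2 ^_) (e l)))
    ; flex-law   = λ _ _ _ _ _ → refl
    }

  open Labelling scaffold

  power-bound : ∀ {r} (x : Fin r → ℕ) b → Desc x → (∀ i → x i < b) → sum (λ i → 2 ^ x i) < 2 ^ b
  power-bound {zero}  x b d lt = ℕ.m^n>0 2 b
  power-bound {suc r} x b d lt = ℕ.<-≤-trans
    (ℕ.+-monoʳ-< (2 ^ x zero) (power-bound (x ∘ suc) (x zero) (desc-tail d) (λ i → d zero (suc i) (s≤s z≤n))))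
    (ℕ.≤-trans (ℕ.≤-reflexive (cong (2 ^ x zero +_) (sym (ℕ.+-identityʳ _)))) (ℕ.^-monoʳ-≤ 2 (lt zero)))

  head-bound : ∀ F → 2 ^ F zero ≤ face-code F
  head-bound F = ℕ.m≤m+n _ _

  section-small : ∀ {b a} → Par b a → ∀ c m D → Small (2 ^ suc b) (proj₁ (section-by b c D) (suc m))
  section-small {b} (_ , _ , _ , n≤b , small) c m (yes _) j i e = ℕ.<-trans (small (suc m) j i e) (<2^suc b)
  section-small {b} (_ , _ , _ , n≤b , _) c zero    (no _) j i e with () ← trans (sym (proj₂ (proj₁ (proj₂ (spare c))))) e
  section-small {b} (_ , _ , _ , n≤b , _) c (suc m) (no _) j i e with proj₂ (proj₂ (spare c)) (suc (suc m)) (λ ()) (λ ())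
  ... | i′ , e′ with trans (sym e′) e
  ...   | refl = ℕ.<-≤-trans (Fin.toℕ<n (suc (suc m))) (ℕ.≤-trans n≤b (ℕ.<⇒≤ (<2^suc b)))

  label-small : ∀ F → Desc F → Most (label F) (Small (2 ^ suc (F zero)))
  label-small F d = go em
    where
    go : Dec (Spec F) → Most (label F) (Small (2 ^ suc (F zero)))
    go (yes (a , m , p , q)) = most-≋ {J = side (F zero) m (label a)} {label F} {P = Small (2 ^ suc (F zero))}
      (λ X → sym (label-spec F {a} {m} p q X))
      (most-all (label a) {P = λ c → Small (2 ^ suc (F zero)) (proj₁ (section-by (F zero) c em) (suc m))}
        (λ c → section-small p c m em))
    go (no ¬s) = most-≋ {J = pure (inj₂ (face-code F , index (F zero)))} {label F} {P = Small (2 ^ suc (F zero))}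
      (λ X → sym (label-flex F ¬s X))
      (⌊⌋-intro λ { j i refl → power-bound F (suc (F zero)) d (λ i → s≤s (below d i)) })
      where
      below : ∀ {r} {x : Fin (suc r) → ℕ} → Desc x → ∀ i → x i ≤ x zero
      below d zero    = ℕ.≤-refl
      below d (suc i) = ℕ.<⇒≤ (d zero (suc i) (s≤s z≤n))

  face-code-distinct : ∀ {x : Fin n → ℕ} → Desc x → ∀ {m m′} → face-code (face x m) ≡ face-code (face x m′) → m ≡ m′
  face-code-distinct {x} d {m} {m′} e = Fin.suc-injective (desc-inj d _ _ (power-inj (x (suc m)) (x (suc m′))
      (ℕ.+-cancelʳ-≡ _ _ _
    (trans (sym (sum-punch (λ i → 2 ^ x i) (suc m))) (trans (sum-punch (λ i → 2 ^ x i) (suc m′)) (cong (2 ^ x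
        (suc m′) +_) (sym e)))))))
    where
    power-inj : ∀ u v → 2 ^ u ≡ 2 ^ v → u ≡ v
    power-inj u v q with ℕ.<-cmp u v
    ... | tri< lt _ _ = contradiction q (ℕ.<⇒≢ (ℕ.^-monoʳ-< 2 (s≤s (s≤s z≤n)) lt))
    ... | tri≈ _ r _  = r
    ... | tri> _ _ gt = contradiction (sym q) (ℕ.<⇒≢ (ℕ.^-monoʳ-< 2 (s≤s (s≤s z≤n)) gt))

  -- The greatest point of the base is below `x zero`, so the numbers on the base stay below
  -- `2 ^ x zero`, which no flexible code at `x zero` undercuts.
  flex-old : ∀ {x} → Desc x → ¬ Par (x zero) (x ∘ suc) → FlexOld x
  flex-old {x} d _ = most-mono (label (x ∘ suc)) {P = Small (2 ^ suc (x (suc zero)))} (λ c small → ⌊⌋-intro (clear c small))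
      (label-small (x ∘ suc) (desc-tail d))
    where
    clear : ∀ c → Small (2 ^ suc (x (suc zero))) c → ∀ m m′ → m ≢ m′ →
            ¬ Clash₂ c (inj₂ (face-code (face x m) , index (x zero))) (inj₂ (face-code (face x m′) , index (x zero)))
    clear (inj₂ (j , i)) small m m′ ne (_ , _ , inj₂ (inj₂ e)) = ne (face-code-distinct d e)
    clear (inj₂ (j , i)) small m m′ ne (_ , _ , inj₁ e) = fresh m e
      where
      fresh : ∀ m → j ≢ face-code (face x m)
      fresh m e = ℕ.<⇒≢ (ℕ.<-≤-trans (small j i refl)
        (ℕ.≤-trans (ℕ.^-monoʳ-≤ 2 (d zero (suc zero) (s≤s z≤n))) (head-bound (face x m)))) e
    clear (inj₂ (j , i)) small m m′ ne (_ , _ , inj₂ (inj₁ e)) = ℕ.<⇒≢ (ℕ.<-≤-trans (small j i refl)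
        (ℕ.≤-trans (ℕ.^-monoʳ-≤ 2 (d zero (suc zero) (s≤s z≤n))) (head-bound (face x m′)))) e

  flex-good : ∀ {x} → Desc x → ¬ Par (x zero) (x ∘ suc) → FlexGood x
  flex-good {x} d _ = ⌊⌋-intro λ
    { m m′ m″ p q r (_ , _ , inj₁ e)        → p (face-code-distinct d e)
    ; m m′ m″ p q r (_ , _ , inj₂ (inj₁ e)) → q (face-code-distinct d e)
    ; m m′ m″ p q r (_ , _ , inj₂ (inj₂ e)) → r (face-code-distinct d e) }

  principal-colour : (J : Uf (Colour₂ ℕ)) → ∃ λ c → Most J (_≡ c)
  principal-colour J with principal (mapᵘ colour-code J)
  ... | x , m with most-some J {P = λ c → colour-code c ≡ x} m
  ...   | c , refl = c , most-mono J (λ d → colour-code-inj) m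

  bound : ∀ {r} (f : Fin r → ℕ) → ∃ λ b → ∀ i → f i < b
  bound {zero}  f = 0 , λ ()
  bound {suc r} f = let (b , lt) = bound (f ∘ suc) in suc (f zero) + b
    , λ { zero → ℕ.m≤m+n _ b ; (suc i) → ℕ.<-≤-trans (lt i) (ℕ.m≤n+m b _) }

  -- The label of `a` is concentrated on one colour `c₀`, so a single simplex over `c₀` is wish
  -- enough. Hence points can be numbers instead of reals.
  realizable : ∀ {a} → Desc a → ∀ {W} → Ext W →
               Most (label a) (λ c → ∃ λ K → proj₁ K zero ≡ c × W K ≡ true) →
               ∃ λ b → Par b a × Most (label a) (λ c → W (section-by b c em) ≡ true)
  realizable {a} da {W} ext-W m = b , (da , below , parents , n≤b , small)
      , most-mono (label a) {P = _≡ c₀} (λ { c refl → meets em }) at-c₀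
    where
    c₀ = proj₁ (principal-colour (label a))
    at-c₀ = proj₂ (principal-colour (label a))
    chosen : ∃ λ K → proj₁ K zero ≡ c₀ × W K ≡ true
    chosen with most-some (label a) {P = λ c → (∃ λ K → proj₁ K zero ≡ c × W K ≡ true) × c ≡ c₀} (most-∧ (label a) m at-c₀)
    ... | c , w , refl = w
    K₀ = proj₁ chosen
    size : Colour₂ ℕ → ℕ
    size (inj₁ _)       = 0
    size (inj₂ (j , _)) = j
    sizes = bound (size ∘ proj₁ K₀)
    content = pair (encode N a) (simp-code K₀)
    -- Padding that makes `b` exceed the greatest parent, `n` and every number in `K₀`, as `Par`
    -- demands.
    junk = suc (a zero) + (n + proj₁ sizes)
    b = pair junk content
    junk≤b : junk ≤ b
    junk≤b = ℕ.≤-trans (ℕ.m≤m+n junk content) (pair-≥ junk content)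
    below : a zero < b
    below = ℕ.≤-trans (ℕ.m≤m+n _ _) junk≤b
    n≤b : n ≤ b
    n≤b = ℕ.≤-trans (ℕ.≤-trans (ℕ.m≤m+n n _) (ℕ.m≤n+m _ (suc (a zero)))) junk≤b
    parents : ∀ l → a l ≡ parent b l
    parents l = sym (trans (cong (λ q → decode N (proj₁ (unpair (proj₂ q))) l) (unpair-pair junk content))
      (trans (cong (λ q → decode N (proj₁ q) l) (unpair-pair (encode N a) (simp-code K₀))) (decode-encode N a l)))
    wish-K₀ : ∀ l → proj₁ (wish b) l ≡ proj₁ K₀ l
    wish-K₀ l = trans (cong (λ q → proj₁ (simp-of (proj₂ (unpair (proj₂ q)))) l) (unpair-pair junk content))
      (trans (cong (λ q → proj₁ (simp-of (proj₂ q)) l) (unpair-pair (encode N a) (simp-code K₀))) (simp-of-code K₀ l))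
    small : ∀ m → Small b (proj₁ (wish b) m)
    small m j i e = ℕ.<-≤-trans (subst (λ c → size c < proj₁ sizes) (trans (sym (wish-K₀ m)) e) (proj₂ sizes m))
      (ℕ.≤-trans (ℕ.≤-trans (ℕ.m≤n+m _ n) (ℕ.m≤n+m _ (suc (a zero)))) junk≤b)
    meets : ∀ D → W (section-by b c₀ D) ≡ true
    meets (yes _) = trans (ext-W wish-K₀) (proj₂ (proj₂ chosen))
    meets (no ne) = contradiction (trans (wish-K₀ zero) (proj₁ (proj₂ chosen))) ne

  number-model : Model
  number-model = model flex-old flex-good realizable

-- Finite partial injections and finitely supported elements

module PartialMaps (em : ∀ {a} → ExcludedMiddle a) where
  open Classical em

  -- The lists bound the domain and the range; they express finiteness and may contain more than is
  -- mapped.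
  record Part (X Y : Set) : Set where
    field
      rel    : X → Y → Bool
      lefts  : List X
      rights : List Y
      func    : ∀ {x u v} → rel x u ≡ true → rel x v ≡ true → u ≡ v
      injc    : ∀ {x y u} → rel x u ≡ true → rel y u ≡ true → x ≡ y
      left   : ∀ {x u} → rel x u ≡ true → x ∈ˡ lefts
      right  : ∀ {x u} → rel x u ≡ true → u ∈ˡ rights
  open Part public

  infix 4 _⊑_
  _⊑_ : ∀ {X Y} → Part X Y → Part X Y → Set
  ρ ⊑ σ = ∀ {x u} → rel ρ x u ≡ true → rel σ x u ≡ true

  flip : ∀ {X Y} → Part X Y → Part Y X
  flip ρ = record { rel = λ u x → rel ρ x u ; lefts = rights ρ ; rights = lefts ρ
                  ; func = injc ρ ; injc = func ρ ; left = right ρ ; right = left ρ }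

  diagonal : ∀ {X} → List X → Part X X
  diagonal L = record
    { rel = λ x y → ⌊ x ≡ y × x ∈ˡ L ⌋ ; lefts = L ; rights = L
    ; func = λ p q → trans (sym (proj₁ (⌊⌋-elim p))) (proj₁ (⌊⌋-elim q))
    ; injc = λ p q → trans (proj₁ (⌊⌋-elim p)) (sym (proj₁ (⌊⌋-elim q)))
    ; left = λ p → proj₂ (⌊⌋-elim p)
    ; right = λ p → let (e , m) = ⌊⌋-elim p in subst (_∈ˡ L) e m }

  compose : ∀ {X Y Z} → Part X Y → Part Y Z → Part X Z
  compose ρ σ = record
    { rel = λ x z → ⌊ (∃ λ y → rel ρ x y ≡ true × rel σ y z ≡ true) ⌋ ; lefts = lefts ρ ; rights = rights σ
    ; func = λ p q → let (y , a , b) = ⌊⌋-elim p ; (y′ , a′ , b′) = ⌊⌋-elim q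
                    in func σ (subst (λ z → rel σ z _ ≡ true) (func ρ a a′) b) b′
    ; injc = λ p q → let (y , a , b) = ⌊⌋-elim p ; (y′ , a′ , b′) = ⌊⌋-elim q
                    in injc ρ (subst (λ z → rel ρ _ z ≡ true) (injc σ b b′) a) a′
    ; left = λ p → let (y , a , b) = ⌊⌋-elim p in left ρ a
    ; right = λ p → let (y , a , b) = ⌊⌋-elim p in right σ b }

  empty : ∀ {X Y} → Part X Y
  empty = record { rel = λ _ _ → false ; lefts = L.[] ; rights = L.[]
                 ; func = λ () ; injc = λ () ; left = λ () ; right = λ () }

  diagonal-sym : ∀ {X} (D : List X) → diagonal D ⊑ flip (diagonal D)
  diagonal-sym D q = let (e , m) = ⌊⌋-elim q in ⌊⌋-intro (sym e , subst (_∈ˡ D) e m)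

  diagonal-⊑-left : ∀ {X Y} (ρ : Part X Y) → ρ ⊑ compose (diagonal (lefts ρ)) ρ
  diagonal-⊑-left ρ {x} h = ⌊⌋-intro (x , ⌊⌋-intro (refl , left ρ h) , h)

  diagonal-⊑-compose : ∀ {X Y} (ρ : Part X Y) {D} → (∀ {u} → u ∈ˡ D → ∃ λ x → rel ρ x u ≡ true) →
                       diagonal D ⊑ compose (flip ρ) ρ
  diagonal-⊑-compose ρ cover q = let (e , m) = ⌊⌋-elim q ; (x , h) = cover m in
    ⌊⌋-intro (x , h , subst (λ z → rel ρ x z ≡ true) e h)

  Infinite : Set → Set
  Infinite X = ∀ (L : List X) → ∃ λ x → ¬ x ∈ˡ L

  injection⇒infinite : ∀ {X : Set} (f : ℕ → X) → (∀ {i j} → f i ≡ f j → i ≡ j) → Infinite X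
  injection⇒infinite f f-inj L = stable λ none → ℕ.1+n≰n (Fin.injective⇒≤
      {f = λ i → Any.index (found none i)}
      (λ {i} {j} e → Fin.toℕ-injective (f-inj (trans (lookup-index (found none i))
        (trans (cong (L.lookup L) e) (sym (lookup-index (found none j))))))))
    where
    found : ¬ (∃ λ x → ¬ x ∈ˡ L) → ∀ (i : Fin (suc (L.length L))) → f (toℕ i) ∈ˡ L
    found none i = stable λ nm → none (f (toℕ i) , nm)

  module _ {X Y : Set} (Y-infinite : Infinite Y) where

    extend-by : ∀ (ρ : Part X Y) x → ∃ λ σ → ρ ⊑ σ × ∃ λ u → rel σ x u ≡ true
    extend-by ρ x with em {P = ∃ λ u → rel ρ x u ≡ true}
    ... | yes (u , p) = ρ , id , u , p
    ... | no fresh with Y-infinite (rights ρ)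
    ...   | u₀ , new = record
              { rel = λ y u → ⌊ Q y u ⌋ ; lefts = x L.∷ lefts ρ ; rights = u₀ L.∷ rights ρ
              ; func = λ p q → q-func (⌊⌋-elim p) (⌊⌋-elim q) ; injc = λ p q → q-inj (⌊⌋-elim p) (⌊⌋-elim q)
              ; left = λ p → q-left (⌊⌋-elim p) ; right = λ p → q-right (⌊⌋-elim p) }
          , (λ p → ⌊⌋-intro (inj₁ p)) , u₀ , ⌊⌋-intro (inj₂ (refl , refl))
      where
      Q : X → Y → Set
      Q y u = rel ρ y u ≡ true ⊎ (y ≡ x × u ≡ u₀)
      q-func : ∀ {y u v} → Q y u → Q y v → u ≡ v
      q-func (inj₁ p) (inj₁ q) = func ρ p q
      q-func (inj₁ p) (inj₂ (refl , _)) = contradiction (_ , p) fresh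
      q-func (inj₂ (refl , _)) (inj₁ q) = contradiction (_ , q) fresh
      q-func (inj₂ (_ , refl)) (inj₂ (_ , refl)) = refl
      q-inj : ∀ {y z u} → Q y u → Q z u → y ≡ z
      q-inj (inj₁ p) (inj₁ q) = injc ρ p q
      q-inj (inj₁ p) (inj₂ (_ , refl)) = contradiction (right ρ p) new
      q-inj (inj₂ (_ , refl)) (inj₁ q) = contradiction (right ρ q) new
      q-inj (inj₂ (refl , _)) (inj₂ (refl , _)) = refl
      q-left : ∀ {y u} → Q y u → y ∈ˡ x L.∷ lefts ρ
      q-left (inj₁ p) = there (left ρ p)
      q-left (inj₂ (refl , _)) = here refl
      q-right : ∀ {y u} → Q y u → u ∈ˡ u₀ L.∷ rights ρ
      q-right (inj₁ p) = there (right ρ p)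
      q-right (inj₂ (_ , refl)) = here refl

    extend-list : ∀ (ρ : Part X Y) L → ∃ λ σ → ρ ⊑ σ × (∀ {x} → x ∈ˡ L → ∃ λ u → rel σ x u ≡ true)
    extend-list ρ L.[] = ρ , id , λ ()
    extend-list ρ (x L.∷ L) with extend-list ρ L
    ... | σ , ρ⊑σ , cover with extend-by σ x
    ...   | σ′ , σ⊑σ′ , u , p = σ′ , (λ q → σ⊑σ′ (ρ⊑σ q)) , λ
              { (here refl) → u , p ; (there m) → let (v , q) = cover m in v , σ⊑σ′ q }

module FiniteSupport (em : ∀ {a} → ExcludedMiddle a) (ℓ : Level) (k : ℕ) (τ : Signature (3 + k)) where
  open Classical em
  open PartialMaps em
  open GreenBlue k
  private
    n : ℕ
    n = 3 + k
    module F (X : Set) = Frame em k (green-blue X)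
    module S (X : Set) = Algebras em ℓ k (green-blue X)

  -- Renaming moves greens only. Blues are fixed, and since clashes among greens ignore their names,
  -- clashes are preserved.
  Col : ∀ {X Y} → Part X Y → Colour₂ X → Colour₂ Y → Set
  Col ρ (inj₁ x) (inj₁ u) = rel ρ x u ≡ true
  Col ρ (inj₂ p) (inj₂ q) = p ≡ q
  Col ρ _ _ = ⊥

  col-mono : ∀ {X Y} {ρ σ : Part X Y} → ρ ⊑ σ → ∀ c d → Col ρ c d → Col σ c d
  col-mono le (inj₁ x) (inj₁ u) q = le q
  col-mono le (inj₂ _) (inj₂ _) q = q

  col-flip : ∀ {X Y} {ρ : Part X Y} c d → Col ρ c d → Col (flip ρ) d c
  col-flip (inj₁ x) (inj₁ u) q = q
  col-flip (inj₂ _) (inj₂ _) q = sym q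

  col-compose : ∀ {X Y Z} {ρ : Part X Y} {σ : Part Y Z} c d e → Col ρ c d → Col σ d e → Col (compose ρ σ) c e
  col-compose (inj₁ x) (inj₁ y) (inj₁ z) p q = ⌊⌋-intro (y , p , q)
  col-compose (inj₂ _) (inj₂ _) (inj₂ _) p q = trans p q

  col-fun : ∀ {X Y} {ρ : Part X Y} c d d′ → Col ρ c d → Col ρ c d′ → d ≡ d′
  col-fun {ρ = ρ} (inj₁ x) (inj₁ u) (inj₁ v) p q = cong inj₁ (func ρ p q)
  col-fun (inj₂ _) (inj₂ _) (inj₂ _) p q = cong inj₂ (trans (sym p) q)

  clash-map : ∀ {X Y} {ρ : Part X Y} {a b c a′ b′ c′} → Col ρ a a′ → Col ρ b b′ → Col ρ c c′ →
              Clash₂ a′ b′ c′ → Clash₂ a b c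
  clash-map {a = inj₁ _} {inj₁ _} {inj₁ _} {inj₁ _} {inj₁ _} {inj₁ _} _ _ _ _ = tt
  clash-map {a = inj₂ _} {inj₂ _} {inj₂ _} {inj₂ _} {inj₂ _} {inj₂ _} refl refl refl q = q
  clash-map {a = inj₁ _} {inj₁ _} {inj₂ _} {inj₁ _} {inj₁ _} {inj₂ _} _ _ _ ()
  clash-map {a = inj₁ _} {inj₂ _} {_} {inj₁ _} {inj₂ _} {_} _ _ _ ()
  clash-map {a = inj₂ _} {inj₁ _} {_} {inj₂ _} {inj₁ _} {_} _ _ _ ()
  clash-map {a = inj₂ _} {inj₂ _} {inj₁ _} {inj₂ _} {inj₂ _} {inj₁ _} _ _ _ ()

  -- Some extension of `L` renames `a` into `b`. Leaving the extension open makes the greens outside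
  -- `L` interchangeable.
  record Match {X Y} (L : Part X Y) (a : F.Atom X) (b : F.Atom Y) : Set where
    field
      part  : Part X Y
      above : L ⊑ part
      place : ∀ i → F.pos a i ≡ F.pos b i
      tint  : ∀ m → Col part (F.col X a m) (F.col Y b m)
  open Match

  match-flip : ∀ {X Y} {L : Part X Y} {a b} → Match L a b → Match (flip L) b a
  match-flip M = record
    { part = flip (part M) ; above = λ q → above M q ; place = λ i → sym (place M i)
    ; tint = λ m → col-flip {ρ = part M} _ _ (tint M m) }

  match-mono : ∀ {X Y} {L L′ : Part X Y} {a b} → L ⊑ L′ → Match L′ a b → Match L a b
  match-mono le M = record { part = part M ; above = λ q → above M (le q) ; place = place M ; tint = tint M }

  match-compose : ∀ {X Y Z} {L : Part X Y} {L′ : Part Y Z} {L″ : Part X Z} {a b c} → L″ ⊑ compose L L′ →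
                  Match L a b → Match L′ b c → Match L″ a c
  match-compose {L = L} {L′} le M M′ = record
    { part = compose (part M) (part M′)
    ; above = λ q → let (y , p , p′) = ⌊⌋-elim (le q) in ⌊⌋-intro (y , above M p , above M′ p′)
    ; place = λ i → trans (place M i) (place M′ i)
    ; tint = λ m → col-compose {ρ = part M} {part M′} _ _ _ (tint M m) (tint M′ m) }

  match-act : ∀ {X Y} {L : Part X Y} {a b} σ → Match L a b → Match L (F.act X a σ) (F.act Y b σ)
  match-act σ M = record { part = part M ; above = above M ; place = λ i → place M (σ i) ; tint = tint M }

  miss-resp : ∀ {X Y} {p q : Fin n → Fin n} → (∀ i → p i ≡ q i) → ∀ {θ m} → F.Miss Y (q ∘ θ) m → F.Miss X (p ∘ θ) m
  miss-resp e {θ} (inj , ms) = (λ u v q → inj u v (trans (sym (e (θ u))) (trans q (e (θ v)))))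
                             , λ l q → ms l (trans (sym (e (θ l))) q)

  greens : ∀ {X r} → (Fin r → Colour₂ X) → List X
  greens K = L.concat (L.tabulate (λ m → green (K m)))
    where
    green : ∀ {X} → Colour₂ X → List X
    green (inj₁ x) = x L.∷ L.[]
    green (inj₂ _) = L.[]

  in-greens : ∀ {X r} (K : Fin r → Colour₂ X) m {x} → K m ≡ inj₁ x → x ∈ˡ greens K
  in-greens {r = suc r} K zero e rewrite e = here refl
  in-greens {r = suc r} K (suc m) e = ∈-++⁺ʳ _ (in-greens (K ∘ suc) m e)

  module _ {X Y : Set} (Y-infinite : Infinite Y) where

    transport : ∀ (ρ : Part X Y) (a : F.Atom X) → ∃ λ σ → ρ ⊑ σ × ∃ λ b → (∀ i → F.pos a i ≡ F.pos b i) ×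
                (∀ m → Col σ (F.col X a m) (F.col Y b m))
    transport ρ a with extend-list Y-infinite ρ (greens (F.col X a))
    ... | σ , le , cover = σ , le , F.atom (F.pos a) (K , good) , (λ _ → refl) , (λ m → proj₂ (image m))
      where
      find : ∀ m c → F.col X a m ≡ c → ∃ λ d → Col σ c d
      find m (inj₂ p) e = inj₂ p , refl
      find m (inj₁ x) e = let (u , q) = cover (in-greens (F.col X a) m e) in inj₁ u , q
      image : ∀ m → ∃ λ d → Col σ (F.col X a m) d
      image m = find m (F.col X a m) refl
      K : Fin n → Colour₂ Y
      K m = proj₁ (image m)
      good : F.Good Y K
      good i j l p q r clash = proj₂ (F.sim a) i j l p q r
        (clash-map {ρ = σ} (proj₂ (image i)) (proj₂ (image j)) (proj₂ (image l)) clash)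

    match-some : ∀ (L : Part X Y) a → ∃ λ b → Match L a b
    match-some L a = let (σ , le , b , p , t) = transport L a in b , record { part = σ ; above = le ; place = p ; tint = t }

    -- Atoms related by a partial map have the same cylindrifications, because
    -- the map extends to the colours of any further atom.
    match-step : ∀ {L : Part X Y} {a a′ b} {i} → Match L a a′ → F.SameOn X (F.Off X i) a b →
                 ∃ λ b′ → Match L b b′ × F.SameOn Y (F.Off Y i) a′ b′
    match-step {L} {a} {a′} {b} {i} M s with transport (part M) b
    ... | σ , le , b′ , p , t = b′ , record { part = σ ; above = λ q → le (above M q) ; place = p ; tint = t }
        , record
            { ker  = λ {u} {v} pu pv e → trans (sym (p u)) (trans (F.ker s pu pv (trans (place M u) (trans e (sym
                (place M v))))) (p v))
            ; ker⁻ = λ {u} {v} pu pv e → trans (sym (place M u)) (trans (F.ker⁻ s pu pv (trans (p u) (trans e (sym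
                (p v))))) (place M v))
            ; lab  = λ θ off {m} {m′} x y → col-fun {ρ = σ} (F.col X a m) _ _ (col-mono {ρ = part M} {σ} le
                (F.col X a m) (F.col Y a′ m) (tint M m))
                (subst (λ c → Col σ c (F.col Y b′ m′)) (sym (F.lab s θ off (miss-resp {X} {Y} (place M) x)
                    (miss-resp {X} {Y} p y))) (t m′))
            }

  _at_ : ∀ {X} → Subset (S.atoms X) → F.Atom X → Bool
  Z at a = Func.to Z (lift a)

  Sim : ∀ {X Y} → Part X Y → Subset (S.atoms X) → Subset (S.atoms Y) → Set
  Sim {X} {Y} L Z W = ∀ a b → Match L a b → Z at a ≡ W at b

  sim-flip : ∀ {X Y} {L : Part X Y} {Z W} → Sim L Z W → Sim (flip L) W Z
  sim-flip s b a M = sym (s a b (match-flip M))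

  sim-mono : ∀ {X Y} {L L′ : Part X Y} {Z W} → L ⊑ L′ → Sim L Z W → Sim L′ Z W
  sim-mono le s a b M = s a b (match-mono le M)

  module _ {X Y : Set} (X-infinite : Infinite X) (Y-infinite : Infinite Y) where

    sim-op : ∀ (L : Part X Y) f (Zs : Vector (Subset (S.atoms X)) (arity f)) (Ws : Vector (Subset (S.atoms Y)) (arity f)) →
             (∀ l → Sim L (Zs l) (Ws l)) → Sim L (Algebra.⟦_⟧ (S.𝔉 X) f Zs) (Algebra.⟦_⟧ (S.𝔉 Y) f Ws)
    sim-op L (bool join)  Zs Ws s a b M = cong₂ _∨ᵇ_ (s zero a b M) (s (suc zero) a b M)
    sim-op L (bool meet)  Zs Ws s a b M = cong₂ _∧ᵇ_ (s zero a b M) (s (suc zero) a b M)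
    sim-op L (bool compl) Zs Ws s a b M = cong notᵇ (s zero a b M)
    sim-op L (bool top)   Zs Ws s a b M = refl
    sim-op L (bool bot)   Zs Ws s a b M = refl
    sim-op L (op (cyl i)) Zs Ws s a b M = ≡true
      (λ h → let (c , st , q) = S.cyl-out X i Zs a h ; (d , N , st′) = match-step Y-infinite M st in
             S.cyl-in Y i Ws b d st′ (trans (sym (s zero c d N)) q))
      (λ h → let (d , st , q) = S.cyl-out Y i Ws b h ; (c , N , st′) = match-step X-infinite (match-flip M) st in
             S.cyl-in X i Zs a c st′ (trans (s zero c d (match-flip N)) q))
    sim-op L (op (ext (diag i j) _)) Zs Ws s a b M = ⌊⌋-cong
      (λ { (_ , _ , lift e) → [] , (λ ()) , lift (trans (sym (place M i)) (trans e (place M j))) })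
      (λ { (_ , _ , lift e) → [] , (λ ()) , lift (trans (place M i) (trans e (sym (place M j)))) })
    sim-op L (op (ext (repl i j) _)) Zs Ws s a b M = trans (S.repl-at X i j Zs a)
      (trans (s zero _ _ (match-act [ i ∣ j ] M)) (sym (S.repl-at Y i j Ws b)))
    sim-op L (op (ext (swap i j) _)) Zs Ws s a b M = trans (S.swap-at X i j Zs a)
      (trans (s zero _ _ (match-act (transpose i j) M)) (sym (S.swap-at Y i j Ws b)))

  -- Similarity to itself over the identity on `D` means invariance under all renamings that fix
  -- `D`.
  Supported : ∀ {X} → Subset (S.atoms X) → Set
  Supported {X} Z = ∃ λ (D : List X) → Sim (diagonal D) Z Z

  common-support : ∀ {X r} (Zs : Vector (Subset (S.atoms X)) r) → (∀ l → Supported (Zs l)) →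
                   ∃ λ (D : List X) → ∀ l → Sim (diagonal D) (Zs l) (Zs l)
  common-support {r = zero}  Zs sup = L.[] , λ ()
  common-support {r = suc r} Zs sup with common-support (Zs ∘ suc) (sup ∘ suc)
  ... | D , s = proj₁ (sup zero) L.++ D , λ
        { zero    → sim-mono {L = diagonal (proj₁ (sup zero))} {Z = Zs zero} {Zs zero}
                      (λ q → let (e , m) = ⌊⌋-elim q in ⌊⌋-intro (e , ∈-++⁺ˡ m)) (proj₂ (sup zero))
        ; (suc l) → sim-mono {L = diagonal D} {Z = Zs (suc l)} {Zs (suc l)}
                      (λ q → let (e , m) = ⌊⌋-elim q in ⌊⌋-intro (e , ∈-++⁺ʳ (proj₁ (sup zero)) m)) (s l) }

  supported : ∀ {X} → Infinite X → Subuniverse (S.𝔉 X)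
  supported {X} inf = record
    { Member   = λ Z → Lift ℓ (Supported Z)
    ; respects = λ { e (lift (D , s)) → lift (D , λ a b M → trans (sym (e (lift a))) (trans (s a b M) (e (lift b)))) }
    ; closed   = λ f Zs m → let (D , s) = common-support Zs (lower ∘ m) in lift (D , sim-op inf inf (diagonal D) f Zs Zs s)
    }

  -- The greens occurring in `a` support it: a renaming that fixes them changes no colour visible in
  -- a tuple of the same type.
  singleton-supported : ∀ {X} (a : F.Atom X) → Supported (S.singleton X a)
  singleton-supported {X} a = D , λ b c M → ⌊⌋-cong (go M) (go (match-mono (diagonal-sym D) (match-flip M)))
    where
    D : List X
    D = greens (F.col X a)
    go : ∀ {b c} → Match (diagonal D) b c → F.Same X a b → F.Same X a c
    go {b} {c} M s = record
      { ker  = λ {u} {v} _ _ e → trans (sym (place M u)) (trans (F.ker s tt tt e) (place M v))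
      ; ker⁻ = λ {u} {v} _ _ e → F.ker⁻ s tt tt (trans (place M u) (trans e (sym (place M v))))
      ; lab  = λ θ _ {m} {m′} x y → trans (F.lab s θ _ x (miss-resp {X} {X} (place M) y)) (fixed (F.col X b m′)
          (F.col X c m′)
                 (λ e → in-greens (F.col X a) m (trans (F.lab s θ _ x (miss-resp {X} {X} (place M) y)) e)) (tint M m′))
      }
      where
      fixed : ∀ c d → (∀ {x} → c ≡ inj₁ x → x ∈ˡ D) → Col (part M) c d → c ≡ d
      fixed (inj₁ x) (inj₁ u) mem q = cong inj₁ (func (part M) (above M (⌊⌋-intro (refl , mem refl))) q)
      fixed (inj₂ _) (inj₂ _) mem q = cong inj₂ q

  dense : ∀ {X} → Infinite X → S.Dense X
  dense {X} inf = record
    { algebra   = subalgebra (S.𝔉 X) (supported inf)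
    ; inclusion = record { map = proj₁ ; map-cong = id ; map-inj = id ; map-homo = λ _ _ _ → refl }
    ; single    = λ a → S.singleton X a , lift (singleton-supported a)
    ; single-at = λ _ _ → refl
    }

  A : ∀ {X} → Infinite X → Algebra τ ℓ
  A {X} inf = S.DenseAlgebra.A X (dense inf) τ

  module Game {X Y : Set} (X-infinite : Infinite X) (Y-infinite : Infinite Y) where
    private
      AX = A X-infinite
      AY = A Y-infinite

    Related : ∀ {m} → Part X Y → Vector (Algebra.Carrier AX) m → Vector (Algebra.Carrier AY) m → Set
    Related ρ zs ws = ∀ j → Sim ρ (proj₁ (zs j)) (proj₁ (ws j))

    sim-eval : ∀ {m} ρ (zs : Vector (Algebra.Carrier AX) m) ws → Related ρ zs ws → ∀ t →
               Sim ρ (proj₁ (eval AX zs t)) (proj₁ (eval AY ws t))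
    sim-eval ρ zs ws r (var x) = r x
    sim-eval ρ zs ws r (fun (bool b) ts) =
      sim-op X-infinite Y-infinite ρ (bool b) (proj₁ ∘ eval AX zs ∘ ts) (proj₁ ∘ eval AY ws ∘ ts)
          (λ l → sim-eval ρ zs ws r (ts l))
    sim-eval ρ zs ws r (fun (op (cyl i)) ts) =
      sim-op X-infinite Y-infinite ρ (op (cyl i)) (proj₁ ∘ eval AX zs ∘ ts) (proj₁ ∘ eval AY ws ∘ ts)
          (λ l → sim-eval ρ zs ws r (ts l))
    sim-eval ρ zs ws r (fun (op (ext e p)) ts) =
      sim-op X-infinite Y-infinite ρ (op (ext e tt)) (proj₁ ∘ eval AX zs ∘ ts) (proj₁ ∘ eval AY ws ∘ ts)
          (λ l → sim-eval ρ zs ws r (ts l))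

    -- One move of the back-and-forth game. The map is first extended until its range covers the
    -- support `D` of `w`; then the preimage of `w` under matching is a similar element, supported
    -- by the domain list.
    answer : ∀ ρ (w : Algebra.Carrier AY) → ∃ λ σ → ρ ⊑ σ × ∃ λ (z : Algebra.Carrier AX) → Sim σ (proj₁ z) (proj₁ w)
    answer ρ (W , lift (D , sW)) with extend-list X-infinite (flip ρ) D
    ... | σ′ , le , cover = σ , (λ q → le q) , (Z , lift (lefts σ , sZ)) , simulates
      where
      σ : Part X Y
      σ = flip σ′
      Meets : F.Atom X → Set
      Meets a = ∃ λ b → Match σ a b × W at b ≡ true
      -- The preimage has to respect equality of types: the renaming of `a` is extended to `c`, and
      -- the image of `c` has the same type as the partner of `a`.
      shift : ∀ {a c} → F.Same X a c → Meets a → Meets c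
      shift {a} {c} s (b , M , q) with match-step Y-infinite {i = zero} M (F.weaken X _ s)
      ... | b′ , M′ , s′ = b″ , N , trans (sW b″ b″ refl-match) (trans (Func.cong W (lift (F.same-sym Y same))) q)
        where
        next = match-some Y-infinite (part M) c
        b″ = proj₁ next
        N : Match σ c b″
        N = match-mono {L = σ} {part M} (above M) (proj₂ next)
        refl-match : Match (diagonal D) b″ b″
        refl-match = match-compose (diagonal-⊑-compose σ cover)
                       (match-flip N) N
        same : F.Same Y b b″
        same = record
          { ker  = λ {u} {v} _ _ e → trans (sym (place N u)) (trans (F.ker s tt tt (trans (place M u) (trans e (sym
              (place M v))))) (place N v))
          ; ker⁻ = λ {u} {v} _ _ e → trans (sym (place M u)) (trans (F.ker⁻ s tt tt (trans (place N u) (trans e (sym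
              (place N v))))) (place M v))
          ; lab  = λ θ _ {m} {m′} x y → col-fun {ρ = part (proj₂ next)} (F.col X a m) _ _
              (col-mono {ρ = part M} {part (proj₂ next)} (above (proj₂ next)) (F.col X a m) (F.col Y b m) (tint M m))
              (subst (λ c → Col (part (proj₂ next)) c (F.col Y b″ m′)) (sym (F.lab s θ _ (miss-resp {X} {Y}
                  (place M) x) (miss-resp {X} {Y} (place N) y))) (tint (proj₂ next) m′))
          }
      Z : Subset (S.atoms X)
      Z = record { to = λ a → ⌊ Meets (lower a) ⌋
                 ; cong = λ s → ⌊⌋-cong (shift (lower s)) (shift (F.same-sym X (lower s))) }
      carry : ∀ {a c} → Match (diagonal (lefts σ)) c a → Meets a → Meets c
      carry N (b , M , q) = b , match-compose (diagonal-⊑-left σ) N M , q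
      sZ : Sim (diagonal (lefts σ)) Z Z
      sZ a c N = ⌊⌋-cong (carry (match-mono (diagonal-sym (lefts σ)) (match-flip N))) (carry N)
      simulates : Sim σ Z W
      simulates a b M = ≡true
        (λ h → let (b′ , M′ , q) = ⌊⌋-elim h in trans (sW b b′ (match-compose
          (diagonal-⊑-compose σ cover)
          (match-flip M) M′)) q)
        (λ h → ⌊⌋-intro (b , M , h))

  module _ {X Y : Set} (X-infinite : Infinite X) (Y-infinite : Infinite Y) where
    open Game X-infinite Y-infinite
    private
      module Back = Game Y-infinite X-infinite
      AX = A X-infinite
      AY = A Y-infinite

    same-theory : ∀ {m} (φ : Formula τ m) ρ (zs : Vector (Algebra.Carrier AX) m) ws → Related ρ zs ws →
                  (Satisfies AX zs φ → Satisfies AY ws φ) × (Satisfies AY ws φ → Satisfies AX zs φ)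
    same-theory (t ≐ u) ρ zs ws r =
        (λ e → λ { (lift b) → let (a , M) = match-some X-infinite (flip ρ) b in
            trans (sym (sim-eval ρ zs ws r t a b (match-flip M))) (trans (e (lift a)) (sim-eval ρ zs ws r u a b
                (match-flip M))) })
      , (λ e → λ { (lift a) → let (b , M) = match-some Y-infinite ρ a in
            trans (sim-eval ρ zs ws r t a b M) (trans (e (lift b)) (sym (sim-eval ρ zs ws r u a b M))) })
    same-theory ⊥̇ ρ zs ws r = (λ ()) , λ ()
    same-theory (φ ⇒ ψ) ρ zs ws r =
        (λ s h → proj₁ (same-theory ψ ρ zs ws r) (s (proj₂ (same-theory φ ρ zs ws r) h)))
      , (λ s h → proj₂ (same-theory ψ ρ zs ws r) (s (proj₁ (same-theory φ ρ zs ws r) h)))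
    same-theory (∀̇ φ) ρ zs ws r =
        (λ s w → let (σ , le , z , sim) = answer ρ w in
            proj₁ (same-theory φ σ (z ∷ zs) (w ∷ ws) (λ { zero → sim
              ; (suc j) → sim-mono {L = ρ} {σ} {proj₁ (zs j)} {proj₁ (ws j)} le (r j) })) (s z))
      , (λ s z → let (σ , le , w , sim) = Back.answer (flip ρ) z in
            proj₂ (same-theory φ (flip σ) (z ∷ zs) (w ∷ ws) (λ { zero → sim-flip {L = σ} {proj₁ w} {proj₁ z} sim
              ; (suc j) → sim-mono {L = ρ} {flip σ} {proj₁ (zs j)} {proj₁ (ws j)} (λ q → le q) (r j) })) (s w))

    theory-⊨ : ∀ {Γ : Pred (Sentence τ) 0ℓ} → AX ⊨ Γ → AY ⊨ Γ
    theory-⊨ m φ φ∈Γ = proj₁ (same-theory φ empty [] [] (λ ())) (m φ φ∈Γ)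

-- Uncountability as a notion of largeness

module Cantor (em : ∀ {a} → ExcludedMiddle a) where
  open Classical em

  Countable : ((ℕ → Bool) → Set) → Set
  Countable W = ∃ λ (φ : (ℕ → Bool) → ℕ) → ∀ x y → W x → W y → φ x ≡ φ y → x ≡ y

  -- Diagonalisation: excluded middle inverts `φ` on its range, and at the number of `d` the inverse
  -- is `d` itself.
  cantor : ¬ Countable (λ _ → ⊤)
  cantor (φ , inj) = Bool.not-¬ refl (flips em)
    where
    hit : ∀ m → Dec (∃ λ f → φ f ≡ m) → Bool
    hit m (yes (f , _)) = notᵇ (f m)
    hit m (no _)        = true
    d : ℕ → Bool
    d m = hit m em
    flips : ∀ D → hit (φ d) D ≡ notᵇ (d (φ d))
    flips (yes (f , e)) = cong (λ g → notᵇ (g (φ d))) (inj f d tt tt e)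
    flips (no none)     = contradiction (d , refl) none

  countable-minus : ∀ {W u} → Countable (λ v → W v × v ≢ u) → Countable W
  countable-minus {W} {u} (φ , inj) = (λ x → number x em) , λ x y Wx Wy → number-inj Wx Wy em em
    where
    number : ∀ x → Dec (x ≡ u) → ℕ
    number x (yes _) = 0
    number x (no _)  = suc (φ x)
    number-inj : ∀ {x y} → W x → W y → ∀ D D′ → number x D ≡ number y D′ → x ≡ y
    number-inj Wx Wy (yes refl) (yes refl) e = refl
    number-inj Wx Wy (no p) (no q) e = inj _ _ (Wx , p) (Wy , q) (ℕ.suc-injective e)

  module _ {L : Set} (code : L → ℕ) (code-inj : ∀ {l l′} → code l ≡ code l′ → l ≡ l′) where

    -- Countability is a Σ-type, so `part` already supplies an injection for every fibre at once.
    countable-union : ∀ {W} (β : (ℕ → Bool) → L) → (∀ l → Countable (λ v → W v × β v ≡ l)) → Countable W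
    countable-union {W} β part = φ , inj
      where
      φ : (ℕ → Bool) → ℕ
      φ x = pair (code (β x)) (proj₁ (part (β x)) x)
      inj : ∀ x y → W x → W y → φ x ≡ φ y → x ≡ y
      inj x y Wx Wy e = let (p , q) = pair-inj e ; βx≡βy = code-inj p in
        proj₂ (part (β x)) x y (Wx , refl) (Wy , sym βx≡βy)
          (trans q (cong (λ l → proj₁ (part l) y) (sym βx≡βy)))

    uncountability : ∀ k → Obstructions.Largeness em k (ℕ → Bool) L
    uncountability k = record
      { Large       = λ W → ¬ Countable W
      ; large-all   = cantor
      ; large-some  = λ large → stable λ none → large ((λ _ → 0) , λ x _ Wx _ _ → contradiction (x , Wx) none)
      ; large-minus = λ large u small → large (countable-minus small)
      ; large-split = λ large β → stable λ none → large (countable-union β (λ l → stable λ ¬c → none (l , ¬c)))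
      }

-- Failure of elementarity when all ultrafilters on ℕ are principal

module PrincipalCase (em : ∀ {a} → ExcludedMiddle a) (ℓ : Level) (k : ℕ) (τ : Signature (3 + k))
                     (principal : (J : Uf ℕ) → ∃ λ x → Quantifier.Most em J (_≡ x)) where
  open Classical em
  open Quantifier em
  open PartialMaps em
  open FiniteSupport em ℓ k τ
  open GreenBlue k
  private
    n : ℕ
    n = 3 + k
    1F 2F : Fin n
    1F = suc zero
    2F = suc (suc zero)
    module G = Algebras em ℓ k (green-blue ℕ)

  ℕ-infinite : Infinite ℕ
  ℕ-infinite = injection⇒infinite id id

  indicator-inj : ∀ {i j : ℕ} → (λ l → ⌊ l ≡ i ⌋) ≡ (λ l → ⌊ l ≡ j ⌋) → i ≡ j
  indicator-inj {i} e = ⌊⌋-elim (trans (sym (cong (λ f → f i) e)) (⌊⌋-intro refl))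

  reals-infinite : Infinite (ℕ → Bool)
  reals-infinite = injection⇒infinite (λ i l → ⌊ l ≡ i ⌋) indicator-inj

  A∈Kₛ : ∀ {κ} {K : Pred (Algebra τ ℓ) κ} → Between K → A ℕ-infinite ∈ (_ₛ em K)
  A∈Kₛ between = G.DenseAlgebra.dense∈Kₛ (dense ℕ-infinite) τ between (Numbers.number-model em k principal)

  private
    X : Set
    X = ℕ → Bool
  open Frame em k (green-blue X) hiding (n)
  open Faces em k (green-blue X)
  open Algebras em ℓ k (green-blue X) using (module DenseAlgebra)
  open DenseAlgebra (dense reals-infinite) τ using (AtA; point; unpoint; unpoint-cong; unpoint-point; R-iff)
  open Obstructions em k using (Step)

  unpoint-step : ∀ {l α β} → Step AtA l α β → SameOn (Off l) (unpoint α) (unpoint β)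
  unpoint-step {l} {α} {β} st = proj₁ (R-iff (cyl l) α (λ _ → β)) st

  point-step : ∀ {l α b} → SameOn (Off l) (unpoint α) b → Step AtA l α (point b)
  point-step {l} {α} {b} s = proj₂ (R-iff (cyl l) α (λ _ → point b)) (same-trans s (weaken _ (same-sym (unpoint-point b))))

  -- Three greens always clash, so two green faces of a simplex force the third one to be blue.
  two-greens : ∀ {x y a} → Inj (pos a) → FaceCol 1F (inj₁ x) a → FaceCol zero (inj₁ y) a →
               ∃ λ l → col a (pos a 2F) ≡ inj₂ l
  two-greens {x} {y} {a} inj f g = third (col a (pos a 2F)) refl
    where
    third : ∀ c → col a (pos a 2F) ≡ c → ∃ λ l → c ≡ inj₂ l
    third (inj₂ l) _ = l , refl
    third (inj₁ z) e = ⊥-elim (proj₂ (sim a) (pos a zero) (pos a 1F) (pos a 2F)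
      (λ q → case inj _ _ q of λ ()) (λ q → case inj _ _ q of λ ()) (λ q → case inj _ _ q of λ ())
      (subst₂ (λ c c′ → Clash₂ c c′ (col a (pos a 2F))) (faceCol-unique {a = a} g (faceCol-generic {a} inj zero))
        (faceCol-unique {a = a} f (faceCol-generic {a} inj 1F)) (subst (Clash₂ (inj₁ y) (inj₁ x)) (sym e) tt)))

  blue-code : ℕ × Fin n → ℕ
  blue-code (p , i) = pair p (toℕ i)

  blue-code-inj : ∀ {l l′} → blue-code l ≡ blue-code l′ → l ≡ l′
  blue-code-inj e = let (p , q) = pair-inj e in cong₂ _,_ p (Fin.toℕ-injective q)

  principal-blue : (J : Uf (ℕ × Fin n)) → ∃ λ l → Most J (_≡ l)
  principal-blue J with principal (mapᵘ blue-code J)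
  ... | x , m with most-some J {P = λ l → blue-code l ≡ x} m
  ...   | l , refl = l , most-mono J (λ _ → blue-code-inj) m

  -- Over the ultrafilter on a one-element set, sequences of atoms are just atoms, and both cases
  -- share one obstruction.
  sequential : SequencesModulo.Sequential em k (pure tt) (λ _ → green-blue X) AtA
  sequential = record
    { rep        = λ α _ → unpoint α
    ; rep-cong   = λ {α} {β} e → ⌊⌋-intro (unpoint-cong {α} {β} e)
    ; rep-step   = λ {l} {α} {β} st → ⌊⌋-intro (unpoint-step {l} {α} {β} st)
    ; V          = X
    ; apex       = λ x _ → inj₁ x
    ; apex-inj   = λ e → green-inj (⌊⌋-elim e)
    ; fetch-E    = λ l i j α ex → let (b , s , e) = ⌊⌋-elim ex in
        point b , point-step {l} {α} s , ⌊⌋-intro (ker (same-sym (unpoint-point b)) tt tt e)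
    ; fetch-apex = λ l x α ex → let (b , s , inj , f) = ⌊⌋-elim ex ; u = same-sym (unpoint-point b) in
        point b , point-step {l} {α} s
        , ⌊⌋-intro ((λ i j e → inj i j (ker⁻ u tt tt e)) , faceCol-same {a = b} (weaken _ u) f)
    ; generic    = let a = atom id (proj₁ (extend₁ zero (inj₂ (0 , zero)))) in
        point a , ⌊⌋-intro (λ i j e → ker (unpoint-point a) tt tt e)
    ; M          = ℕ
    ; r          = n
    ; default    = 0 , zero
    -- The blue colours are countably many, so an uncountable set has an uncountable fibre.
    ; large      = Cantor.uncountability em blue-code blue-code-inj k
    ; principal  = principal-blue
    ; Cl         = λ c l → c tt ≡ inj₂ l
    ; Cl-func    = λ e p q → blue-inj (trans (sym p) (trans (⌊⌋-elim e) q))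
    ; Cl-some    = λ {_} {_} {α} _ g f f′ → two-greens {a = unpoint α} (⌊⌋-elim g) (⌊⌋-elim f) (⌊⌋-elim f′)
    ; Cl-clash   = λ ok → blue-clash (⌊⌋-elim ok)
    }
    where
    green-inj : ∀ {x y : X} → _≡_ {A = Colour₂ X} (inj₁ x) (inj₁ y) → x ≡ y
    green-inj refl = refl
    blue-inj : ∀ {l l′} → _≡_ {A = Colour₂ X} (inj₂ l) (inj₂ l′) → l ≡ l′
    blue-inj refl = refl
    blue-clash : ∀ {c c′ c″ : Colour₂ X} {m m′ q} → ¬ Clash₂ c c′ c″ →
                 c″ ≡ inj₂ (m , q) → c′ ≡ inj₂ (m , q) → c ≡ inj₂ (m′ , q) → ⊥
    blue-clash ok refl refl refl = ok (refl , refl , inj₂ (inj₂ refl))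

  not-elementary : ∀ {κ} {K : Pred (Algebra τ ℓ) κ} → Between K → ¬ Elementary (_ₛ em K)
  not-elementary between (Γ , iff) = Obstructions.obstruction⇒¬representable em k AtA
      (SequencesModulo.obstruction em k (pure tt) (λ _ → green-blue X) sequential)
      (proj₂ (proj₂ (proj₂ (Equivalence.from (iff (A reals-infinite))
        (theory-⊨ ℕ-infinite reals-infinite (Equivalence.to (iff (A ℕ-infinite)) (A∈Kₛ between)))))))

module _ (em : ∀ {a} → ExcludedMiddle a) where
  open Classical em
  open Quantifier em

  all-principal : ¬ (∃ λ (𝓓 : Uf ℕ) → ∀ x → Most 𝓓 (_≢ x)) → (J : Uf ℕ) → ∃ λ x → Most J (_≡ x)
  all-principal none J = stable λ nowhere → none (J , λ x → most-¬ J (λ m → nowhere (x , m)))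

corollary6p15 :
  (em : ∀ {a} → ExcludedMiddle a) →
  ∀ {ℓ k : Level} (n : ℕ) → 2 < n →
  (τ : Signature n) (K : Pred (Algebra τ ℓ) k) → Between K →
  ¬ Elementary (_ₛ em K)
corollary6p15 em {ℓ} (suc (suc (suc k′))) (s≤s (s≤s (s≤s _))) τ K between
  with em {P = ∃ λ (𝓓 : Uf ℕ) → ∀ x → Quantifier.Most em 𝓓 (_≢ x)}
... | yes (𝓓 , nonprincipal) = UltrafilterCase.not-elementary em ℓ k′ τ 𝓓 nonprincipal between
... | no none                 = PrincipalCase.not-elementary em ℓ k′ τ (all-principal em none) between
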